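{- Let $q$ be an odd prime and let $m$ be an odd positive integer such that either $q^2 \mid m$ or $p \mid m$ for some prime $p \equiv 1 \pmod{q}$. Let $\alpha$ be an automorphism of the cyclic group $\mathbb{Z}_m$ of order $q$. Then $G = \mathbb{Z}_q \ltimes_\alpha \mathbb{Z}_m$ is sequenceable.
   Context: $\mathbb{Z}_q \ltimes_\alpha \mathbb{Z}_m$ is the set $\{(u,v): u\in\mathbb{Z}_q, v\in \mathbb{Z}_m\}$ with multiplication $(u,v)(x,y) = (u+x, \alpha^x(v)+y)$. A group $G$ of order $n$ is sequenceable if there is an arrangement $(a_1,\ldots,a_n)$ of its elements such that $a_1^{ -1}a_2, a_2^{ -1}a_3, \ldots, a_{n-1}^{ -1}a_n$ are exactly the non-identity elements of $G$, each once. -}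

module Defs where

open import Data.Nat using (ℕ; zero; suc; _+_; _∸_; _%_; _<_; NonZero)
open import Data.Nat.DivMod using (m%n<n)
open import Data.Fin using (Fin; toℕ; fromℕ<)
open import Data.Product using (_×_; _,_; ∃)
open import Data.List using (List; []; _∷_)
open import Data.List.Relation.Unary.Unique.Propositional using (Unique)
open import Data.List.Membership.Propositional using (_∈_)
open import Relation.Binary.PropositionalEquality using (_≡_)
open import Relation.Nullary using (¬_)
open import Function.Definitions using (Injective; Surjective)

iter : {A : Set} → (A → A) → ℕ → A → A
iter f zero    x = x
iter f (suc k) x = f (iter f k x)

addMod : ∀ n .{{_ : NonZero n}} → Fin n → Fin n → Fin n
addMod n a b = fromℕ< (m%n<n (toℕ a + toℕ b) n)

negMod : ∀ n .{{_ : NonZero n}} → Fin n → Fin n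
negMod n a = fromℕ< (m%n<n (n ∸ toℕ a) n)

zeroMod : ∀ n .{{_ : NonZero n}} → Fin n
zeroMod n = fromℕ< (m%n<n 0 n)

IsAutomorphism : ∀ m .{{_ : NonZero m}} → (Fin m → Fin m) → Set
IsAutomorphism m α =
  (∀ x y → α (addMod m x y) ≡ addMod m (α x) (α y))
  × Injective _≡_ _≡_ α × Surjective _≡_ _≡_ α

HasOrder : ∀ m → (Fin m → Fin m) → ℕ → Set
HasOrder m α k =
  (∀ x → iter α k x ≡ x)
  × (∀ j → 0 < j → j < k → ¬ (∀ x → iter α j x ≡ x))

SD : ℕ → ℕ → Set
SD q m = Fin q × Fin m

module SemiDirect (q m : ℕ) .{{_ : NonZero q}} .{{_ : NonZero m}}
                  (α : Fin m → Fin m) where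

  mul : SD q m → SD q m → SD q m
  mul (u , v) (x , y) = addMod q u x , addMod m (iter α (toℕ x) v) y

  e : SD q m
  e = zeroMod q , zeroMod m

  -- inverse of (u,v) is (-u, -α^{-u}(v)), where α^{-u} = α^{(q - u) mod q}
  inv : SD q m → SD q m
  inv (u , v) = negMod q u , negMod m (iter α (toℕ (negMod q u)) v)

  quotients : List (SD q m) → List (SD q m)
  quotients []           = []
  quotients (a ∷ [])     = []
  quotients (a ∷ b ∷ as) = mul (inv a) b ∷ quotients (b ∷ as)

  Sequenceable : Set
  Sequenceable = ∃ λ (as : List (SD q m)) →
      Unique as × (∀ g → g ∈ as)
    × Unique (quotients as)
    × (∀ g → g ∈ quotients as → ¬ g ≡ e)
    × (∀ g → ¬ g ≡ e → g ∈ quotients as)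

{-# OPTIONS --safe #-}
-- If (u , w) stands for the element (u , rᵘ w), where r = α(1), then the step from (u , w) to (u′ , w′)
-- has the quotient (u′ - u , r^u′ (w′ - w)).
-- With q = 2h + 1, the tour projects to the closed walk in ℤ/q
--   0 … 0, 1 -1 … 1 -1, 2 -2 … 2 -2, …, h -h … h -h, -h h … -h h, …, -1 1 … -1 1, 0.
-- Between the cosets i and -i put y = 2x on the way out and x = π(y/2) on the way back, for a
-- permutation π of ℤ/m with two cycles such that x ↦ 2x - π(x) is bijective: the first visit of the pair
-- runs through the first cycle and the second visit through the second one. Every quotient with first
-- component ±2i then occurs except for one of each sign, and these are supplied by the links between
-- the pairs h - i and h - i + 1 (or 0 and 1) once the pieces are placed suitably. The visits to 0 follow a
-- zigzag through the non-zero residues with all non-zero differences but one, and the missing one is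
-- supplied by the turning point -h, -h; this is where r ≠ 1 enters. With σ = r^h the offsets match if the
-- zigzag runs from σ² - 1 to σ² + 1 and the cycles are cut suitably, which can be achieved because the
-- zigzag contains almost every edge {v , -1-v} and the permutations are translations on long intervals.
module Submission where

open import Defs
open import Data.Nat using (ℕ; _%_; _^_; NonZero)
open import Data.Nat.Divisibility using (_∣_)
open import Data.Nat.Primality using (Prime)
open import Data.Fin using (Fin)
open import Data.Product using (_×_; ∃)
open import Data.Sum using (_⊎_)
open import Relation.Binary.PropositionalEquality using (_≡_)

open import Data.Nat as ℕ using (zero; suc)
import Data.Nat.Properties as ℕₚ
import Data.Nat.Divisibility as ℕ∣
open import Data.Nat.Divisibility using (_∣?_)
open import Data.Nat.DivMod using (_/_; m≡m%n+[m/n]*n; m%n<n; m<n⇒m%n≡m)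
open import Data.Nat.Primality using (prime⇒nonTrivial)
import Data.Nat.Tactic.RingSolver as ℕ-Solver
open import Data.Integer as ℤ using (ℤ; +_; -[1+_]; _+_; _*_; _-_; -_; 0ℤ; 1ℤ; _%ℕ_; _/ℕ_)
import Data.Integer.Properties as ℤₚ
import Data.Integer.DivMod as ℤᵈ
open import Data.Integer.Divisibility.Signed using (divides; ∣m∣n⇒∣m+n; ∣n⇒∣m*n; ∣⇒∣ᵤ) renaming (_∣_ to _∣ℤ_)
open import Data.Integer.Tactic.RingSolver using (solve-∀)
open import Data.Fin as Fin using (toℕ; fromℕ<)
import Data.Fin.Properties as Finₚ
open import Data.List using (List; []; _∷_; _++_; _∷ʳ_; length; map; reverse; lookup)
open import Data.List.Properties using (++-assoc; length-++; map-++; length-map; reverse-++; unfold-reverse; length-reverse; tabulate-lookup)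
open import Data.List.Membership.Propositional using (_∈_)
open import Data.List.Membership.Propositional.Properties using (∈-++⁺ˡ; ∈-++⁺ʳ; ∈-++⁻; ∈-map⁺)
open import Data.List.Relation.Unary.All as All using ()
open import Data.List.Relation.Unary.AllPairs as AllPairs using ()
open import Data.List.Relation.Unary.Any as Any using (here; there)
open import Data.List.Relation.Unary.Any.Properties using (lookup-index; reverse⁺)
open import Data.List.Relation.Unary.Unique.Propositional using (Unique)
import Data.List.Relation.Unary.Unique.Propositional.Properties as Uniqueₚ
open import Data.Product using (∃₂; _,_; proj₁; proj₂)
open import Data.Product.Properties using (≡-dec)
open import Data.Sum using (inj₁; inj₂; [_,_]′)
open import Function using (_∘_)
open import Relation.Nullary using (¬_; yes; no; contradiction)
open import Relation.Nullary.Decidable using (False; toWitnessFalse)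
open import Relation.Binary.PropositionalEquality

-- Walks and adjacency in lists

-- Repetitions are never excluded directly: elements and quotients are only shown to be exhausted,
-- and counting does the rest. The constants come from the offsets. Scale a pair by c and cut its
-- cycles so that x₁ = p + 1 and x₀ = p - ζ. The pair is then left c (1 + ζ) below the point where
-- it was entered. Suppose that every pair has the same drop g and that the link to the next pair
-- gets the label replacing a missing one. The link back then has the right label iff c (1 - ζ)(1 -
-- σ) = 0, which suggests ζ = 1 and c = g/2 outside the pair h, -h. At that pair the turn has the
-- label -2cζ, which must be -2σ to yield the quotient -2; with c = 1 this gives ζ = σ and g = 1 +
-- σ. Closing up in the coset 0 forces the zigzag to end at σ² + 1, and its missing step -2 makes it
-- start at σ² - 1. The second ingredient is that q is odd: since σ^q = 1, σ is neither 0 nor -1, it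
-- is 1 modulo 3 if 3 divides m, and 1 + σ is a unit. This avoids the values of ζ for which the cuts
-- fail.

data Adj {A : Set} (a b : A) : List A → Set where
  here  : ∀ {l} → Adj a b (a ∷ b ∷ l)
  there : ∀ {x l} → Adj a b l → Adj a b (x ∷ l)

module _ {A : Set} where

  adj-++ˡ : ∀ {a b : A} {l} k → Adj a b l → Adj a b (l ++ k)
  adj-++ˡ k here      = here
  adj-++ˡ k (there p) = there (adj-++ˡ k p)

  adj-++ʳ : ∀ {a b : A} k {l} → Adj a b l → Adj a b (k ++ l)
  adj-++ʳ []      p = p
  adj-++ʳ (x ∷ k) p = there (adj-++ʳ k p)

  adj-mid : ∀ {a b : A} k l → Adj a b (k ++ a ∷ b ∷ l)
  adj-mid k l = adj-++ʳ k here

  adj-split : ∀ {a b : A} {l} → Adj a b l → ∃₂ λ k k′ → l ≡ k ++ a ∷ b ∷ k′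
  adj-split {l = _ ∷ _ ∷ l} here = [] , l , refl
  adj-split {l = x ∷ _} (there p) with adj-split p
  ... | k , k′ , refl = x ∷ k , k′ , refl

  adj-cut : ∀ {a b : A} k c l → Adj a b (k ++ c ∷ l) → Adj a b (k ∷ʳ c) ⊎ Adj a b (c ∷ l)
  adj-cut []          c l p         = inj₂ p
  adj-cut (x ∷ [])    c l here      = inj₁ here
  adj-cut (x ∷ y ∷ k) c l here      = inj₁ here
  adj-cut (x ∷ k)     c l (there p) = [ inj₁ ∘ there , inj₂ ]′ (adj-cut k c l p)

  adj-glue : ∀ {a b : A} k c l → Adj a b (k ∷ʳ c) → Adj a b (k ++ c ∷ l)
  adj-glue k c l p = subst (Adj _ _) (++-assoc k (c ∷ []) l) (adj-++ˡ l p)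

  adj-reverse : ∀ {a b : A} {l} → Adj a b l → Adj b a (reverse l)
  adj-reverse {a} {b} p with adj-split p
  ... | k , k′ , refl = subst (Adj b a) (sym eq) (adj-mid (reverse k′) (reverse k))
    where
    eq : reverse (k ++ a ∷ b ∷ k′) ≡ reverse k′ ++ b ∷ a ∷ reverse k
    eq = begin
      reverse (k ++ a ∷ b ∷ k′)                    ≡⟨ reverse-++ k _ ⟩
      reverse (a ∷ b ∷ k′) ++ reverse k            ≡⟨ cong (_++ reverse k) (reverse-++ (a ∷ b ∷ []) k′) ⟩
      (reverse k′ ++ b ∷ a ∷ []) ++ reverse k      ≡⟨ ++-assoc (reverse k′) _ _ ⟩
      reverse k′ ++ b ∷ a ∷ reverse k              ∎
      where open ≡-Reasoning

  adj-successor : ∀ {a : A} c l → a ∈ c ∷ l → ∀ {d} → ∃ λ b → Adj a b (c ∷ l ∷ʳ d)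
  adj-successor c []      (here refl) = _ , here
  adj-successor c (x ∷ l) (here refl) = _ , here
  adj-successor c (x ∷ l) (there p) with adj-successor x l p
  ... | b , q = b , there q

adj-map : ∀ {A B : Set} (f : A → B) {a b l} → Adj a b l → Adj (f a) (f b) (map f l)
adj-map f here      = here
adj-map f (there p) = there (adj-map f p)

closed : {A : Set} → A → List A → List A
closed c K = c ∷ K ∷ʳ c

-- `path` is the cycle rotated so as to begin with `b` and end with `a`. Only the cut edge is lost,
-- and putting `a` in front once more restores it.
record Opened {A : Set} (a b : A) (c : A) (K : List A) : Set where
  field
    path init rest : List A
    ends     : path ≡ init ∷ʳ a
    starts   : path ≡ b ∷ rest
    vertices : ∀ {x} → x ∈ K ∷ʳ c → x ∈ path
    edges    : ∀ {x y} → Adj x y (closed c K) → Adj x y (a ∷ path)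
    size     : length path ≡ suc (length K)

module _ {A : Set} where

  adj-closing : ∀ {a b : A} c K {d} → Adj a b (c ∷ K ∷ʳ d) →
                (b ≡ d × ∃ λ A₀ → c ∷ K ≡ A₀ ∷ʳ a) ⊎
                (∃₂ λ A₀ B → c ∷ K ≡ A₀ ++ a ∷ b ∷ B)
  adj-closing c []      here      = inj₁ (refl , [] , refl)
  adj-closing c []      (there (there ()))
  adj-closing c (x ∷ K) here      = inj₂ ([] , K , refl)
  adj-closing c (x ∷ K) (there p) with adj-closing x K p
  ... | inj₁ (e , A₀ , q)  = inj₁ (e , c ∷ A₀ , cong (c ∷_) q)
  ... | inj₂ (A₀ , B , q) = inj₂ (c ∷ A₀ , B , cong (c ∷_) q)

  cut-open : ∀ {a b : A} c K → Adj a b (closed c K) → Opened a b c K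
  cut-open {a} {b} c K p with adj-closing c K p
  ... | inj₁ (refl , A₀ , eq) = record
    { path = c ∷ K ; init = A₀ ; rest = K ; ends = eq ; starts = refl
    ; vertices = λ q → [ there , (λ { (here refl) → here refl }) ]′ (∈-++⁻ K q)
    ; edges = λ q → [ there ∘ subst (Adj _ _) (sym eq) , (λ { here → here ; (there (there ())) }) ]′
                    (adj-cut A₀ a (c ∷ []) (subst (Adj _ _) walk q))
    ; size = refl }
    where
    walk : c ∷ K ∷ʳ c ≡ A₀ ++ a ∷ c ∷ []
    walk = trans (cong (_∷ʳ c) eq) (++-assoc A₀ _ _)
  ... | inj₂ (A₀ , B , eq) = record
    { path = b ∷ B ++ A₀ ∷ʳ a ; init = b ∷ B ++ A₀ ; rest = B ++ A₀ ∷ʳ a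
    ; ends = cong (b ∷_) (sym (++-assoc B A₀ _)) ; starts = refl
    ; vertices = λ q → member ([ there , (λ { (here refl) → here refl }) ]′ (∈-++⁻ K q))
    ; edges = λ q → edge A₀ eq (adj-cut A₀ a (b ∷ B ∷ʳ c) (subst (Adj _ _) walk q))
    ; size = begin
        suc (length (B ++ A₀ ∷ʳ a))          ≡⟨ cong suc (length-++ B) ⟩
        suc (length B ℕ.+ length (A₀ ∷ʳ a))  ≡⟨ cong (λ z → suc (length B ℕ.+ z)) (length-++ A₀) ⟩
        suc (length B ℕ.+ (length A₀ ℕ.+ 1)) ≡⟨ cong suc (shuffle (length B) (length A₀)) ⟩
        suc (length A₀ ℕ.+ suc (length B))   ≡⟨ ℕₚ.+-suc (length A₀) _ ⟨
        length A₀ ℕ.+ suc (suc (length B))   ≡⟨ length-++ A₀ ⟨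
        length (A₀ ++ a ∷ b ∷ B)             ≡⟨ cong length eq ⟨
        suc (length K)                       ∎ }
    where
    open ≡-Reasoning
    shuffle : ∀ x y → x ℕ.+ (y ℕ.+ 1) ≡ y ℕ.+ suc x
    shuffle x y = trans (cong (x ℕ.+_) (ℕₚ.+-comm y 1)) (trans (ℕₚ.+-comm x (suc y)) (sym (ℕₚ.+-suc y x)))
    walk : c ∷ K ∷ʳ c ≡ A₀ ++ a ∷ b ∷ B ∷ʳ c
    walk = trans (cong (_∷ʳ c) eq) (++-assoc A₀ _ _)
    member : ∀ {x} → x ∈ c ∷ K → x ∈ b ∷ B ++ A₀ ∷ʳ a
    member q with ∈-++⁻ A₀ (subst (_ ∈_) eq q)
    ... | inj₁ r           = ∈-++⁺ʳ (b ∷ B) (∈-++⁺ˡ r)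
    ... | inj₂ (here refl) = ∈-++⁺ʳ (b ∷ B) (∈-++⁺ʳ A₀ (here refl))
    ... | inj₂ (there r)   = ∈-++⁺ˡ r
    edge : ∀ {x y} A₀ → c ∷ K ≡ A₀ ++ a ∷ b ∷ B →
           Adj x y (A₀ ∷ʳ a) ⊎ Adj x y (a ∷ b ∷ B ∷ʳ c) → Adj x y (a ∷ b ∷ B ++ A₀ ∷ʳ a)
    edge A₀        e    (inj₁ r) = adj-++ʳ (a ∷ b ∷ B) r
    -- Here `a` is `c` itself, so the second half of the walk already returns to `a`.
    edge []        refl (inj₂ r) = r
    edge (_ ∷ A₀) refl (inj₂ r) = adj-glue (a ∷ b ∷ B) c (A₀ ∷ʳ a) r

-- Counting: exhaustive lists of the right length

surjective⇒injective : ∀ {n} (f : Fin n → Fin n) → (∀ y → ∃ λ x → f x ≡ y) →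
                       ∀ {i j} → f i ≡ f j → i ≡ j
surjective⇒injective {suc n} f sur {i} {j} eq with i Finₚ.≟ j
... | yes i≡j = i≡j
... | no  i≢j = contradiction (Finₚ.injective⇒≤ g-inj) ℕₚ.1+n≰n
  where
  -- A section of f can be chosen to avoid i, because j has the same image.
  s : ∀ y → ∃ λ x → f x ≡ y × i ≢ x
  s y with sur y
  ... | x , e with i Finₚ.≟ x
  ...   | yes refl = j , trans (sym eq) e , i≢j
  ...   | no  i≢x  = x , e , i≢x
  g : Fin (suc n) → Fin n
  g y = Fin.punchOut (proj₂ (proj₂ (s y)))
  g-inj : ∀ {y z} → g y ≡ g z → y ≡ z
  g-inj {y} {z} e = trans (sym (proj₁ (proj₂ (s y)))) (trans (cong f (Finₚ.punchOut-injective (proj₂ (proj₂ (s y))) (proj₂ (proj₂ (s z))) e)) (proj₁ (proj₂ (s z))))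

-- Pigeonhole: there are as many positions in `l` as pairs, so `lookup l`, being onto, is injective.
-- Both the sequence and its quotients get their uniqueness from here.
cover⇒unique : ∀ {q m} (l : List (Fin q × Fin m)) → length l ≡ q ℕ.* m → (∀ g → g ∈ l) → Unique l
cover⇒unique {q} {m} l len cov =
  subst Unique (tabulate-lookup l) (Uniqueₚ.tabulate⁺ inj)
  where
  enc : Fin q × Fin m → Fin (length l)
  enc (u , v) = Fin.cast (sym len) (Fin.combine u v)
  sur : ∀ y → ∃ λ x → enc (lookup l x) ≡ y
  sur y with Finₚ.combine-surjective {q} {m} (Fin.cast len y)
  ... | u , v , e = Any.index (cov (u , v)) ,
    trans (cong enc (sym (lookup-index (cov (u , v)))))
          (Finₚ.toℕ-injective (trans (Finₚ.toℕ-cast (sym len) _) (trans (cong Fin.toℕ e) (Finₚ.toℕ-cast len y))))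
  inj : ∀ {i j} → lookup l i ≡ lookup l j → i ≡ j
  inj e = surjective⇒injective (enc ∘ lookup l) sur (cong enc e)

adj-suffix : ∀ {A : Set} {a b : A} k l {l′} → Adj a b (l ++ l′) → Adj a b ((k ++ l) ++ l′)
adj-suffix k l {l′} p = subst (Adj _ _) (sym (++-assoc k l l′)) (adj-++ʳ k p)

-- Arithmetic modulo m

infixr 8 _^ᶻ_
_^ᶻ_ : ℤ → ℕ → ℤ
x ^ᶻ zero  = 1ℤ
x ^ᶻ suc n = x * x ^ᶻ n

^ᶻ-+ : ∀ x a b → x ^ᶻ (a ℕ.+ b) ≡ x ^ᶻ a * x ^ᶻ b
^ᶻ-+ x zero    b = sym (ℤₚ.*-identityˡ _)
^ᶻ-+ x (suc a) b = trans (cong (x *_) (^ᶻ-+ x a b)) (sym (ℤₚ.*-assoc x _ _))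

module Mod (m : ℕ) where

  infix 4 _≈_ _≉_
  record _≈_ (a b : ℤ) : Set where
    constructor congruent
    field difference : + m ∣ℤ a - b

  _≉_ : ℤ → ℤ → Set
  a ≉ b = ¬ a ≈ b

  ≡⇒≈ : ∀ {a b} → a ≡ b → a ≈ b
  ≡⇒≈ {a} refl = congruent (divides 0ℤ (ℤₚ.+-inverseʳ a))

  -- A congruence follows from others once its difference is a combination of theirs.
  lin₁ : ∀ {x y a b} c → x - y ≡ c * (a - b) → a ≈ b → x ≈ y
  lin₁ c e (congruent p) = congruent (subst (+ m ∣ℤ_) (sym e) (∣n⇒∣m*n c p))

  lin₂ : ∀ {x y a b a′ b′} c c′ → x - y ≡ c * (a - b) + c′ * (a′ - b′) → a ≈ b → a′ ≈ b′ → x ≈ y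
  lin₂ c c′ e (congruent p) (congruent q) =
    congruent (subst (+ m ∣ℤ_) (sym e) (∣m∣n⇒∣m+n (∣n⇒∣m*n c p) (∣n⇒∣m*n c′ q)))

  lin₃ : ∀ {x y a b a′ b′ a″ b″} c c′ c″ →
         x - y ≡ c * (a - b) + c′ * (a′ - b′) + c″ * (a″ - b″) → a ≈ b → a′ ≈ b′ → a″ ≈ b″ → x ≈ y
  lin₃ c c′ c″ e (congruent p) (congruent q) (congruent r) = congruent (subst (+ m ∣ℤ_) (sym e)
    (∣m∣n⇒∣m+n (∣m∣n⇒∣m+n (∣n⇒∣m*n c p) (∣n⇒∣m*n c′ q)) (∣n⇒∣m*n c″ r)))

  lin₄ : ∀ {x y a b a′ b′ a″ b″ a‴ b‴} c c′ c″ c‴ →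
         x - y ≡ c * (a - b) + c′ * (a′ - b′) + (c″ * (a″ - b″) + c‴ * (a‴ - b‴)) →
         a ≈ b → a′ ≈ b′ → a″ ≈ b″ → a‴ ≈ b‴ → x ≈ y
  lin₄ c c′ c″ c‴ e (congruent p) (congruent q) (congruent r) (congruent t) = congruent (subst (+ m ∣ℤ_) (sym e)
    (∣m∣n⇒∣m+n (∣m∣n⇒∣m+n (∣n⇒∣m*n c p) (∣n⇒∣m*n c′ q)) (∣m∣n⇒∣m+n (∣n⇒∣m*n c″ r) (∣n⇒∣m*n c‴ t))))

  modulus≈0 : + m ≈ 0ℤ
  modulus≈0 = congruent (divides 1ℤ (trans (ℤₚ.+-identityʳ (+ m)) (sym (ℤₚ.*-identityˡ (+ m)))))

  shift-modulus : ∀ k {x y} → x ≡ y + k * + m → x ≈ y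
  shift-modulus k {y = y} refl = congruent (divides k (lemma y (k * + m)))
    where lemma : ∀ y z → y + z - y ≡ z
          lemma = solve-∀

  ≈-sym : ∀ {a b} → a ≈ b → b ≈ a
  ≈-sym {a} {b} = lin₁ (- 1ℤ) (lemma a b)
    where lemma : ∀ a b → b - a ≡ - 1ℤ * (a - b)
          lemma = solve-∀

  ≈-trans : ∀ {a b c} → a ≈ b → b ≈ c → a ≈ c
  ≈-trans {a} {b} {c} = lin₂ 1ℤ 1ℤ (lemma a b c)
    where lemma : ∀ a b c → a - c ≡ 1ℤ * (a - b) + 1ℤ * (b - c)
          lemma = solve-∀

  ≈-+ : ∀ {a b c d} → a ≈ b → c ≈ d → a + c ≈ b + d
  ≈-+ {a} {b} {c} {d} = lin₂ 1ℤ 1ℤ (lemma a b c d)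
    where lemma : ∀ a b c d → a + c - (b + d) ≡ 1ℤ * (a - b) + 1ℤ * (c - d)
          lemma = solve-∀

  ≈-* : ∀ {a b c d} → a ≈ b → c ≈ d → a * c ≈ b * d
  ≈-* {a} {b} {c} {d} = lin₂ c b (lemma a b c d)
    where lemma : ∀ a b c d → a * c - b * d ≡ c * (a - b) + b * (c - d)
          lemma = solve-∀

  ≈-*ˡ : ∀ c {a b} → a ≈ b → c * a ≈ c * b
  ≈-*ˡ c {a} {b} = lin₁ c (lemma a b c)
    where lemma : ∀ a b c → c * a - c * b ≡ c * (a - b)
          lemma = solve-∀

  ^ᶻ-cong : ∀ n {a b} → a ≈ b → a ^ᶻ n ≈ b ^ᶻ n
  ^ᶻ-cong zero    p = ≡⇒≈ refl
  ^ᶻ-cong (suc n) p = ≈-* p (^ᶻ-cong n p)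

  module _ .{{_ : ℕ.NonZero m}} where

    residue : ∀ w → ∃ λ x → x ℕ.< m × w ≈ + x
    residue w = w %ℕ m , ℤᵈ.n%ℕd<d w m ,
      shift-modulus (w /ℕ m) (ℤᵈ.a≡a%ℕn+[a/ℕn]*n w m)

    private
      ordered : ∀ {x y} → x ℕ.≤ y → y ℕ.< m → + y ≈ + x → y ≡ x
      ordered {x} {y} x≤y y<m (congruent p) with y ℕ.∸ x in eq
      ... | zero  = ℕₚ.≤-antisym (ℕₚ.m∸n≡0⇒m≤n eq) x≤y
      ... | suc d = contradiction (subst (m ℕ∣.∣_) diff (∣⇒∣ᵤ p)) (ℕ∣.>⇒∤ d<m)
        where
        diff : ℤ.∣ + y - + x ∣ ≡ suc d
        diff = trans (cong ℤ.∣_∣ (trans (ℤₚ.m-n≡m⊖n y x) (ℤₚ.⊖-≥ x≤y))) eq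
        d<m : suc d ℕ.< m
        d<m = ℕₚ.≤-<-trans (subst (ℕ._≤ y) eq (ℕₚ.m∸n≤m y x)) y<m

    residue-unique : ∀ {x y} → x ℕ.< m → y ℕ.< m → + x ≈ + y → x ≡ y
    residue-unique {x} {y} x<m y<m p with ℕₚ.≤-total x y
    ... | inj₁ x≤y = sym (ordered x≤y y<m (≈-sym p))
    ... | inj₂ y≤x = ordered y≤x x<m p

change-modulus : ∀ {m} k {m′} → m ≡ k ℕ.* m′ → ∀ {a b} → Mod._≈_ m a b → Mod._≈_ m′ a b
change-modulus k {m′} refl (Mod.congruent (divides z e)) = Mod.congruent (divides (z * + k)
  (trans e (trans (cong (z *_) (ℤₚ.pos-* k m′)) (sym (ℤₚ.*-assoc z (+ k) (+ m′))))))

-- Lists in arithmetic progression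

run : ℕ → ℕ → ℕ → List ℕ
run a d zero    = []
run a d (suc n) = a ∷ run (a ℕ.+ d) d n

private
  run-step : ∀ a i d → a ℕ.+ suc i ℕ.* d ≡ a ℕ.+ d ℕ.+ i ℕ.* d
  run-step = ℕ-Solver.solve-∀

run-∈ : ∀ {a d n x} i → i ℕ.< n → x ≡ a ℕ.+ i ℕ.* d → x ∈ run a d n
run-∈ {a} zero    (ℕ.s≤s _) e = here (trans e (ℕₚ.+-identityʳ a))
run-∈ {a} {d} (suc i) (ℕ.s≤s p) e = there (run-∈ i p (trans e (run-step a i d)))

run-adj : ∀ {a d n x y} i → suc i ℕ.< n → x ≡ a ℕ.+ i ℕ.* d → y ≡ x ℕ.+ d → Adj x y (run a d n)
run-adj {a} {d} zero (ℕ.s≤s (ℕ.s≤s _)) e e′ =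
  subst₂ (λ u v → Adj u v _) (sym x≡a) (sym (trans e′ (cong (ℕ._+ d) x≡a))) here
  where x≡a = trans e (ℕₚ.+-identityʳ a)
run-adj {a} {d} (suc i) (ℕ.s≤s p) e e′ = there (run-adj i p (trans e (run-step a i d)) e′)

run-exit : ∀ {a d x b l} n → x ≡ a ℕ.+ n ℕ.* d → Adj x b (run a d (suc n) ++ b ∷ l)
run-exit {a} zero e = subst (λ u → Adj u _ _) (sym (trans e (ℕₚ.+-identityʳ a))) here
run-exit {a} {d} (suc n) e = there (run-exit n (trans e (run-step a n d)))

length-run : ∀ a d n → length (run a d n) ≡ n
length-run a d zero    = refl
length-run a d (suc n) = cong suc (length-run _ d n)

split-at : ∀ a {b x} → x ℕ.< a ℕ.+ b → x ℕ.< a ⊎ ∃ λ y → y ℕ.< b × x ≡ a ℕ.+ y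
split-at a {b} {x} p with ℕₚ.<-≤-connex x a
... | inj₁ x<a = inj₁ x<a
... | inj₂ a≤x = inj₂ (x ℕ.∸ a , ℕₚ.+-cancelˡ-< a _ _ (subst (ℕ._< a ℕ.+ b) (sym e) p) , sym e)
  where e = ℕₚ.m+[n∸m]≡n a≤x

halve : ∀ x → ∃ λ i → x ≡ i ℕ.+ i ⊎ x ≡ suc (i ℕ.+ i)
halve zero    = 0 , inj₁ refl
halve (suc x) with halve x
... | i , inj₁ e = i , inj₂ (cong suc e)
... | i , inj₂ e = suc i , inj₁ (trans (cong suc e) (cong suc (sym (ℕₚ.+-suc i i))))

double-cancel-< : ∀ i n → i ℕ.+ i ℕ.< n ℕ.+ n → i ℕ.< n
double-cancel-< i n p = ℕₚ.≰⇒> λ n≤i → ℕₚ.<⇒≱ p (ℕₚ.+-mono-≤ n≤i n≤i)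

-- Two-cycle permutations and blocks

-- A permutation π of ℤ/m with the two cycles closed c₁ K₁ and closed c₂ K₂ for which x ↦ 2x - π(x) is onto.
record Cycles (m : ℕ) : Set where
  open Mod m
  field
    c₁ c₂ : ℤ
    K₁ K₂ : List ℤ
    vertices : ∀ w → (∃ λ x → x ∈ K₁ ∷ʳ c₁ × x ≈ w) ⊎ (∃ λ x → x ∈ K₂ ∷ʳ c₂ × x ≈ w)
    edges    : ∀ w → ∃₂ λ a b → (Adj a b (closed c₁ K₁) ⊎ Adj a b (closed c₂ K₂)) × + 2 * a - b ≈ w
    size     : suc (length K₁) ℕ.+ suc (length K₂) ≡ m

-- The cycles of a Cycles as paths, the first one without its step p → x₁. How a block fits to its
-- neighbours depends only on x₁ - x₀ ≈ 1 + ζ and 2p - 2x₀ ≈ 2ζ.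
record Block (m : ℕ) (ζ : ℤ) : Set where
  open Mod m
  field
    p x₁ x₀ : ℤ
    path₁ path₂ init₁ init₂ rest₁ : List ℤ
    ends₁    : path₁ ≡ init₁ ∷ʳ p
    starts₁  : path₁ ≡ x₁ ∷ rest₁
    ends₂    : path₂ ≡ init₂ ∷ʳ x₀
    x₁≈      : x₁ ≈ p + 1ℤ
    x₀≈      : x₀ ≈ p - ζ
    vertices : ∀ w → (∃ λ x → x ∈ path₁ × x ≈ w) ⊎ (∃ λ x → x ∈ path₂ × x ≈ w)
    edges    : ∀ w → + 2 * p - x₁ ≈ w ⊎
                     (∃₂ λ a b → (Adj a b path₁ ⊎ Adj a b (x₀ ∷ path₂)) × + 2 * a - b ≈ w)
    size     : length path₁ ℕ.+ length path₂ ≡ m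

module _ {m : ℕ} (C : Cycles m) where
  open Mod m
  private module C = Cycles C
  open C using (c₁; c₂; K₁; K₂)

  -- The second cycle is cut behind `x₀`, and `x₀ ∷ path₂` still has all its steps. So only the step
  -- from `p` to `x₁` on the first cycle is set apart.
  cut-cycles : ∀ {p x₁ x₀ ζ} → Adj p x₁ (closed c₁ K₁) → x₁ ≈ p + 1ℤ →
               x₀ ∈ K₂ ∷ʳ c₂ → x₀ ≈ p - ζ → Block m ζ
  cut-cycles {p} {x₁} {x₀} e₁ x₁≈ x₀∈ x₀≈ = record
    { p = p ; x₁ = x₁ ; x₀ = x₀
    ; path₁ = O₁.path ; path₂ = O₂.path ; init₁ = O₁.init ; init₂ = O₂.init ; rest₁ = O₁.rest
    ; ends₁ = O₁.ends ; starts₁ = O₁.starts ; ends₂ = O₂.ends ; x₁≈ = x₁≈ ; x₀≈ = x₀≈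
    ; vertices = λ w → [ (λ { (x , i , e) → inj₁ (x , O₁.vertices i , e) })
                       , (λ { (x , i , e) → inj₂ (x , O₂.vertices i , e) }) ]′ (C.vertices w)
    ; edges = edge
    ; size = trans (cong₂ ℕ._+_ O₁.size O₂.size) C.size }
    where
    successor : ∃ λ b → Adj x₀ b (closed c₂ K₂)
    successor = adj-successor c₂ K₂ ([ there , (λ { (here refl) → here refl }) ]′ (∈-++⁻ K₂ x₀∈))
    module O₁ = Opened (cut-open c₁ K₁ e₁)
    module O₂ = Opened (cut-open c₂ K₂ (proj₂ successor))
    first-edge : ∀ {a b} → Adj a b (p ∷ O₁.path) → (a ≡ p × b ≡ x₁) ⊎ Adj a b O₁.path
    first-edge q with subst (λ l → Adj _ _ (p ∷ l)) O₁.starts q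
    ... | here    = inj₁ (refl , refl)
    ... | there r = inj₂ (subst (Adj _ _) (sym O₁.starts) r)
    edge : ∀ w → + 2 * p - x₁ ≈ w ⊎
           (∃₂ λ a b → (Adj a b O₁.path ⊎ Adj a b (x₀ ∷ O₂.path)) × + 2 * a - b ≈ w)
    edge w with C.edges w
    ... | a , b , inj₂ q , e = inj₂ (a , b , inj₂ (O₂.edges q) , e)
    ... | a , b , inj₁ q , e with first-edge (O₁.edges q)
    ...   | inj₁ (refl , refl) = inj₁ e
    ...   | inj₂ r             = inj₂ (a , b , inj₁ r , e)

-- The congruence 2a - b ≡ x is written without subtraction, with multiples of `m` on both sides, so
-- that every case becomes a polynomial identity over ℕ.
record Cyclesℕ (m : ℕ) : Set where
  field
    c₁ c₂ : ℕ
    K₁ K₂ : List ℕ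
    vertices : ∀ x → x ℕ.< m → x ∈ K₁ ∷ʳ c₁ ⊎ x ∈ K₂ ∷ʳ c₂
    edges    : ∀ x → x ℕ.< m → ∃₂ λ a b → (Adj a b (closed c₁ K₁) ⊎ Adj a b (closed c₂ K₂)) ×
               ∃₂ λ i j → 2 ℕ.* a ℕ.+ i ℕ.* m ≡ b ℕ.+ x ℕ.+ j ℕ.* m
    size     : suc (length K₁) ℕ.+ suc (length K₂) ≡ m

module _ {m : ℕ} .{{_ : ℕ.NonZero m}} (C : Cyclesℕ m) where
  open Mod m
  private
    module C = Cyclesℕ C
    map-closed : ∀ c K → map +_ (closed c K) ≡ closed (+ c) (map +_ K)
    map-closed c K = cong (+ c ∷_) (map-++ +_ K (c ∷ []))

  adj-integral : ∀ {a b} c K → Adj a b (closed c K) → Adj (+ a) (+ b) (closed (+ c) (map +_ K))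
  adj-integral c K q = subst (Adj _ _) (map-closed c K) (adj-map +_ q)

  ∈-integral : ∀ {x : ℕ} c K → x ∈ K ∷ʳ c → + x ∈ map +_ K ∷ʳ + c
  ∈-integral c K q = subst (_ ∈_) (map-++ +_ K (c ∷ [])) (∈-map⁺ +_ q)

  integral : Cycles m
  integral = record
    { c₁ = + C.c₁ ; c₂ = + C.c₂ ; K₁ = map +_ C.K₁ ; K₂ = map +_ C.K₂
    ; vertices = vertex ; edges = edge
    ; size = trans (cong₂ (λ u v → suc u ℕ.+ suc v) (length-map +_ C.K₁) (length-map +_ C.K₂)) C.size }
    where
    vertex : ∀ w → _
    vertex w with residue w
    ... | x , x<m , e = [ (λ q → inj₁ (+ x , ∈-integral C.c₁ C.K₁ q , ≈-sym e))
                        , (λ q → inj₂ (+ x , ∈-integral C.c₂ C.K₂ q , ≈-sym e)) ]′ (C.vertices x x<m)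
    edge : ∀ w → _
    edge w with residue w
    ... | x , x<m , e with C.edges x x<m
    ...   | a , b , q , i , j , eq =
      + a , + b , [ inj₁ ∘ adj-integral C.c₁ C.K₁ , inj₂ ∘ adj-integral C.c₂ C.K₂ ]′ q ,
      ≈-trans (shift-modulus (+ j - + i) (rearrange (+ 2 * + a) (+ b) (+ x) (+ i) (+ j) (+ m) eqℤ)) (≈-sym e)
      where
      eqℤ : + 2 * + a + + i * + m ≡ + b + + x + + j * + m
      eqℤ = trans (sym (trans (ℤₚ.pos-+ (2 ℕ.* a) _) (cong₂ _+_ (ℤₚ.pos-* 2 a) (ℤₚ.pos-* i m))))
        (trans (cong +_ eq) (trans (ℤₚ.pos-+ (b ℕ.+ x) _) (cong₂ _+_ (ℤₚ.pos-+ b x) (ℤₚ.pos-* j m))))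
      rearrange : ∀ a b x i j n → a + i * n ≡ b + x + j * n → a - b ≡ x + (j - i) * n
      rearrange a b x i j n h = trans (l₁ a b i n) (trans (cong (λ z → z - i * n - b) h) (l₂ b x i j n))
        where l₁ : ∀ a b i n → a - b ≡ a + i * n - i * n - b
              l₁ = solve-∀
              l₂ : ∀ b x i j n → b + x + j * n - i * n - b ≡ x + (j - i) * n
              l₂ = solve-∀

  cut-natural-cycles : ∀ {p x₀ ζ} → Adj p (p ℕ.+ 1) (closed C.c₁ C.K₁) → x₀ ∈ C.K₂ ∷ʳ C.c₂ →
                       + x₀ ≈ + p - ζ → Block m ζ
  cut-natural-cycles {p} e q x₀≈ = cut-cycles integral (adj-integral C.c₁ C.K₁ e) (≡⇒≈ (ℤₚ.pos-+ p 1))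
                                              (∈-integral C.c₂ C.K₂ q) x₀≈

-- An interval of 2n + ε numbers splits by parity. For ε = 1 it begins and ends with the parity of
-- `b`, which therefore gets one term more. It serves for the vertices of the upper third and, with
-- a smaller `b`, for the values 2x - π(x).
parity : ∀ {ε} → ε ≡ 0 ⊎ ε ≡ 1 → ∀ b n y → y ℕ.< n ℕ.+ n ℕ.+ ε →
         (∃ λ i → i ℕ.< n ℕ.+ ε × b ℕ.+ 1 ℕ.+ ε ℕ.+ y ≡ b ℕ.+ 2 ℕ.+ i ℕ.* 2) ⊎
         (∃ λ i → i ℕ.< n × b ℕ.+ 1 ℕ.+ ε ℕ.+ y ≡ b ℕ.+ 1 ℕ.+ 2 ℕ.* ε ℕ.+ i ℕ.* 2)
parity (inj₁ refl) b n y p with halve y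
... | i , inj₁ refl = inj₂ (i , double-cancel-< i n (subst (i ℕ.+ i ℕ.<_) (ℕₚ.+-identityʳ _) p) , e b i)
  where e : ∀ b i → b ℕ.+ 1 ℕ.+ 0 ℕ.+ (i ℕ.+ i) ≡ b ℕ.+ 1 ℕ.+ 0 ℕ.+ i ℕ.* 2
        e = ℕ-Solver.solve-∀
... | i , inj₂ refl = inj₁ (i , subst (i ℕ.<_) (sym (ℕₚ.+-identityʳ n))
    (double-cancel-< i n (ℕₚ.<-trans (ℕₚ.n<1+n _) (subst (suc (i ℕ.+ i) ℕ.<_) (ℕₚ.+-identityʳ _) p))) , e b i)
  where e : ∀ b i → b ℕ.+ 1 ℕ.+ 0 ℕ.+ (1 ℕ.+ (i ℕ.+ i)) ≡ b ℕ.+ 2 ℕ.+ i ℕ.* 2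
        e = ℕ-Solver.solve-∀
parity (inj₂ refl) b n y p with halve y
... | i , inj₁ refl = inj₁ (i , double-cancel-< i (n ℕ.+ 1)
      (ℕₚ.<-trans p (subst (n ℕ.+ n ℕ.+ 1 ℕ.<_) (e′ n) (ℕₚ.n<1+n _))) , e b i)
  where e : ∀ b i → b ℕ.+ 1 ℕ.+ 1 ℕ.+ (i ℕ.+ i) ≡ b ℕ.+ 2 ℕ.+ i ℕ.* 2
        e = ℕ-Solver.solve-∀
        e′ : ∀ n → suc (n ℕ.+ n ℕ.+ 1) ≡ (n ℕ.+ 1) ℕ.+ (n ℕ.+ 1)
        e′ = ℕ-Solver.solve-∀
... | i , inj₂ refl = inj₂ (i , double-cancel-< i n
      (ℕₚ.≤-pred (subst (suc (i ℕ.+ i) ℕ.<_) (ℕₚ.+-comm (n ℕ.+ n) 1) p)) , e b i)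
  where e : ∀ b i → b ℕ.+ 1 ℕ.+ 1 ℕ.+ (1 ℕ.+ (i ℕ.+ i)) ≡ b ℕ.+ 1 ℕ.+ 2 ℕ.+ i ℕ.* 2
        e = ℕ-Solver.solve-∀

-- π(x) = x + 1 on 0, …, 2t and 2t + 2, …, and π(x) = x + 2 on the upper third, where the odd and the
-- even residues are traversed one after the other.
module CoprimeTo3 (t ε : ℕ) (ε≤1 : ε ≡ 0 ⊎ ε ≡ 1) where

  m : ℕ
  m = 6 ℕ.* t ℕ.+ 5 ℕ.+ 2 ℕ.* ε

  -- Both progressions reach the top of the range: the last even vertex is m - 1, the last odd one m
  -- - 2. For ε = 1 the odd ones begin only at 4t + 5, since 4t + 3 still lies on the first cycle.
  evens odds : ℕ → List ℕ
  evens n = run (4 ℕ.* t ℕ.+ 4) 2 (n ℕ.+ ε)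
  odds  n = run (4 ℕ.* t ℕ.+ 3 ℕ.+ 2 ℕ.* ε) 2 n

  K₁ K₂ : List ℕ
  K₁ = run (2 ℕ.* t ℕ.+ 2 ℕ.+ 1) 1 (2 ℕ.* t ℕ.+ ε)
  K₂ = run 1 1 (2 ℕ.* t ℕ.+ 1) ++ evens (suc t) ++ odds (suc t)

  upper-∈ : ∀ y → y ℕ.< suc t ℕ.+ suc t ℕ.+ ε → 4 ℕ.* t ℕ.+ 3 ℕ.+ ε ℕ.+ y ∈ K₂ ∷ʳ 0
  upper-∈ y p with parity ε≤1 (4 ℕ.* t ℕ.+ 2) (suc t) y p
  ... | inj₁ (i , q , e) = ∈-++⁺ˡ (∈-++⁺ʳ (run 1 1 (2 ℕ.* t ℕ.+ 1)) (∈-++⁺ˡ (run-∈ i q (trans (l t ε y) (trans e (r t i))))))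
    where l : ∀ t ε y → 4 ℕ.* t ℕ.+ 3 ℕ.+ ε ℕ.+ y ≡ 4 ℕ.* t ℕ.+ 2 ℕ.+ 1 ℕ.+ ε ℕ.+ y
          l = ℕ-Solver.solve-∀
          r : ∀ t i → 4 ℕ.* t ℕ.+ 2 ℕ.+ 2 ℕ.+ i ℕ.* 2 ≡ 4 ℕ.* t ℕ.+ 4 ℕ.+ i ℕ.* 2
          r = ℕ-Solver.solve-∀
  ... | inj₂ (i , q , e) = ∈-++⁺ˡ (∈-++⁺ʳ (run 1 1 (2 ℕ.* t ℕ.+ 1)) (∈-++⁺ʳ (evens (suc t)) (run-∈ i q (trans (l t ε y) (trans e (r t ε i))))))
    where l : ∀ t ε y → 4 ℕ.* t ℕ.+ 3 ℕ.+ ε ℕ.+ y ≡ 4 ℕ.* t ℕ.+ 2 ℕ.+ 1 ℕ.+ ε ℕ.+ y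
          l = ℕ-Solver.solve-∀
          r : ∀ t ε i → 4 ℕ.* t ℕ.+ 2 ℕ.+ 1 ℕ.+ 2 ℕ.* ε ℕ.+ i ℕ.* 2 ≡ 4 ℕ.* t ℕ.+ 3 ℕ.+ 2 ℕ.* ε ℕ.+ i ℕ.* 2
          r = ℕ-Solver.solve-∀

  lower-∈ : ∀ x → x ℕ.< 2 ℕ.* t ℕ.+ 2 → x ∈ K₂ ∷ʳ 0
  lower-∈ zero    p = ∈-++⁺ʳ K₂ (here refl)
  lower-∈ (suc x) p = ∈-++⁺ˡ (∈-++⁺ˡ (run-∈ x (ℕₚ.≤-pred (subst (suc x ℕ.<_) (ℕₚ.+-suc (2 ℕ.* t) 1) p))
                                            (cong suc (sym (ℕₚ.*-identityʳ x)))))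

  middle-∈ : ∀ i → i ℕ.< suc (2 ℕ.* t ℕ.+ ε) → 2 ℕ.* t ℕ.+ 2 ℕ.+ i ∈ K₁ ∷ʳ (2 ℕ.* t ℕ.+ 2)
  middle-∈ zero    p = ∈-++⁺ʳ K₁ (here (ℕₚ.+-identityʳ _))
  middle-∈ (suc i) (ℕ.s≤s p) = ∈-++⁺ˡ (run-∈ i p (e (2 ℕ.* t ℕ.+ 2) i))
    where e : ∀ a i → a ℕ.+ suc i ≡ a ℕ.+ 1 ℕ.+ i ℕ.* 1
          e = ℕ-Solver.solve-∀

  data Region (x : ℕ) : Set where
    lower  : x ℕ.< 2 ℕ.* t ℕ.+ 2 → Region x
    middle : ∀ i → i ℕ.< suc (2 ℕ.* t ℕ.+ ε) → x ≡ 2 ℕ.* t ℕ.+ 2 ℕ.+ i → Region x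
    upper  : ∀ y → y ℕ.< suc t ℕ.+ suc t ℕ.+ ε → x ≡ 4 ℕ.* t ℕ.+ 3 ℕ.+ ε ℕ.+ y → Region x

  region : ∀ x → x ℕ.< m → Region x
  region x x<m with split-at (2 ℕ.* t ℕ.+ 2) (subst (x ℕ.<_) (e t ε) x<m)
    where e : ∀ t ε → 6 ℕ.* t ℕ.+ 5 ℕ.+ 2 ℕ.* ε ≡ 2 ℕ.* t ℕ.+ 2 ℕ.+ (suc (2 ℕ.* t ℕ.+ ε) ℕ.+ (suc t ℕ.+ suc t ℕ.+ ε))
          e = ℕ-Solver.solve-∀
  ... | inj₁ p = lower p
  ... | inj₂ (y , p , refl) with split-at (suc (2 ℕ.* t ℕ.+ ε)) p
  ...   | inj₁ q              = middle y q refl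
  ...   | inj₂ (z , q , refl) = upper z q (e t ε z)
    where e : ∀ t ε z → 2 ℕ.* t ℕ.+ 2 ℕ.+ (suc (2 ℕ.* t ℕ.+ ε) ℕ.+ z) ≡ 4 ℕ.* t ℕ.+ 3 ℕ.+ ε ℕ.+ z
          e = ℕ-Solver.solve-∀

  private
    Edge : ℕ → Set
    Edge x = ∃₂ λ a b → (Adj a b (closed (2 ℕ.* t ℕ.+ 2) K₁) ⊎ Adj a b (closed 0 K₂)) ×
             ∃₂ λ i j → 2 ℕ.* a ℕ.+ i ℕ.* m ≡ b ℕ.+ x ℕ.+ j ℕ.* m

    in-evens : ∀ {a b} → Adj a b (evens (suc t)) → Adj a b (closed 0 K₂)
    in-evens p = there (adj-++ˡ _ (adj-++ʳ (run 1 1 (2 ℕ.* t ℕ.+ 1)) (adj-++ˡ _ p)))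

    in-odds : ∀ {a b} → Adj a b (odds (suc t)) → Adj a b (closed 0 K₂)
    in-odds p = there (adj-++ˡ _ (adj-++ʳ (run 1 1 (2 ℕ.* t ℕ.+ 1)) (adj-++ʳ (evens (suc t)) p)))

    in-start : ∀ {a b} → Adj a b (run 0 1 (suc (2 ℕ.* t ℕ.+ 1))) → Adj a b (closed 0 K₂)
    in-start p = adj-++ˡ (0 ∷ []) (adj-++ˡ (evens (suc t) ++ odds (suc t)) p)

    -- Where π(x) = x + 2 the value is x - 2, which accounts for the even values from 4t + 2 up to m
    -- - 5. The remaining m - 3 and m - 1 come from the return of the first cycle to 2t + 2 and from
    -- 0 → 1.
    even-edge : ∀ i → i ℕ.< suc (suc t) ℕ.+ ε → Edge (4 ℕ.* t ℕ.+ 2 ℕ.+ i ℕ.* 2)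
    even-edge i p with split-at (t ℕ.+ ε) (subst (i ℕ.<_) (ℕₚ.+-comm 2 (t ℕ.+ ε)) p)
    ... | inj₁ q =
      _ , _ , inj₂ (in-evens (run-adj i (ℕ.s≤s q) refl refl)) , 0 , 0 , e t i
      where e : ∀ t i → 2 ℕ.* (4 ℕ.* t ℕ.+ 4 ℕ.+ i ℕ.* 2) ℕ.+ 0 ≡
                        4 ℕ.* t ℕ.+ 4 ℕ.+ i ℕ.* 2 ℕ.+ 2 ℕ.+ (4 ℕ.* t ℕ.+ 2 ℕ.+ i ℕ.* 2) ℕ.+ 0
            e = ℕ-Solver.solve-∀
    ... | inj₂ (0 , q , refl) =
      _ , _ , inj₁ (run-exit (2 ℕ.* t ℕ.+ ε) refl) , 0 , 0 , e t ε
      where e : ∀ t ε → 2 ℕ.* (2 ℕ.* t ℕ.+ 2 ℕ.+ (2 ℕ.* t ℕ.+ ε) ℕ.* 1) ℕ.+ 0 ≡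
                        2 ℕ.* t ℕ.+ 2 ℕ.+ (4 ℕ.* t ℕ.+ 2 ℕ.+ (t ℕ.+ ε ℕ.+ 0) ℕ.* 2) ℕ.+ 0
            e = ℕ-Solver.solve-∀
    ... | inj₂ (1 , q , refl) =
      0 , 1 , inj₂ (in-start (run-adj 0 (ℕ.s≤s (ℕₚ.m≤n+m 1 (2 ℕ.* t))) refl refl)) , 1 , 0 , e t ε
      where e : ∀ t ε → 0 ℕ.+ 1 ℕ.* (6 ℕ.* t ℕ.+ 5 ℕ.+ 2 ℕ.* ε) ≡
                        1 ℕ.+ (4 ℕ.* t ℕ.+ 2 ℕ.+ (t ℕ.+ ε ℕ.+ 1) ℕ.* 2) ℕ.+ 0
            e = ℕ-Solver.solve-∀
    ... | inj₂ (suc (suc _) , ℕ.s≤s (ℕ.s≤s ()) , _)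

    -- As for the even values; here m - 4 and m - 2 are left over, and they come from m - 2 → 0 and
    -- from the jump 2t + 1 → 4t + 4.
    odd-edge : ∀ i → i ℕ.< suc (suc t) → Edge (4 ℕ.* t ℕ.+ 1 ℕ.+ 2 ℕ.* ε ℕ.+ i ℕ.* 2)
    odd-edge i p with split-at t (subst (i ℕ.<_) (ℕₚ.+-comm 2 t) p)
    ... | inj₁ q =
      _ , _ , inj₂ (in-odds (run-adj i (ℕ.s≤s q) refl refl)) , 0 , 0 , e t ε i
      where e : ∀ t ε i → 2 ℕ.* (4 ℕ.* t ℕ.+ 3 ℕ.+ 2 ℕ.* ε ℕ.+ i ℕ.* 2) ℕ.+ 0 ≡
                        4 ℕ.* t ℕ.+ 3 ℕ.+ 2 ℕ.* ε ℕ.+ i ℕ.* 2 ℕ.+ 2 ℕ.+ (4 ℕ.* t ℕ.+ 1 ℕ.+ 2 ℕ.* ε ℕ.+ i ℕ.* 2) ℕ.+ 0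
            e = ℕ-Solver.solve-∀
    ... | inj₂ (0 , q , refl) =
      _ , 0 , inj₂ (adj-++ʳ (0 ∷ []) (adj-suffix (run 1 1 (2 ℕ.* t ℕ.+ 1)) (evens (suc t) ++ odds (suc t))
                   (adj-suffix (evens (suc t)) (odds (suc t)) (run-exit t refl)))) , 0 , 1 , e t ε
      where e : ∀ t ε → 2 ℕ.* (4 ℕ.* t ℕ.+ 3 ℕ.+ 2 ℕ.* ε ℕ.+ t ℕ.* 2) ℕ.+ 0 ≡
                        4 ℕ.* t ℕ.+ 1 ℕ.+ 2 ℕ.* ε ℕ.+ (t ℕ.+ 0) ℕ.* 2 ℕ.+ 1 ℕ.* (6 ℕ.* t ℕ.+ 5 ℕ.+ 2 ℕ.* ε)
            e = ℕ-Solver.solve-∀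
    ... | inj₂ (1 , q , refl) =
      _ , _ , inj₂ (adj-++ˡ (0 ∷ []) (run-exit {0} {1} (2 ℕ.* t ℕ.+ 1) refl)) , 1 , 0 , e t ε
      where e : ∀ t ε → 2 ℕ.* ((2 ℕ.* t ℕ.+ 1) ℕ.* 1) ℕ.+ 1 ℕ.* (6 ℕ.* t ℕ.+ 5 ℕ.+ 2 ℕ.* ε) ≡
                        4 ℕ.* t ℕ.+ 4 ℕ.+ (4 ℕ.* t ℕ.+ 1 ℕ.+ 2 ℕ.* ε ℕ.+ (t ℕ.+ 1) ℕ.* 2) ℕ.+ 0
            e = ℕ-Solver.solve-∀
    ... | inj₂ (suc (suc _) , ℕ.s≤s (ℕ.s≤s ()) , _)

    edge : ∀ x → x ℕ.< m → Edge x
    edge x x<m with split-at (2 ℕ.* t) (subst (x ℕ.<_) (e t ε) x<m)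
      where e : ∀ t ε → 6 ℕ.* t ℕ.+ 5 ℕ.+ 2 ℕ.* ε ≡
                2 ℕ.* t ℕ.+ (1 ℕ.+ (2 ℕ.* t ℕ.+ ε ℕ.+ (suc (suc t) ℕ.+ suc (suc t) ℕ.+ ε)))
            e = ℕ-Solver.solve-∀
    ... | inj₁ q =
      suc x , suc (suc x) , inj₂ (in-start (run-adj (suc x) (ℕ.s≤s (subst (suc x ℕ.<_) (ℕₚ.+-comm 1 _) (ℕ.s≤s q)))
        (cong suc (sym (ℕₚ.*-identityʳ x))) (ℕₚ.+-comm 1 (suc x)))) , 0 , 0 , e x
      where e : ∀ x → 2 ℕ.* (1 ℕ.+ x) ℕ.+ 0 ≡ 2 ℕ.+ x ℕ.+ x ℕ.+ 0
            e = ℕ-Solver.solve-∀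
    -- The value 2t falls between the two stretches of step 1, because 2t + 1 does not go to 2t + 2.
    -- It comes from the passage m - 1 → 4t + 3 + 2ε from the even to the odd vertices.
    ... | inj₂ (zero , _ , refl) =
      _ , _ , inj₂ (there (adj-++ˡ (0 ∷ []) (adj-++ʳ (run 1 1 (2 ℕ.* t ℕ.+ 1)) (run-exit (t ℕ.+ ε) refl)))) , 0 , 1 , e t ε
      where e : ∀ t ε → 2 ℕ.* (4 ℕ.* t ℕ.+ 4 ℕ.+ (t ℕ.+ ε) ℕ.* 2) ℕ.+ 0 ≡
                        4 ℕ.* t ℕ.+ 3 ℕ.+ 2 ℕ.* ε ℕ.+ (2 ℕ.* t ℕ.+ 0) ℕ.+ 1 ℕ.* (6 ℕ.* t ℕ.+ 5 ℕ.+ 2 ℕ.* ε)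
            e = ℕ-Solver.solve-∀
    ... | inj₂ (suc y , ℕ.s≤s p , refl) with split-at (2 ℕ.* t ℕ.+ ε) p
    ...   | inj₁ q =
      _ , _ , inj₁ (adj-++ˡ _ (run-adj {2 ℕ.* t ℕ.+ 2} {1} y (ℕ.s≤s q) refl refl)) , 0 , 0 , e t y
      where e : ∀ t y → 2 ℕ.* (2 ℕ.* t ℕ.+ 2 ℕ.+ y ℕ.* 1) ℕ.+ 0 ≡
                        2 ℕ.* t ℕ.+ 2 ℕ.+ y ℕ.* 1 ℕ.+ 1 ℕ.+ (2 ℕ.* t ℕ.+ (1 ℕ.+ y)) ℕ.+ 0
            e = ℕ-Solver.solve-∀
    ...   | inj₂ (z , q , refl) with parity ε≤1 (4 ℕ.* t) (suc (suc t)) z q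
    ...     | inj₁ (i , r , eq) = subst Edge (trans (sym eq) (e t ε z)) (even-edge i r)
      where e : ∀ t ε z → 4 ℕ.* t ℕ.+ 1 ℕ.+ ε ℕ.+ z ≡ 2 ℕ.* t ℕ.+ suc (2 ℕ.* t ℕ.+ ε ℕ.+ z)
            e = ℕ-Solver.solve-∀
    ...     | inj₂ (i , r , eq) = subst Edge (trans (sym eq) (e t ε z)) (odd-edge i r)
      where e : ∀ t ε z → 4 ℕ.* t ℕ.+ 1 ℕ.+ ε ℕ.+ z ≡ 2 ℕ.* t ℕ.+ suc (2 ℕ.* t ℕ.+ ε ℕ.+ z)
            e = ℕ-Solver.solve-∀

  cycles : Cyclesℕ m
  cycles = record
    { c₁ = 2 ℕ.* t ℕ.+ 2 ; c₂ = 0 ; K₁ = K₁ ; K₂ = K₂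
    ; vertices = λ x x<m → vertex x (region x x<m)
    ; edges = edge
    ; size = trans (cong₂ (λ u v → suc u ℕ.+ suc v) (length-run _ _ (2 ℕ.* t ℕ.+ ε)) length-K₂) (e t ε) }
    where
    vertex : ∀ x → Region x → x ∈ K₁ ∷ʳ (2 ℕ.* t ℕ.+ 2) ⊎ x ∈ K₂ ∷ʳ 0
    vertex x (lower p)         = inj₂ (lower-∈ x p)
    vertex _ (middle i p refl) = inj₁ (middle-∈ i p)
    vertex _ (upper y p refl)  = inj₂ (upper-∈ y p)
    length-K₂ : length K₂ ≡ 2 ℕ.* t ℕ.+ 1 ℕ.+ (suc t ℕ.+ ε ℕ.+ suc t)
    length-K₂ = trans (length-++ (run 1 1 (2 ℕ.* t ℕ.+ 1))) (cong₂ ℕ._+_ (length-run 1 1 _)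
      (trans (length-++ (evens (suc t))) (cong₂ ℕ._+_ (length-run _ 2 (suc t ℕ.+ ε)) (length-run _ 2 (suc t)))))
    e : ∀ t ε → suc (2 ℕ.* t ℕ.+ ε) ℕ.+ suc (2 ℕ.* t ℕ.+ 1 ℕ.+ (suc t ℕ.+ ε ℕ.+ suc t)) ≡ 6 ℕ.* t ℕ.+ 5 ℕ.+ 2 ℕ.* ε
    e = ℕ-Solver.solve-∀

  module _ {u : ℕ} (2t+ε≡1+u : 2 ℕ.* t ℕ.+ ε ≡ suc u) where
    open Mod m
    private instance
      m≢0 : ℕ.NonZero m
      m≢0 = ℕ.>-nonZero (subst (0 ℕ.<_) (e t ε) (ℕ.s≤s ℕ.z≤n))
        where e : ∀ t ε → 1 ℕ.+ (6 ℕ.* t ℕ.+ 4 ℕ.+ 2 ℕ.* ε) ≡ 6 ℕ.* t ℕ.+ 5 ℕ.+ 2 ℕ.* ε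
              e = ℕ-Solver.solve-∀

    private
      next : ∀ i → i ℕ.< suc u → Adj (2 ℕ.* t ℕ.+ 2 ℕ.+ i) (2 ℕ.* t ℕ.+ 2 ℕ.+ i ℕ.+ 1) (closed (2 ℕ.* t ℕ.+ 2) K₁)
      next i p = adj-++ˡ _ (run-adj {2 ℕ.* t ℕ.+ 2} {1} i (ℕ.s≤s (subst (i ℕ.<_) (sym 2t+ε≡1+u) p))
                                    (cong (2 ℕ.* t ℕ.+ 2 ℕ.+_) (sym (ℕₚ.*-identityʳ i))) refl)

    -- If the first candidate x₀ = p - ζ lies on the first cycle, moving p to the other end of
    -- that cycle pushes x₀ beyond it.
    block : ∀ ζ → ζ ≉ 0ℤ → ζ ≉ - 1ℤ → Block m ζ
    block ζ ζ≉0 ζ≉-1 with residue (+ (2 ℕ.* t ℕ.+ 2 ℕ.+ 0) - ζ)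
    ... | x , x<m , ≈x with region x x<m
    ...   | lower p         = cut-natural-cycles cycles (next 0 (ℕ.s≤s ℕ.z≤n)) (lower-∈ x p) (≈-sym ≈x)
    ...   | upper y p refl  = cut-natural-cycles cycles (next 0 (ℕ.s≤s ℕ.z≤n)) (upper-∈ y p) (≈-sym ≈x)
    ...   | middle 0 p refl = contradiction (lin₁ (- 1ℤ) (e (+ (2 ℕ.* t ℕ.+ 2)) ζ) ≈x) ζ≉0
      where e : ∀ a ζ → ζ - 0ℤ ≡ - 1ℤ * (a + 0ℤ - ζ - (a + 0ℤ))
            e = solve-∀
    -- Moving `p` would not help for ζ = -1: it would put `x₀` on the last vertex of the first
    -- cycle.
    ...   | middle 1 p refl = contradiction (lin₁ (- 1ℤ) (e (+ (2 ℕ.* t ℕ.+ 2)) ζ) ≈x) ζ≉-1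
      where e : ∀ a ζ → ζ - - 1ℤ ≡ - 1ℤ * (a + 0ℤ - ζ - (a + 1ℤ))
            e = solve-∀
    ...   | middle (suc (suc i)) p refl =
      cut-natural-cycles cycles (next u (ℕₚ.n<1+n u)) (upper-∈ i i<) (lin₁ (- 1ℤ) shift ≈x)
      where
      i< : i ℕ.< suc t ℕ.+ suc t ℕ.+ ε
      i< = ℕₚ.<-≤-trans (ℕₚ.≤-trans (ℕₚ.m≤n+m (suc i) 2) p)
             (subst₂ ℕ._≤_ (e₁ t ε) (e₂ t ε) (ℕₚ.m≤n+m (2 ℕ.* t ℕ.+ ε ℕ.+ 1) 1))
        where e₁ : ∀ t ε → 2 ℕ.* t ℕ.+ ε ℕ.+ 1 ≡ suc (2 ℕ.* t ℕ.+ ε)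
              e₁ = ℕ-Solver.solve-∀
              e₂ : ∀ t ε → 1 ℕ.+ (2 ℕ.* t ℕ.+ ε ℕ.+ 1) ≡ suc t ℕ.+ suc t ℕ.+ ε
              e₂ = ℕ-Solver.solve-∀
      split : 4 ℕ.* t ℕ.+ 3 ℕ.+ ε ℕ.+ i ≡ 2 ℕ.* t ℕ.+ 2 ℕ.+ (1 ℕ.+ suc u ℕ.+ i)
      split = trans (e₁ t ε i) (cong (λ v → 2 ℕ.* t ℕ.+ 2 ℕ.+ (1 ℕ.+ v ℕ.+ i)) 2t+ε≡1+u)
        where e₁ : ∀ t ε i → 4 ℕ.* t ℕ.+ 3 ℕ.+ ε ℕ.+ i ≡ 2 ℕ.* t ℕ.+ 2 ℕ.+ (1 ℕ.+ (2 ℕ.* t ℕ.+ ε) ℕ.+ i)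
              e₁ = ℕ-Solver.solve-∀
      a = + (2 ℕ.* t ℕ.+ 2)
      shift : + (4 ℕ.* t ℕ.+ 3 ℕ.+ ε ℕ.+ i) - (a + + u - ζ) ≡ - 1ℤ * (a + 0ℤ - ζ - (a + (+ 2 + + i)))
      shift = trans (cong (λ v → + v - (a + + u - ζ)) split) (e a (+ u) (+ i) ζ)
        where e : ∀ a u i ζ → a + (+ 2 + u + i) - (a + u - ζ) ≡ - 1ℤ * (a + 0ℤ - ζ - (a + (+ 2 + i)))
              e = solve-∀

-- Cycles for the odd multiples of 3 from 15 on

downs : ℕ → ℕ → List ℕ
downs b zero    = []
downs b (suc n) = b ℕ.+ 2 ℕ.* n ∷ downs b n

downs-∈ : ∀ {b x} i {n} → i ℕ.< n → x ≡ b ℕ.+ 2 ℕ.* i → x ∈ downs b n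
downs-∈ {b} i {suc n} p e with ℕₚ.m≤n⇒m<n∨m≡n (ℕₚ.≤-pred p)
... | inj₁ q    = there (downs-∈ i q e)
... | inj₂ refl = here e

downs-adj : ∀ {b x y} i {n} → suc i ℕ.< n → x ≡ b ℕ.+ 2 ℕ.* suc i → y ≡ b ℕ.+ 2 ℕ.* i → Adj x y (downs b n)
downs-adj {b} i {suc n} p refl refl with ℕₚ.m≤n⇒m<n∨m≡n (ℕₚ.≤-pred p)
... | inj₁ q    = there (downs-adj {b} i q refl refl)
... | inj₂ refl = here

downs-exit : ∀ {b c} n {l} → Adj b c (downs b (suc n) ++ c ∷ l)
downs-exit {b} {c} zero {l} = subst (λ u → Adj b c (u ∷ c ∷ l)) (sym (ℕₚ.+-identityʳ b)) here
downs-exit {b} (suc n)      = there (downs-exit {b} n)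

length-downs : ∀ b n → length (downs b n) ≡ n
length-downs b zero    = refl
length-downs b (suc n) = cong suc (length-downs b n)

private abstract
  far-eq : ∀ a b x ζ → x + b - (a + b - ζ) ≡ - 1ℤ * (a + 0ℤ - ζ - x)
  far-eq = solve-∀
  excluded-eq : ∀ a ζ d → ζ - - d ≡ - 1ℤ * (a + 0ℤ - ζ - (a + d))
  excluded-eq = solve-∀
  at₅-eq : ∀ a → a + + 5 ≡ a + + 7 + - + 2
  at₅-eq = solve-∀
  at₁₀-index : ∀ l → 6 ℕ.* suc l ℕ.+ 10 ≡ 4 ℕ.* suc l ℕ.+ 11 ℕ.+ (1 ℕ.+ 2 ℕ.* l)
  at₁₀-index = ℕ-Solver.solve-∀
  at₁₀-eq : ∀ k → 6 ℕ.* k ℕ.+ 10 ≡ 4 ℕ.* k ℕ.+ 10 ℕ.+ 2 ℕ.* k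
  at₁₀-eq = ℕ-Solver.solve-∀
  middle₂-eq : ∀ k → 4 ℕ.* k ℕ.+ 9 ≡ 2 ℕ.* k ℕ.+ 7 ℕ.+ 2 ℕ.+ 2 ℕ.* k
  middle₂-eq = ℕ-Solver.solve-∀
  middle-eq : ∀ k i → 4 ℕ.* k ℕ.+ 11 ℕ.+ i ≡ 2 ℕ.* k ℕ.+ 7 ℕ.+ (4 ℕ.+ i) ℕ.+ 2 ℕ.* k
  middle-eq = ℕ-Solver.solve-∀
  bound-eq : ∀ l → 2 ℕ.+ 2 ℕ.* l ≡ 2 ℕ.* suc l
  bound-eq = ℕ-Solver.solve-∀
  bound : ∀ l → 1 ℕ.+ 2 ℕ.* l ℕ.< suc (2 ℕ.* suc l ℕ.+ 1)
  bound l = ℕ.s≤s (ℕₚ.m≤n⇒m≤n+o 1 (ℕₚ.≤-trans (ℕₚ.n≤1+n _) (ℕₚ.≤-reflexive (bound-eq l))))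
  offset-eq-1 : ∀ k → 6 ℕ.* k ℕ.+ 15 ≡ suc (suc k) ℕ.+ suc (suc k) ℕ.+
      (3 ℕ.+ (suc (2 ℕ.* k ℕ.+ 1) ℕ.+ (2 ℕ.+ (suc (2 ℕ.* k ℕ.+ 1) ℕ.+ 2))))
  offset-eq-1 = ℕ-Solver.solve-∀
  offset-eq-2 : ∀ k → suc (suc k) ℕ.+ suc (suc k) ℕ.+ 0 ≡ 2 ℕ.* k ℕ.+ 4
  offset-eq-2 = ℕ-Solver.solve-∀
  offset-eq-3 : ∀ k → suc (suc k) ℕ.+ suc (suc k) ℕ.+ 1 ≡ 2 ℕ.* k ℕ.+ 5
  offset-eq-3 = ℕ-Solver.solve-∀
  offset-eq-4 : ∀ k → suc (suc k) ℕ.+ suc (suc k) ℕ.+ 2 ≡ 2 ℕ.* k ℕ.+ 6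
  offset-eq-4 = ℕ-Solver.solve-∀
  offset-eq-5 : ∀ k y → suc (suc k) ℕ.+ suc (suc k) ℕ.+ (3 ℕ.+ y) ≡ 2 ℕ.* k ℕ.+ 7 ℕ.+ y
  offset-eq-5 = ℕ-Solver.solve-∀
  offset-eq-6 : ∀ k → suc (suc k) ℕ.+ suc (suc k) ℕ.+ (3 ℕ.+ (suc (2 ℕ.* k ℕ.+ 1) ℕ.+ 0)) ≡ 4 ℕ.* k ℕ.+ 9
  offset-eq-6 = ℕ-Solver.solve-∀
  offset-eq-7 : ∀ k → suc (suc k) ℕ.+ suc (suc k) ℕ.+ (3 ℕ.+ (suc (2 ℕ.* k ℕ.+ 1) ℕ.+ 1)) ≡ 4 ℕ.* k ℕ.+ 10
  offset-eq-7 = ℕ-Solver.solve-∀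
  offset-eq-8 : ∀ k z → suc (suc k) ℕ.+ suc (suc k) ℕ.+ (3 ℕ.+ (suc (2 ℕ.* k ℕ.+ 1) ℕ.+ (2 ℕ.+ z))) ≡ 4 ℕ.* k ℕ.+ 11 ℕ.+ z
  offset-eq-8 = ℕ-Solver.solve-∀
  offset-eq-9 : ∀ k → suc (suc k) ℕ.+ suc (suc k) ℕ.+ (3 ℕ.+ (suc (2 ℕ.* k ℕ.+ 1) ℕ.+ (2 ℕ.+ (suc (2 ℕ.* k ℕ.+ 1) ℕ.+ 0)))) ≡ 6 ℕ.* k ℕ.+ 13
  offset-eq-9 = ℕ-Solver.solve-∀
  offset-eq-10 : ∀ k → suc (suc k) ℕ.+ suc (suc k) ℕ.+ (3 ℕ.+ (suc (2 ℕ.* k ℕ.+ 1) ℕ.+ (2 ℕ.+ (suc (2 ℕ.* k ℕ.+ 1) ℕ.+ 1)))) ≡ 6 ℕ.* k ℕ.+ 14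
  offset-eq-10 = ℕ-Solver.solve-∀
  offset-eq-11 : ∀ a i → a ℕ.+ suc i ≡ a ℕ.+ 1 ℕ.+ i ℕ.* 1
  offset-eq-11 = ℕ-Solver.solve-∀
  offset-eq-12 : ∀ k → 0 ℕ.+ 1 ℕ.* (6 ℕ.* k ℕ.+ 15) ≡ 6 ℕ.* k ℕ.+ 13 ℕ.+ 2 ℕ.+ 0
  offset-eq-12 = ℕ-Solver.solve-∀
  offset-eq-13 : ∀ i → 2 ℕ.* (2 ℕ.* suc i) ℕ.+ 0 ≡ 2 ℕ.* i ℕ.+ (2 ℕ.+ 2 ℕ.* suc i) ℕ.+ 0
  offset-eq-13 = ℕ-Solver.solve-∀
  offset-eq-14 : ∀ k → 2 ℕ.+ 1 ℕ.* (6 ℕ.* k ℕ.+ 15) ≡ 6 ℕ.* k ℕ.+ 14 ℕ.+ 3 ℕ.+ 0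
  offset-eq-14 = ℕ-Solver.solve-∀
  offset-eq-15 : ∀ i → 2 ℕ.* (1 ℕ.+ 2 ℕ.* suc i) ℕ.+ 0 ≡ 1 ℕ.+ 2 ℕ.* i ℕ.+ (3 ℕ.+ 2 ℕ.* suc i) ℕ.+ 0
  offset-eq-15 = ℕ-Solver.solve-∀
  offset-eq-16 : ∀ k i → 2 ℕ.* (2 ℕ.* k ℕ.+ 7 ℕ.+ i ℕ.* 1) ℕ.+ 0 ≡
              2 ℕ.* k ℕ.+ 7 ℕ.+ i ℕ.* 1 ℕ.+ 1 ℕ.+ (2 ℕ.* k ℕ.+ 6 ℕ.+ i) ℕ.+ 0
  offset-eq-16 = ℕ-Solver.solve-∀
  offset-eq-17 : ∀ k i → 2 ℕ.* (4 ℕ.* k ℕ.+ 11 ℕ.+ i ℕ.* 1) ℕ.+ 0 ≡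
              4 ℕ.* k ℕ.+ 11 ℕ.+ i ℕ.* 1 ℕ.+ 1 ℕ.+ (4 ℕ.* k ℕ.+ 10 ℕ.+ i) ℕ.+ 0
  offset-eq-17 = ℕ-Solver.solve-∀
  offset-eq-18 : ∀ k → 2 ℕ.* (4 ℕ.* k ℕ.+ 11 ℕ.+ (2 ℕ.* k ℕ.+ 1) ℕ.* 1) ℕ.+ 0 ≡
            2 ℕ.* suc k ℕ.+ (4 ℕ.* k ℕ.+ 7 ℕ.+ 0) ℕ.+ 1 ℕ.* (6 ℕ.* k ℕ.+ 15)
  offset-eq-18 = ℕ-Solver.solve-∀
  offset-eq-19 : ∀ k → 2 ℕ.* (6 ℕ.* k ℕ.+ 13) ℕ.+ 0 ≡
            1 ℕ.+ 2 ℕ.* suc k ℕ.+ (4 ℕ.* k ℕ.+ 7 ℕ.+ 1) ℕ.+ 1 ℕ.* (6 ℕ.* k ℕ.+ 15)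
  offset-eq-19 = ℕ-Solver.solve-∀
  offset-eq-20 : ∀ k → 2 ℕ.* (6 ℕ.* k ℕ.+ 14) ℕ.+ 0 ≡
            2 ℕ.* k ℕ.+ 4 ℕ.+ (4 ℕ.* k ℕ.+ 7 ℕ.+ 2) ℕ.+ 1 ℕ.* (6 ℕ.* k ℕ.+ 15)
  offset-eq-20 = ℕ-Solver.solve-∀
  offset-eq-21 : ∀ k → 2 ℕ.* (2 ℕ.* k ℕ.+ 7 ℕ.+ (2 ℕ.* k ℕ.+ 1) ℕ.* 1) ℕ.+ 0 ≡
            2 ℕ.* k ℕ.+ 5 ℕ.+ (6 ℕ.* k ℕ.+ 11 ℕ.+ 0) ℕ.+ 0
  offset-eq-21 = ℕ-Solver.solve-∀
  offset-eq-22 : ∀ k → 2 ℕ.* (4 ℕ.* k ℕ.+ 9) ℕ.+ 0 ≡ 2 ℕ.* k ℕ.+ 6 ℕ.+ (6 ℕ.* k ℕ.+ 11 ℕ.+ 1) ℕ.+ 0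
  offset-eq-22 = ℕ-Solver.solve-∀
  offset-eq-23 : ∀ k → 2 ℕ.* (4 ℕ.* k ℕ.+ 10) ℕ.+ 0 ≡ 2 ℕ.* k ℕ.+ 7 ℕ.+ (6 ℕ.* k ℕ.+ 11 ℕ.+ 2) ℕ.+ 0
  offset-eq-23 = ℕ-Solver.solve-∀
  offset-eq-24 : ∀ k → 2 ℕ.* (2 ℕ.* k ℕ.+ 4) ℕ.+ 1 ℕ.* (6 ℕ.* k ℕ.+ 15) ≡
            4 ℕ.* k ℕ.+ 9 ℕ.+ (6 ℕ.* k ℕ.+ 11 ℕ.+ 3) ℕ.+ 0
  offset-eq-24 = ℕ-Solver.solve-∀
  offset-eq-25 : ∀ k → 2 ℕ.* (2 ℕ.* k ℕ.+ 5) ℕ.+ 0 ≡ 4 ℕ.* k ℕ.+ 10 ℕ.+ 0 ℕ.+ 0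
  offset-eq-25 = ℕ-Solver.solve-∀
  offset-eq-26 : ∀ k → 2 ℕ.* (2 ℕ.* k ℕ.+ 6) ℕ.+ 0 ≡ 4 ℕ.* k ℕ.+ 11 ℕ.+ 1 ℕ.+ 0
  offset-eq-26 = ℕ-Solver.solve-∀
  offset-eq-27 : ∀ k → 6 ℕ.* k ℕ.+ 15 ≡ 2 ℕ.+ (suc (suc k) ℕ.+ suc (suc k) ℕ.+ (2 ℕ.* k ℕ.+ 1 ℕ.+ (3 ℕ.+ (2 ℕ.* k ℕ.+ 1 ℕ.+ 4))))
  offset-eq-27 = ℕ-Solver.solve-∀
  offset-eq-28 : ∀ k y → 2 ℕ.* k ℕ.+ 6 ℕ.+ y ≡ 2 ℕ.+ (suc (suc k) ℕ.+ suc (suc k) ℕ.+ y)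
  offset-eq-28 = ℕ-Solver.solve-∀
  offset-eq-29 : ∀ k z → 4 ℕ.* k ℕ.+ 7 ℕ.+ z ≡ 2 ℕ.+ (suc (suc k) ℕ.+ suc (suc k) ℕ.+ (2 ℕ.* k ℕ.+ 1 ℕ.+ z))
  offset-eq-29 = ℕ-Solver.solve-∀
  offset-eq-30 : ∀ k w → 4 ℕ.* k ℕ.+ 10 ℕ.+ w ≡ 2 ℕ.+ (suc (suc k) ℕ.+ suc (suc k) ℕ.+ (2 ℕ.* k ℕ.+ 1 ℕ.+ (3 ℕ.+ w)))
  offset-eq-30 = ℕ-Solver.solve-∀
  offset-eq-31 : ∀ k v → 6 ℕ.* k ℕ.+ 11 ℕ.+ v ≡
              2 ℕ.+ (suc (suc k) ℕ.+ suc (suc k) ℕ.+ (2 ℕ.* k ℕ.+ 1 ℕ.+ (3 ℕ.+ (2 ℕ.* k ℕ.+ 1 ℕ.+ v))))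
  offset-eq-31 = ℕ-Solver.solve-∀

-- With j = k + 2: π(x) = x - 2 below 2j, which takes two passes, and π(x) = x + 1 on the two upper
-- runs, apart from three residues above each of 2j, 4j and 6j.
module MultipleOf3 (k : ℕ) where

  m : ℕ
  m = 6 ℕ.* k ℕ.+ 15

  c₁ c₂ : ℕ
  c₁ = 2 ℕ.* k ℕ.+ 7
  c₂ = 6 ℕ.* k ℕ.+ 13

  -- The descent by 2 continues through zero modulo m: 1 → m - 1 leaves the odd pass, and 0 → m - 2
  -- closes the second cycle. Besides the run from 2j + 3 to 4j the first cycle has only 2j + 1 and
  -- 4j + 2.
  high tail K₁ K₂ : List ℕ
  high = run (4 ℕ.* k ℕ.+ 11) 1 (suc (2 ℕ.* k ℕ.+ 1))
  tail = 6 ℕ.* k ℕ.+ 14 ∷ 2 ℕ.* k ℕ.+ 4 ∷ 4 ℕ.* k ℕ.+ 9 ∷ 2 ℕ.* k ℕ.+ 6 ∷ high ++ downs 0 (suc (suc k))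
  K₁   = run (2 ℕ.* k ℕ.+ 7 ℕ.+ 1) 1 (2 ℕ.* k ℕ.+ 1) ++ 2 ℕ.* k ℕ.+ 5 ∷ 4 ℕ.* k ℕ.+ 10 ∷ []
  K₂   = downs 1 (suc (suc k)) ++ tail

  data Region (x : ℕ) : Set where
    even   : ∀ i → i ℕ.< suc (suc k) → x ≡ 2 ℕ.* i → Region x
    odd    : ∀ i → i ℕ.< suc (suc k) → x ≡ 1 ℕ.+ 2 ℕ.* i → Region x
    at₄    : x ≡ 2 ℕ.* k ℕ.+ 4 → Region x
    at₅    : x ≡ 2 ℕ.* k ℕ.+ 5 → Region x
    at₆    : x ≡ 2 ℕ.* k ℕ.+ 6 → Region x
    middle : ∀ i → i ℕ.< suc (2 ℕ.* k ℕ.+ 1) → x ≡ 2 ℕ.* k ℕ.+ 7 ℕ.+ i → Region x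
    at₉    : x ≡ 4 ℕ.* k ℕ.+ 9 → Region x
    at₁₀   : x ≡ 4 ℕ.* k ℕ.+ 10 → Region x
    upper  : ∀ i → i ℕ.< suc (2 ℕ.* k ℕ.+ 1) → x ≡ 4 ℕ.* k ℕ.+ 11 ℕ.+ i → Region x
    at₁₃   : x ≡ 6 ℕ.* k ℕ.+ 13 → Region x
    at₁₄   : x ≡ 6 ℕ.* k ℕ.+ 14 → Region x

  private
    double : ∀ i → i ℕ.+ i ≡ 2 ℕ.* i
    double = ℕ-Solver.solve-∀

    below : ∀ n y → y ℕ.< n ℕ.+ n → (∃ λ i → i ℕ.< n × y ≡ 2 ℕ.* i) ⊎ (∃ λ i → i ℕ.< n × y ≡ 1 ℕ.+ 2 ℕ.* i)
    below n y p with halve y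
    ... | i , inj₁ refl = inj₁ (i , double-cancel-< i n p , double i)
    ... | i , inj₂ refl = inj₂ (i , double-cancel-< i n (ℕₚ.<-trans (ℕₚ.n<1+n _) p) , cong suc (double i))

  region : ∀ x → x ℕ.< m → Region x
  region x x<m with split-at (suc (suc k) ℕ.+ suc (suc k)) (subst (x ℕ.<_) (offset-eq-1 k) x<m)
  ... | inj₁ p = [ (λ { (i , q , e) → even i q e }) , (λ { (i , q , e) → odd i q e }) ]′ (below (suc (suc k)) x p)
  ... | inj₂ (0 , _ , refl) = at₄ (offset-eq-2 k)
  ... | inj₂ (1 , _ , refl) = at₅ (offset-eq-3 k)
  ... | inj₂ (2 , _ , refl) = at₆ (offset-eq-4 k)
  ... | inj₂ (suc (suc (suc y)) , ℕ.s≤s (ℕ.s≤s (ℕ.s≤s p)) , refl) with split-at (suc (2 ℕ.* k ℕ.+ 1)) p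
  ...   | inj₁ q = middle y q (offset-eq-5 k y)
  ...   | inj₂ (0 , _ , refl) = at₉ (offset-eq-6 k)
  ...   | inj₂ (1 , _ , refl) = at₁₀ (offset-eq-7 k)
  ...   | inj₂ (suc (suc z) , ℕ.s≤s (ℕ.s≤s q) , refl) with split-at (suc (2 ℕ.* k ℕ.+ 1)) q
  ...     | inj₁ r = upper z r (offset-eq-8 k z)
  ...     | inj₂ (0 , _ , refl) = at₁₃ (offset-eq-9 k)
  ...     | inj₂ (1 , _ , refl) = at₁₄ (offset-eq-10 k)
  ...     | inj₂ (suc (suc _) , ℕ.s≤s (ℕ.s≤s ()) , _)

  private
    ∈-tail : ∀ {x} → x ∈ tail → x ∈ K₂ ∷ʳ c₂
    ∈-tail p = ∈-++⁺ˡ (∈-++⁺ʳ (downs 1 (suc (suc k))) p)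

  even-∈ : ∀ {x} i → i ℕ.< suc (suc k) → x ≡ 2 ℕ.* i → x ∈ K₂ ∷ʳ c₂
  even-∈ i p e = ∈-tail (there (there (there (there (∈-++⁺ʳ high (downs-∈ i p e))))))

  odd-∈ : ∀ {x} i → i ℕ.< suc (suc k) → x ≡ 1 ℕ.+ 2 ℕ.* i → x ∈ K₂ ∷ʳ c₂
  odd-∈ i p e = ∈-++⁺ˡ (∈-++⁺ˡ (downs-∈ i p e))

  upper-∈ : ∀ {x} i → i ℕ.< suc (2 ℕ.* k ℕ.+ 1) → x ≡ 4 ℕ.* k ℕ.+ 11 ℕ.+ i → x ∈ K₂ ∷ʳ c₂
  upper-∈ i p e = ∈-tail (there (there (there (there (∈-++⁺ˡ
    (run-∈ i p (trans e (cong (4 ℕ.* k ℕ.+ 11 ℕ.+_) (sym (ℕₚ.*-identityʳ i))))))))))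

  middle-∈ : ∀ i → i ℕ.< suc (2 ℕ.* k ℕ.+ 1) → 2 ℕ.* k ℕ.+ 7 ℕ.+ i ∈ K₁ ∷ʳ c₁
  middle-∈ zero    p = ∈-++⁺ʳ K₁ (here (ℕₚ.+-identityʳ _))
  middle-∈ (suc i) (ℕ.s≤s p) = ∈-++⁺ˡ (∈-++⁺ˡ (run-∈ i p (offset-eq-11 (2 ℕ.* k ℕ.+ 7) i)))

  vertex : ∀ {x} → Region x → x ∈ K₁ ∷ʳ c₁ ⊎ x ∈ K₂ ∷ʳ c₂
  vertex (even i p e)      = inj₂ (even-∈ i p e)
  vertex (odd i p e)       = inj₂ (odd-∈ i p e)
  vertex (at₄ e)           = inj₂ (∈-tail (there (here e)))
  vertex (at₅ e)           = inj₁ (∈-++⁺ˡ (∈-++⁺ʳ (run (2 ℕ.* k ℕ.+ 7 ℕ.+ 1) 1 (2 ℕ.* k ℕ.+ 1)) (here e)))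
  vertex (at₆ e)           = inj₂ (∈-tail (there (there (there (here e)))))
  vertex (middle i p refl) = inj₁ (middle-∈ i p)
  vertex (at₉ e)           = inj₂ (∈-tail (there (there (here e))))
  vertex (at₁₀ e)          = inj₁ (∈-++⁺ˡ (∈-++⁺ʳ (run (2 ℕ.* k ℕ.+ 7 ℕ.+ 1) 1 (2 ℕ.* k ℕ.+ 1)) (there (here e))))
  vertex (upper i p e)     = inj₂ (upper-∈ i p e)
  vertex (at₁₃ e)          = inj₂ (∈-++⁺ʳ K₂ (here e))
  vertex (at₁₄ e)          = inj₂ (∈-tail (here e))

  private
    Edge : ℕ → Set
    Edge x = ∃₂ λ a b → (Adj a b (closed c₁ K₁) ⊎ Adj a b (closed c₂ K₂)) ×
             ∃₂ λ i j → 2 ℕ.* a ℕ.+ i ℕ.* m ≡ b ℕ.+ x ℕ.+ j ℕ.* m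

    in-tail : ∀ {a b} → Adj a b (tail ∷ʳ c₂) → Adj a b (closed c₂ K₂)
    in-tail p = there (adj-suffix (downs 1 (suc (suc k))) tail p)

    in-first : ∀ {a b} → Adj a b (run (2 ℕ.* k ℕ.+ 7) 1 (suc (2 ℕ.* k ℕ.+ 1)) ++ 2 ℕ.* k ℕ.+ 5 ∷ 4 ℕ.* k ℕ.+ 10 ∷ c₁ ∷ []) →
               Adj a b (closed c₁ K₁)
    in-first {a} {b} = subst (Adj a b) (sym (++-assoc (run (2 ℕ.* k ℕ.+ 7) 1 (suc (2 ℕ.* k ℕ.+ 1))) _ _))

    even-edge : ∀ i → i ℕ.< suc (suc k) → Edge (2 ℕ.+ 2 ℕ.* i)
    even-edge zero p = 0 , c₂ , inj₂ (in-tail (there (there (there (there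
      (adj-suffix high (downs 0 (suc (suc k))) (downs-exit {0} (suc k)))))))) , 1 , 0 , offset-eq-12 k
    even-edge (suc i) p = _ , _ , inj₂ (in-tail (there (there (there (there
      (adj-++ˡ _ (adj-++ʳ high (downs-adj {0} i p refl refl)))))))) , 0 , 0 , offset-eq-13 i

    odd-edge : ∀ i → i ℕ.< suc (suc k) → Edge (3 ℕ.+ 2 ℕ.* i)
    odd-edge zero p = _ , _ , inj₂ (there (adj-++ˡ _ (downs-exit {1} (suc k)))) , 1 , 0 , offset-eq-14 k
    odd-edge (suc i) p = _ , _ , inj₂ (there (adj-++ˡ _ (adj-++ˡ tail (downs-adj {1} i p refl refl)))) , 0 , 0 , offset-eq-15 i

    middle-edge : ∀ i → i ℕ.< 2 ℕ.* k ℕ.+ 1 → Edge (2 ℕ.* k ℕ.+ 6 ℕ.+ i)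
    middle-edge i p = _ , _ , inj₁ (in-first (adj-++ˡ _ (run-adj {2 ℕ.* k ℕ.+ 7} {1} i (ℕ.s≤s p) refl refl))) , 0 , 0 , offset-eq-16 k i

    upper-edge : ∀ i → i ℕ.< 2 ℕ.* k ℕ.+ 1 → Edge (4 ℕ.* k ℕ.+ 10 ℕ.+ i)
    upper-edge i p = _ , _ , inj₂ (in-tail (there (there (there (there
      (adj-++ˡ _ (adj-++ˡ _ (run-adj {4 ℕ.* k ℕ.+ 11} {1} i (ℕ.s≤s p) refl refl)))))))) , 0 , 0 , offset-eq-17 k i

    -- Modulo m, π(x) = x + 2j + 1 on 2j, 2j + 1, 2j + 2 and on 6j, 6j + 1, 6j + 2, while π(x) = x -
    -- 2j + 1 on 4j, 4j + 1, 4j + 2. The values 2x - π(x) there are the three residues around 0,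
    -- around 4j and around 6j respectively, exactly those which the runs miss. Those around 4j are
    -- treated here.
    junction-edge : ∀ i → i ℕ.< 3 → Edge (4 ℕ.* k ℕ.+ 7 ℕ.+ i)
    junction-edge 0 _ = _ , _ , inj₂ (in-tail (there (there (there (there
      (adj-++ˡ _ (run-exit (2 ℕ.* k ℕ.+ 1) refl))))))) , 0 , 1 , offset-eq-18 k
    junction-edge 1 _ = _ , _ , inj₂ here , 0 , 1 , offset-eq-19 k
    junction-edge 2 _ = _ , _ , inj₂ (in-tail here) , 0 , 1 , offset-eq-20 k
    junction-edge (suc (suc (suc _))) (ℕ.s≤s (ℕ.s≤s (ℕ.s≤s ())))

    top-edge : ∀ i → i ℕ.< 4 → Edge (6 ℕ.* k ℕ.+ 11 ℕ.+ i)
    top-edge 0 _ = _ , _ , inj₁ (in-first (run-exit {2 ℕ.* k ℕ.+ 7} {1} (2 ℕ.* k ℕ.+ 1) refl)) , 0 , 0 , offset-eq-21 k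
    top-edge 1 _ = _ , _ , inj₂ (in-tail (there (there here))) , 0 , 0 , offset-eq-22 k
    top-edge 2 _ = _ , _ , inj₁ (in-first (adj-++ʳ (run (2 ℕ.* k ℕ.+ 7) 1 (suc (2 ℕ.* k ℕ.+ 1))) (there here))) , 0 , 0 , offset-eq-23 k
    top-edge 3 _ = _ , _ , inj₂ (in-tail (there here)) , 1 , 0 , offset-eq-24 k
    top-edge (suc (suc (suc (suc _)))) (ℕ.s≤s (ℕ.s≤s (ℕ.s≤s (ℕ.s≤s ()))))

    edge : ∀ x → x ℕ.< m → Edge x
    edge 0 _ = _ , _ , inj₁ (in-first (adj-++ʳ (run (2 ℕ.* k ℕ.+ 7) 1 (suc (2 ℕ.* k ℕ.+ 1))) here)) , 0 , 0 , offset-eq-25 k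
    edge 1 _ = _ , _ , inj₂ (in-tail (there (there (there here)))) , 0 , 0 , offset-eq-26 k
    edge (suc (suc x)) x<m with split-at (suc (suc k) ℕ.+ suc (suc k)) (ℕₚ.≤-pred (ℕₚ.≤-pred (subst (suc (suc x) ℕ.<_) (offset-eq-27 k) x<m)))
    ... | inj₁ p = [ (λ { (i , q , refl) → even-edge i q }) , (λ { (i , q , refl) → odd-edge i q }) ]′ (below (suc (suc k)) x p)
    ... | inj₂ (y , p , refl) with split-at (2 ℕ.* k ℕ.+ 1) p
    ...   | inj₁ q = subst Edge (offset-eq-28 k y) (middle-edge y q)
    ...   | inj₂ (z , q , refl) with split-at 3 q
    ...     | inj₁ r = subst Edge (offset-eq-29 k z) (junction-edge z r)
    ...     | inj₂ (w , r , refl) with split-at (2 ℕ.* k ℕ.+ 1) r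
    ...       | inj₁ s = subst Edge (offset-eq-30 k w) (upper-edge w s)
    ...       | inj₂ (v , s , refl) = subst Edge (offset-eq-31 k v) (top-edge v s)

  cycles : Cyclesℕ m
  cycles = record
    { c₁ = c₁ ; c₂ = c₂ ; K₁ = K₁ ; K₂ = K₂
    ; vertices = λ x x<m → vertex (region x x<m) ; edges = edge
    ; size = trans (cong₂ (λ u v → suc u ℕ.+ suc v) length-K₁ length-K₂) (e k) }
    where
    length-K₁ : length K₁ ≡ 2 ℕ.* k ℕ.+ 1 ℕ.+ 2
    length-K₁ = trans (length-++ (run (2 ℕ.* k ℕ.+ 7 ℕ.+ 1) 1 (2 ℕ.* k ℕ.+ 1))) (cong (ℕ._+ 2) (length-run _ 1 (2 ℕ.* k ℕ.+ 1)))
    length-K₂ : length K₂ ≡ suc (suc k) ℕ.+ (4 ℕ.+ (suc (2 ℕ.* k ℕ.+ 1) ℕ.+ suc (suc k)))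
    length-K₂ = trans (length-++ (downs 1 (suc (suc k)))) (cong₂ ℕ._+_ (length-downs 1 (suc (suc k)))
      (cong (4 ℕ.+_) (trans (length-++ high) (cong₂ ℕ._+_ (length-run _ 1 (suc (2 ℕ.* k ℕ.+ 1))) (length-downs 0 (suc (suc k)))))))
    e : ∀ k → suc (2 ℕ.* k ℕ.+ 1 ℕ.+ 2) ℕ.+ suc (suc (suc k) ℕ.+ (4 ℕ.+ (suc (2 ℕ.* k ℕ.+ 1) ℕ.+ suc (suc k)))) ≡ 6 ℕ.* k ℕ.+ 15
    e = ℕ-Solver.solve-∀

  module _ where
    open Mod m
    private
      next : ∀ i → i ℕ.< 2 ℕ.* k ℕ.+ 1 → Adj (2 ℕ.* k ℕ.+ 7 ℕ.+ i) (2 ℕ.* k ℕ.+ 7 ℕ.+ i ℕ.+ 1) (closed c₁ K₁)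
      next i p = in-first (adj-++ˡ _ (run-adj {2 ℕ.* k ℕ.+ 7} {1} i (ℕ.s≤s p)
                                              (cong (2 ℕ.* k ℕ.+ 7 ℕ.+_) (sym (ℕₚ.*-identityʳ i))) refl))

      instance
        m≢0 : ℕ.NonZero m
        m≢0 = ℕ.>-nonZero (ℕₚ.m≤n⇒m≤o+n (6 ℕ.* k) (ℕ.s≤s ℕ.z≤n))

      far : ∀ {ζ x y} → + (2 ℕ.* k ℕ.+ 7 ℕ.+ 0) - ζ ≈ + x → y ∈ K₂ ∷ʳ c₂ → y ≡ x ℕ.+ 2 ℕ.* k → Block m ζ
      far {ζ} {x} ≈x y∈ refl = cut-natural-cycles cycles
        (next (2 ℕ.* k) (subst (2 ℕ.* k ℕ.<_) (ℕₚ.+-comm 1 (2 ℕ.* k)) (ℕₚ.n<1+n _))) y∈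
        (lin₁ (- 1ℤ) (far-eq (+ (2 ℕ.* k ℕ.+ 7)) (+ (2 ℕ.* k)) (+ x) ζ) ≈x)

    -- As ζ ≡ 1 (mod 3) in the application, the four exceptional values do not occur.
    block : ∀ ζ → ζ ≉ 0ℤ → ζ ≉ + 2 → ζ ≉ - 1ℤ → ζ ≉ - (+ 3) → Block m ζ
    block ζ ζ≉0 ζ≉2 ζ≉-1 ζ≉-3 with residue (+ (2 ℕ.* k ℕ.+ 7 ℕ.+ 0) - ζ)
    ... | x , x<m , ≈x = place (region x x<m)
      where
      near : x ∈ K₂ ∷ʳ c₂ → Block m ζ
      near x∈ = cut-natural-cycles cycles (next 0 (subst (0 ℕ.<_) (ℕₚ.+-comm 1 (2 ℕ.* k)) (ℕ.s≤s ℕ.z≤n))) x∈ (≈-sym ≈x)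
      excluded : ∀ {A : Set} d → ζ ≉ - d → + x ≡ + (2 ℕ.* k ℕ.+ 7) + d → A
      excluded {A = A} d ζ≉ e = contradiction
        (lin₁ (- 1ℤ) (excluded-eq (+ (2 ℕ.* k ℕ.+ 7)) ζ d) (subst (+ (2 ℕ.* k ℕ.+ 7 ℕ.+ 0) - ζ ≈_) e ≈x)) ζ≉
      place : Region x → Block m ζ
      place (even i p e)  = near (even-∈ i p e)
      place (odd i p e)   = near (odd-∈ i p e)
      place (at₄ e)       = near (∈-tail (there (here e)))
      place (at₆ e)       = near (∈-tail (there (there (there (here e)))))
      place (at₉ e)       = near (∈-tail (there (there (here e))))
      place (upper i p e) = near (upper-∈ i p e)
      place (at₁₃ e)      = near (∈-++⁺ʳ K₂ (here e))
      place (at₁₄ e)      = near (∈-tail (here e))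
      place (at₅ e)       = excluded (- + 2) ζ≉2 (trans (cong +_ e) (at₅-eq (+ (2 ℕ.* k))))
      place (at₁₀ e)      = opposite k refl
        where
        -- For k > 0, moving `p` by 2k takes 4k + 10 to 6k + 10 on the upper run. For k = 0 there is
        -- no room to move, but then 4k + 10 = 7 + 3 belongs to the excluded ζ = -3.
        opposite : ∀ l → l ≡ k → Block m ζ
        opposite zero    refl = excluded (+ 3) ζ≉-3 (cong +_ e)
        opposite (suc l) refl = far ≈x (upper-∈ {6 ℕ.* k ℕ.+ 10} (1 ℕ.+ 2 ℕ.* l) (bound l) (at₁₀-index l))
                                    (trans (at₁₀-eq k) (cong (ℕ._+ 2 ℕ.* k) (sym e)))
      place (middle 0 _ e) = excluded 0ℤ ζ≉0 (cong +_ e)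
      place (middle 1 _ e) = excluded 1ℤ ζ≉-1 (cong +_ e)
      place (middle 2 _ e) = far ≈x (∈-tail (there (there (here refl)))) (trans (middle₂-eq k) (cong (ℕ._+ 2 ℕ.* k) (sym e)))
      place (middle 3 _ e) = excluded (+ 3) ζ≉-3 (cong +_ e)
      place (middle (suc (suc (suc (suc i)))) p e) =
        far ≈x (upper-∈ i (ℕₚ.≤-trans (ℕₚ.m≤n+m (suc i) 4) p) refl) (trans (middle-eq k i) (cong (ℕ._+ 2 ℕ.* k) (sym e)))

incongruent-3 : ∀ a b {_ : False (3 ∣? ℤ.∣ a - b ∣)} → Mod._≉_ 3 a b
incongruent-3 a b {f} (Mod.congruent d) = toWitnessFalse f (∣⇒∣ᵤ d)

module Nine where

  vertex : ∀ x → x ℕ.< 9 → x ∈ 4 ∷ 3 ∷ [] ⊎ x ∈ 8 ∷ 7 ∷ 1 ∷ 5 ∷ 2 ∷ 6 ∷ 0 ∷ []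
  vertex 0 _ = inj₂ (there (there (there (there (there (there (here refl)))))))
  vertex 1 _ = inj₂ (there (there (here refl)))
  vertex 2 _ = inj₂ (there (there (there (there (here refl)))))
  vertex 3 _ = inj₁ (there (here refl))
  vertex 4 _ = inj₁ (here refl)
  vertex 5 _ = inj₂ (there (there (there (here refl))))
  vertex 6 _ = inj₂ (there (there (there (there (there (here refl))))))
  vertex 7 _ = inj₂ (there (here refl))
  vertex 8 _ = inj₂ (here refl)
  vertex (suc (suc (suc (suc (suc (suc (suc (suc (suc _))))))))) (ℕ.s≤s (ℕ.s≤s (ℕ.s≤s (ℕ.s≤s (ℕ.s≤s (ℕ.s≤s (ℕ.s≤s (ℕ.s≤s (ℕ.s≤s ())))))))))

  edge : ∀ x → x ℕ.< 9 → ∃₂ λ a b →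
         (Adj a b (3 ∷ 4 ∷ 3 ∷ []) ⊎ Adj a b (0 ∷ 8 ∷ 7 ∷ 1 ∷ 5 ∷ 2 ∷ 6 ∷ 0 ∷ [])) ×
         ∃₂ λ i j → 2 ℕ.* a ℕ.+ i ℕ.* 9 ≡ b ℕ.+ x ℕ.+ j ℕ.* 9
  edge 0 _ = 8 , 7 , inj₂ (there here) , 0 , 1 , refl
  edge 1 _ = 0 , 8 , inj₂ here , 1 , 0 , refl
  edge 2 _ = 3 , 4 , inj₁ here , 0 , 0 , refl
  edge 3 _ = 6 , 0 , inj₂ (there (there (there (there (there (there here)))))) , 0 , 1 , refl
  edge 4 _ = 7 , 1 , inj₂ (there (there here)) , 0 , 1 , refl
  edge 5 _ = 4 , 3 , inj₁ (there here) , 0 , 0 , refl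
  edge 6 _ = 1 , 5 , inj₂ (there (there (there here))) , 1 , 0 , refl
  edge 7 _ = 2 , 6 , inj₂ (there (there (there (there (there here))))) , 1 , 0 , refl
  edge 8 _ = 5 , 2 , inj₂ (there (there (there (there here)))) , 0 , 0 , refl
  edge (suc (suc (suc (suc (suc (suc (suc (suc (suc _))))))))) (ℕ.s≤s (ℕ.s≤s (ℕ.s≤s (ℕ.s≤s (ℕ.s≤s (ℕ.s≤s (ℕ.s≤s (ℕ.s≤s (ℕ.s≤s ())))))))))

  -- In the pattern for 6j + 3 the two runs of step 1 are empty for j = 1, so 9 needs cycles of its
  -- own. The first one is 3, 4 only; from p = 3 and ζ ≡ 1 (mod 3) it follows that x₀ is 2, 5 or 8.
  cycles : Cyclesℕ 9
  cycles = record { c₁ = 3 ; c₂ = 0 ; K₁ = 4 ∷ [] ; K₂ = 8 ∷ 7 ∷ 1 ∷ 5 ∷ 2 ∷ 6 ∷ []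
                  ; vertices = vertex ; edges = edge ; size = refl }

  open Mod 9

  block : ∀ ζ → Mod._≈_ 3 ζ 1ℤ → Block 9 ζ
  block ζ ζ≈1 with residue (+ 3 - ζ)
  ... | x , x<9 , ≈x = place x x<9 ≈x
    where
    mod3 : ∀ {x} → + 3 - ζ ≈ + x → Mod._≈_ 3 (+ x) (+ 2)
    mod3 {x} p = Mod.lin₂ 3 (- 1ℤ) (- 1ℤ) (e (+ x) ζ) (change-modulus 3 refl p) ζ≈1
      where e : ∀ x ζ → x - + 2 ≡ - 1ℤ * (+ 3 - ζ - x) + - 1ℤ * (ζ - 1ℤ)
            e = solve-∀
    good : ∀ {x} → + 3 - ζ ≈ + x → x ∈ 8 ∷ 7 ∷ 1 ∷ 5 ∷ 2 ∷ 6 ∷ 0 ∷ [] → Block 9 ζ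
    good p x∈ = cut-natural-cycles cycles {p = 3} here x∈ (≈-sym p)
    place : ∀ x → x ℕ.< 9 → + 3 - ζ ≈ + x → Block 9 ζ
    place 0 _ p = contradiction (mod3 p) (incongruent-3 (+ 0) (+ 2))
    place 1 _ p = contradiction (mod3 p) (incongruent-3 (+ 1) (+ 2))
    place 2 _ p = good p (there (there (there (there (here refl)))))
    place 3 _ p = contradiction (mod3 p) (incongruent-3 (+ 3) (+ 2))
    place 4 _ p = contradiction (mod3 p) (incongruent-3 (+ 4) (+ 2))
    place 5 _ p = good p (there (there (there (here refl))))
    place 6 _ p = contradiction (mod3 p) (incongruent-3 (+ 6) (+ 2))
    place 7 _ p = contradiction (mod3 p) (incongruent-3 (+ 7) (+ 2))
    place 8 _ p = good p (here refl)
    place (suc (suc (suc (suc (suc (suc (suc (suc (suc _))))))))) (ℕ.s≤s (ℕ.s≤s (ℕ.s≤s (ℕ.s≤s (ℕ.s≤s (ℕ.s≤s (ℕ.s≤s (ℕ.s≤s (ℕ.s≤s ()))))))))) _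

module Fifteen (k : ℕ) where
  open Mod (6 ℕ.* k ℕ.+ 15)

  block : ∀ ζ → Mod._≈_ 3 ζ 1ℤ → Block (6 ℕ.* k ℕ.+ 15) ζ
  block ζ ζ≈1 = MultipleOf3.block k ζ
    (away 0ℤ (incongruent-3 1ℤ 0ℤ)) (away (+ 2) (incongruent-3 1ℤ (+ 2)))
    (away (- 1ℤ) (incongruent-3 1ℤ (- 1ℤ))) (away (- + 3) (incongruent-3 1ℤ (- + 3)))
    where
    away : ∀ d → Mod._≉_ 3 1ℤ d → ζ ≉ d
    away d 1≉d p = 1≉d (Mod.≈-trans 3 (Mod.≈-sym 3 ζ≈1) (change-modulus (2 ℕ.* k ℕ.+ 5) (e k) p))
      where e : ∀ k → 6 ℕ.* k ℕ.+ 15 ≡ (2 ℕ.* k ℕ.+ 5) ℕ.* 3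
            e = ℕ-Solver.solve-∀

-- The wheel: a zigzag through the non-zero residues

-- The reflection v ↦ -1 - v exchanges the constructors `+ x` and `-[1+ x ]`, so both lists are
-- sequences of mirror pairs, in the two orientations.
zig zag : ℕ → ℕ → List ℤ
zig x zero    = []
zig x (suc n) = + x ∷ -[1+ x ] ∷ zig (suc x) n
zag x zero    = []
zag x (suc n) = -[1+ x ] ∷ + x ∷ zag (suc x) n

zig-pair : ∀ x n i → i ℕ.< n → Adj (+ (x ℕ.+ i)) -[1+ x ℕ.+ i ] (zig x n)
zig-pair x (suc n) zero    p rewrite ℕₚ.+-identityʳ x = here
zig-pair x (suc n) (suc i) (ℕ.s≤s p) rewrite ℕₚ.+-suc x i = there (there (zig-pair (suc x) n i p))

zig-link : ∀ x n i {l} → i ℕ.< n → Adj -[1+ x ℕ.+ i ] (+ suc (x ℕ.+ i)) (zig x n ++ + (x ℕ.+ n) ∷ l)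
zig-link x (suc zero)    zero    p rewrite ℕₚ.+-identityʳ x | ℕₚ.+-comm x 1 = there here
zig-link x (suc (suc n)) zero    p rewrite ℕₚ.+-identityʳ x = there here
zig-link x (suc n)       (suc i) (ℕ.s≤s p) rewrite ℕₚ.+-suc x i | ℕₚ.+-suc x n =
  there (there (zig-link (suc x) n i p))

zag-pair : ∀ x n i → i ℕ.< n → Adj -[1+ x ℕ.+ i ] (+ (x ℕ.+ i)) (zag x n)
zag-pair x (suc n) zero    p rewrite ℕₚ.+-identityʳ x = here
zag-pair x (suc n) (suc i) (ℕ.s≤s p) rewrite ℕₚ.+-suc x i = there (there (zag-pair (suc x) n i p))

zag-link : ∀ x n i {l} → i ℕ.< suc n →
           Adj (+ (x ℕ.+ i)) -[1+ suc (x ℕ.+ i) ] (+ x ∷ zag (suc x) n ++ -[1+ suc x ℕ.+ n ] ∷ l)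
zag-link x zero    zero    p rewrite ℕₚ.+-identityʳ x = here
zag-link x (suc n) zero    p rewrite ℕₚ.+-identityʳ x = here
zag-link x zero    (suc i) (ℕ.s≤s ())
zag-link x (suc n) (suc i) (ℕ.s≤s p) rewrite ℕₚ.+-suc x i | ℕₚ.+-suc x n =
  there (there (zag-link (suc x) n i p))

length-zig : ∀ x n → length (zig x n) ≡ n ℕ.+ n
length-zig x zero    = refl
length-zig x (suc n) = cong suc (trans (cong suc (length-zig (suc x) n)) (sym (ℕₚ.+-suc n n)))

length-zag : ∀ x n → length (zag x n) ≡ n ℕ.+ n
length-zag x zero    = refl
length-zag x (suc n) = cong suc (trans (cong suc (length-zag (suc x) n)) (sym (ℕₚ.+-suc n n)))

adj⇒∈ˡ : ∀ {A : Set} {a b : A} {l} → Adj a b l → a ∈ l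
adj⇒∈ˡ here      = here refl
adj⇒∈ˡ (there p) = there (adj⇒∈ˡ p)

adj⇒∈ʳ : ∀ {A : Set} {a b : A} {l} → Adj a b l → b ∈ l
adj⇒∈ʳ here      = there (here refl)
adj⇒∈ʳ (there p) = there (adj⇒∈ʳ p)

complement : ∀ {i n} → i ℕ.< n → ∃ λ j → n ≡ suc (i ℕ.+ j)
complement {i} {suc n} (ℕ.s≤s p) = n ℕ.∸ i , cong suc (sym (ℕₚ.m+[n∸m]≡n p))

-- A cycle through all residues but one whose steps are all the non-zero residues, such that
-- v and -1-v are neighbours except where this is impossible.
record Wheel (m : ℕ) : Set where
  open Mod m
  field
    hole : ℤ
    c    : ℤ
    K    : List ℤ
    vertices : ∀ w → w ≉ hole → ∃ λ x → x ∈ K ∷ʳ c × x ≈ w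
    steps    : ∀ w → w ≉ 0ℤ → ∃₂ λ x y → Adj x y (closed c K) × y - x ≈ w
    pairs    : ∀ v → v ≉ hole → - 1ℤ - v ≉ hole → + 2 * v + 1ℤ ≉ 0ℤ →
               ∃₂ λ x y → x ≈ v × y ≈ - 1ℤ - v × (Adj x y (closed c K) ⊎ Adj y x (closed c K))
    -- Twice the distance from the hole to -1/2, the fixed point of v ↦ -1-v, is ±1/2.
    centre   : ∃ λ ε → (+ 2 * hole + 1ℤ) * (+ 2 * ε) ≈ - 1ℤ
    size     : suc (suc (length K)) ≡ m

private abstract
  zig-pair-step : ∀ x → - (1ℤ + x) - x ≡ - (1ℤ + (x + x))
  zig-pair-step = solve-∀
  zig-link-step : ∀ x → 1ℤ + x - - (1ℤ + x) ≡ 1ℤ + x + (1ℤ + x)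
  zig-link-step = solve-∀
  zag-pair-step : ∀ x → x - - (1ℤ + x) ≡ 1ℤ + (x + x)
  zag-pair-step = solve-∀
  zag-link-step : ∀ x → - (+ 2 + x) - x ≡ - (+ 2 + (x + x))
  zag-link-step = solve-∀
  closing-step : ∀ x → 0ℤ - - (1ℤ + x) ≡ 1ℤ + x
  closing-step = solve-∀
  reflect : ∀ x y → - x ≡ y + - 1ℤ * (y + x)
  reflect = solve-∀
  mirror₁ : ∀ x v → - (1ℤ + x) - (- 1ℤ - v) ≡ 1ℤ * (v - x)
  mirror₁ = solve-∀
  mirror₂ : ∀ x v → x - (- 1ℤ - v) ≡ 1ℤ * (v - - (1ℤ + x))
  mirror₂ = solve-∀
  mirror₃ : ∀ x v → - 1ℤ - v - - (1ℤ + x) ≡ - 1ℤ * (v - x)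
  mirror₃ = solve-∀
  double-step : ∀ v x → + 2 * v + 1ℤ - 0ℤ ≡ + 2 * (v - x) + 1ℤ * (1ℤ + (x + x) - 0ℤ)
  double-step = solve-∀
  wrap : ∀ x → - (1ℤ + x) ≡ x + - 1ℤ * (1ℤ + (x + x))
  wrap = solve-∀
  middle : ∀ a → suc (a ℕ.+ 0) ℕ.+ suc (a ℕ.+ 0) ≡ suc (a ℕ.+ suc a)
  middle = ℕ-Solver.solve-∀
  middle′ : ∀ a → a ℕ.+ 0 ℕ.+ (a ℕ.+ 0) ≡ a ℕ.+ a
  middle′ = ℕ-Solver.solve-∀
  opposite₁ : ∀ a j x → suc (a ℕ.+ suc j) ℕ.+ suc (a ℕ.+ suc j) ℕ.+ suc (x ℕ.+ x) ≡
              suc (a ℕ.+ suc (suc (j ℕ.+ x)) ℕ.+ (a ℕ.+ suc (suc (j ℕ.+ x))))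
  opposite₁ = ℕ-Solver.solve-∀
  opposite₂ : ∀ a j x → suc (a ℕ.+ j) ℕ.+ suc (a ℕ.+ j) ℕ.+ suc (x ℕ.+ x) ≡
              suc (a ℕ.+ suc (j ℕ.+ x) ℕ.+ (a ℕ.+ suc (j ℕ.+ x)))
  opposite₂ = ℕ-Solver.solve-∀
  opposite₃ : ∀ a i j → suc (i ℕ.+ i) ℕ.+ suc (suc (a ℕ.+ j ℕ.+ (a ℕ.+ j))) ≡
              suc (a ℕ.+ suc (i ℕ.+ j) ℕ.+ (a ℕ.+ suc (i ℕ.+ j)))
  opposite₃ = ℕ-Solver.solve-∀
  centre₁ : ∀ a → (+ 2 * - (1ℤ + a) + 1ℤ) * (+ 2 * - 1ℤ) ≡ - 1ℤ + 1ℤ * (1ℤ + (a + (1ℤ + a) + (a + (1ℤ + a))))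
  centre₁ = solve-∀
  centre₂ : ∀ a → (+ 2 * - (1ℤ + a) + 1ℤ) * (+ 2 * 1ℤ) ≡ - 1ℤ + - 1ℤ * (1ℤ + (a + a + (a + a)))
  centre₂ = solve-∀
  sizes : ∀ a b → suc (suc (suc (a ℕ.+ a ℕ.+ suc (b ℕ.+ b ℕ.+ 1)))) ≡ suc (suc a ℕ.+ suc b ℕ.+ (suc a ℕ.+ suc b))
  sizes = ℕ-Solver.solve-∀

module _ (a′ b : ℕ) where
  private
    a H m : ℕ
    a = suc a′
    H = a ℕ.+ suc b
    m = suc (H ℕ.+ H)
    last : List ℤ
    last = + a ∷ zag (suc a) b ++ -[1+ suc a ℕ.+ b ] ∷ []
    K : List ℤ
    K = -[1+ 0 ] ∷ zig 1 a′ ++ last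
    W : List ℤ
    W = closed 0ℤ K
  open Mod m

  private
    in-zig : ∀ {x y} → Adj x y (zig 0 a) → Adj x y W
    in-zig p = adj-++ˡ (0ℤ ∷ []) (adj-++ˡ last p)

    in-zag : ∀ {x y} → Adj x y (zag (suc a) b) → Adj x y W
    in-zag p = adj-suffix (zig 0 a) last (there (adj-++ˡ (0ℤ ∷ []) (adj-++ˡ _ p)))

    in-link : ∀ {x y} → Adj x y last → Adj x y W
    in-link p = adj-suffix (zig 0 a) last (adj-++ˡ (0ℤ ∷ []) p)

    positive : ∀ {x y n w} → Adj x y W → y - x ≡ + n → w ≈ + n → ∃₂ λ x y → Adj x y W × y - x ≈ w
    positive p e q = _ , _ , p , ≈-trans (≡⇒≈ e) (≈-sym q)

    negative : ∀ {x y n r w} → Adj x y W → y - x ≡ - + n → w ≈ + r → r ℕ.+ n ≡ m → ∃₂ λ x y → Adj x y W × y - x ≈ w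
    negative {n = n} {r} p e q s = _ , _ , p , ≈-trans (≡⇒≈ e) (≈-trans
      (shift-modulus (- 1ℤ) (trans (reflect (+ n) (+ r)) (cong (λ z → + r + - 1ℤ * + z) s))) (≈-sym q))

    zig-step : ∀ {w} x → x ℕ.< a → ∀ {r} → w ≈ + r → r ℕ.+ suc (x ℕ.+ x) ≡ m → ∃₂ λ x y → Adj x y W × y - x ≈ w
    zig-step x p = negative (in-zig (zig-pair 0 a x p)) (zig-pair-step (+ x))

    zig-step′ : ∀ {w} x → x ℕ.< a → w ≈ + (suc x ℕ.+ suc x) → ∃₂ λ x y → Adj x y W × y - x ≈ w
    zig-step′ x p = positive (adj-++ˡ (0ℤ ∷ []) (zig-link 0 a x p)) (zig-link-step (+ x))

    zag-step : ∀ {w} i → i ℕ.< b → w ≈ + suc (suc a ℕ.+ i ℕ.+ (suc a ℕ.+ i)) → ∃₂ λ x y → Adj x y W × y - x ≈ w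
    zag-step i p = positive (in-zag (zag-pair (suc a) b i p)) (zag-pair-step (+ (suc a ℕ.+ i)))

    zag-step′ : ∀ {w} i → i ℕ.< suc b → ∀ {r} → w ≈ + r → r ℕ.+ suc (suc (a ℕ.+ i ℕ.+ (a ℕ.+ i))) ≡ m →
                ∃₂ λ x y → Adj x y W × y - x ≈ w
    zag-step′ i p = negative (in-link (zag-link a b i p)) (zag-link-step (+ (a ℕ.+ i)))

    last-step : ∀ {w} → w ≈ + suc H → ∃₂ λ x y → Adj x y W × y - x ≈ w
    last-step q = positive (adj-suffix (zig 0 a) last (adj-suffix (+ a ∷ zag (suc a) b) (-[1+ suc a ℕ.+ b ] ∷ []) here))
      (trans (closing-step (+ (suc a ℕ.+ b))) (cong (λ z → + suc z) (sym (ℕₚ.+-suc a b)))) q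

  -- Positions on the wheel of the balanced residues from -H to H: `-mid` is the hole, `+mid` its
  -- mirror image, and `end` is -1/2.
  data Folded (v : ℤ) : Set where
    +zig : ∀ x → x ℕ.< a → v ≈ + x → Folded v
    -zig : ∀ x → x ℕ.< a → v ≈ -[1+ x ] → Folded v
    +mid : v ≈ + a → Folded v
    -mid : v ≈ -[1+ a ] → Folded v
    +zag : ∀ i → i ℕ.< b → v ≈ + (suc a ℕ.+ i) → Folded v
    -zag : ∀ i → i ℕ.< b → v ≈ -[1+ suc a ℕ.+ i ] → Folded v
    end  : v ≈ + H → Folded v

  private
    locate : ∀ x → x ℕ.< H → x ℕ.< a ⊎ x ≡ a ⊎ ∃ λ i → i ℕ.< b × x ≡ suc a ℕ.+ i
    locate x p with split-at a p
    ... | inj₁ q                       = inj₁ q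
    ... | inj₂ (zero , _ , e)          = inj₂ (inj₁ (trans e (ℕₚ.+-identityʳ a)))
    ... | inj₂ (suc i , ℕ.s≤s q , e)   = inj₂ (inj₂ (i , q , trans e (ℕₚ.+-suc a i)))

  fold : ∀ v → Folded v
  fold v with residue v
  ... | x , x<m , e with split-at (suc H) x<m
  ...   | inj₁ x<1+H with ℕₚ.m≤n⇒m<n∨m≡n (ℕₚ.≤-pred x<1+H)
  ...     | inj₂ refl = end e
  ...     | inj₁ x<H with locate x x<H
  ...       | inj₁ q                     = +zig x q e
  ...       | inj₂ (inj₁ refl)           = +mid e
  ...       | inj₂ (inj₂ (i , q , refl)) = +zag i q e
  fold v | x , x<m , e | inj₂ (y , y<H , refl) with complement y<H
  ... | j , H≡ with locate j (subst (j ℕ.<_) (sym H≡) (ℕ.s≤s (ℕₚ.m≤n+m j y)))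
  ...   | located = [ (λ q → -zig j q v≈) , [ (λ { refl → -mid v≈ }) , (λ { (i , q , refl) → -zag i q v≈ }) ]′ ]′ located
    where
    v≈ : v ≈ -[1+ j ]
    v≈ = ≈-trans e (shift-modulus 1ℤ (trans (regroup (+ H) (+ y) (+ j))
           (cong (λ z → - (1ℤ + + j) + 1ℤ * (1ℤ + (+ H + + z))) (sym H≡))))
      where abstract
        regroup : ∀ h y j → 1ℤ + h + y ≡ - (1ℤ + j) + 1ℤ * (1ℤ + (h + (1ℤ + (y + j))))
        regroup = solve-∀

  private
    m≈0 : 1ℤ + (+ H + + H) ≈ 0ℤ
    m≈0 = modulus≈0

  -- Before the skipped residue -1 - a all steps have even least residues, namely 2, ..., 2a and m +
  -- 1 - 2a, ..., m - 1. After it they are odd, namely 1, ..., 2b + 1 and 2a + 3, ..., m - 2. What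
  -- is left is 2a + 2 if b = a and 2a + 1 if a = b + 1; in both cases this is H + 1, the closing
  -- step.
  wheel : b ≡ a ⊎ a ≡ suc b → Wheel m
  wheel b≡ = record
    { hole = -[1+ a ] ; c = 0ℤ ; K = K
    ; vertices = λ w w≉ → vertex w≉ (fold w)
    ; steps = λ w w≉0 → step b≡ w≉0
    ; pairs = λ v h₁ h₂ h₃ → pair h₁ h₂ h₃ (fold v)
    ; centre = centre b≡
    ; size = size }
    where
    rotate : ∀ {x} → x ∈ W → x ∈ K ∷ʳ 0ℤ
    rotate (here e)  = ∈-++⁺ʳ K (here e)
    rotate (there p) = p
    H≈ : -[1+ suc a ℕ.+ b ] ≈ + H
    H≈ = shift-modulus (- 1ℤ) (trans (cong (λ z → -[1+ z ]) (sym (ℕₚ.+-suc a b))) (wrap (+ H)))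
    vertex : ∀ {w} → w ≉ -[1+ a ] → Folded w → ∃ λ x → x ∈ K ∷ʳ 0ℤ × x ≈ w
    vertex _  (+zig x p e) = _ , rotate (adj⇒∈ˡ (in-zig (zig-pair 0 a x p))) , ≈-sym e
    vertex _  (-zig x p e) = _ , rotate (adj⇒∈ʳ (in-zig (zig-pair 0 a x p))) , ≈-sym e
    vertex _  (+mid e)     = _ , rotate (∈-++⁺ˡ (∈-++⁺ʳ (zig 0 a) (here refl))) , ≈-sym e
    vertex w≉ (-mid e)     = contradiction e w≉
    vertex _  (+zag i p e) = _ , rotate (adj⇒∈ʳ (in-zag (zag-pair (suc a) b i p))) , ≈-sym e
    vertex _  (-zag i p e) = _ , rotate (adj⇒∈ˡ (in-zag (zag-pair (suc a) b i p))) , ≈-sym e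
    vertex _  (end e)      = _ , rotate (∈-++⁺ˡ (∈-++⁺ʳ (zig 0 a) (there (∈-++⁺ʳ (zag (suc a) b) (here refl))))) ,
                             ≈-trans H≈ (≈-sym e)
    pair : ∀ {v} → v ≉ -[1+ a ] → - 1ℤ - v ≉ -[1+ a ] → + 2 * v + 1ℤ ≉ 0ℤ → Folded v →
           ∃₂ λ x y → x ≈ v × y ≈ - 1ℤ - v × (Adj x y W ⊎ Adj y x W)
    pair {v} _ _ _ (+zig x p e) = _ , _ , ≈-sym e , lin₁ 1ℤ (mirror₁ (+ x) v) e , inj₁ (in-zig (zig-pair 0 a x p))
    pair {v} _ _ _ (-zig x p e) = _ , _ , ≈-sym e , lin₁ 1ℤ (mirror₂ (+ x) v) e , inj₂ (in-zig (zig-pair 0 a x p))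
    pair {v} _ h _ (+mid e)     = contradiction (lin₁ (- 1ℤ) (mirror₃ (+ a) v) e) h
    pair     h _ _ (-mid e)     = contradiction e h
    pair {v} _ _ _ (+zag i p e) = _ , _ , ≈-sym e , lin₁ 1ℤ (mirror₁ (+ (suc a ℕ.+ i)) v) e , inj₂ (in-zag (zag-pair (suc a) b i p))
    pair {v} _ _ _ (-zag i p e) = _ , _ , ≈-sym e , lin₁ 1ℤ (mirror₂ (+ (suc a ℕ.+ i)) v) e , inj₁ (in-zag (zag-pair (suc a) b i p))
    pair {v} _ _ h (end e)      = contradiction (lin₂ (+ 2) 1ℤ (double-step v (+ H)) e m≈0) h
    even-step : b ≡ a ⊎ a ≡ suc b → ∀ {w} i → suc i ℕ.≤ H → w ≈ + (suc i ℕ.+ suc i) → ∃₂ λ x y → Adj x y W × y - x ≈ w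
    even-step b≡ i p e with split-at a p
    ... | inj₁ q = zig-step′ i q e
    even-step (inj₁ refl) i p e | inj₂ (zero , _ , refl) =
      last-step (≈-trans e (≡⇒≈ (cong +_ (middle a))))
    even-step (inj₁ refl) i p e | inj₂ (suc j , ℕ.s≤s q , refl) with complement q
    ... | x , a≡ = zig-step x (subst (x ℕ.<_) (sym a≡) (ℕ.s≤s (ℕₚ.m≤n+m x j))) e
                     (trans (opposite₁ a j x) (cong (λ z → suc (a ℕ.+ suc z ℕ.+ (a ℕ.+ suc z))) (sym a≡)))
    even-step (inj₂ a≡1+b) i p e | inj₂ (j , q , refl) with complement (subst (j ℕ.<_) (sym a≡1+b) q)
    ... | x , a≡ = zig-step x (subst (x ℕ.<_) (sym a≡) (ℕ.s≤s (ℕₚ.m≤n+m x j))) e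
                     (trans (opposite₂ a j x) (trans (cong (λ z → suc (a ℕ.+ z ℕ.+ (a ℕ.+ z))) (sym a≡)) m-even))
      where m-even = cong (λ z → suc (a ℕ.+ z ℕ.+ (a ℕ.+ z))) a≡1+b
    odd-step : b ≡ a ⊎ a ≡ suc b → ∀ {w} i → i ℕ.< H → w ≈ + suc (i ℕ.+ i) → ∃₂ λ x y → Adj x y W × y - x ≈ w
    odd-step (inj₁ refl) i p e with split-at (suc a) (subst (i ℕ.<_) (ℕₚ.+-suc a b) p)
    ... | inj₂ (j , q , refl) = zag-step j q e
    ... | inj₁ q with complement q
    ...   | j , a≡ = zag-step′ j (subst (j ℕ.<_) (sym a≡) (ℕ.s≤s (ℕₚ.m≤n+m j i))) e
                       (trans (opposite₃ a i j) (cong (λ z → suc (a ℕ.+ z ℕ.+ (a ℕ.+ z))) (sym a≡)))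
    odd-step (inj₂ a≡1+b) i p e with split-at a p
    ... | inj₂ (zero , _ , refl) = last-step (≈-trans e (≡⇒≈ (cong (λ z → + suc z)
            (trans (middle′ a) (cong (a ℕ.+_) a≡1+b)))))
    ... | inj₂ (suc j , ℕ.s≤s q , refl) = zag-step j q (≈-trans e (≡⇒≈ (cong (λ z → + suc (z ℕ.+ z)) (ℕₚ.+-suc a j))))
    ... | inj₁ q with complement q
    ...   | j , a≡ = zag-step′ j (subst (j ℕ.<_) (trans (sym a≡) a≡1+b) (ℕ.s≤s (ℕₚ.m≤n+m j i))) e
                       (trans (opposite₃ a i j) (trans (cong (λ z → suc (a ℕ.+ z ℕ.+ (a ℕ.+ z))) (sym a≡))
                         (cong (λ z → suc (a ℕ.+ z ℕ.+ (a ℕ.+ z))) a≡1+b)))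
    step : b ≡ a ⊎ a ≡ suc b → ∀ {w} → w ≉ 0ℤ → ∃₂ λ x y → Adj x y W × y - x ≈ w
    step b≡ {w} w≉0 with residue w
    ... | r , r<m , e with halve r
    ...   | zero  , inj₁ refl = contradiction e w≉0
    ...   | suc i , inj₁ refl = even-step b≡ i (ℕₚ.≤-pred (double-cancel-< (suc i) (suc H)
                                  (ℕₚ.<-trans r<m (ℕ.s≤s (subst (H ℕ.+ H ℕ.<_) (sym (ℕₚ.+-suc H H)) (ℕₚ.n<1+n _)))))) e
    ...   | i     , inj₂ refl = odd-step b≡ i (double-cancel-< i H (ℕₚ.≤-pred r<m)) e
    centre : b ≡ a ⊎ a ≡ suc b → ∃ λ ε → (+ 2 * -[1+ a ] + 1ℤ) * (+ 2 * ε) ≈ - 1ℤ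
    centre (inj₁ refl) = - 1ℤ , shift-modulus 1ℤ (centre₁ (+ a))
    centre (inj₂ a≡1+b) = 1ℤ , shift-modulus (- 1ℤ) (trans (centre₂ (+ a))
      (cong (λ z → - 1ℤ + - 1ℤ * (1ℤ + (+ a + + z + (+ a + + z)))) a≡1+b))
    size : suc (suc (length K)) ≡ m
    size = trans (cong (λ z → suc (suc (suc z))) (trans (length-++ (zig 1 a′)) (cong₂ ℕ._+_ (length-zig 1 a′)
      (cong suc (trans (length-++ (zag (suc a) b)) (cong (ℕ._+ 1) (length-zag (suc a) b))))))) (sizes a′ b)

-- A Hamiltonian path on the non-zero residues whose steps are all the non-zero residues except -2.
record ZeroRun (m : ℕ) (s : ℤ) : Set where
  open Mod m
  field
    first last     : ℤ
    path init rest : List ℤ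
    starts   : path ≡ first ∷ rest
    ends     : path ≡ init ∷ʳ last
    first≈   : first ≈ s - 1ℤ
    last≈    : last ≈ s + 1ℤ
    vertices : ∀ w → w ≉ 0ℤ → ∃ λ x → x ∈ path × x ≈ w
    steps    : ∀ w → w ≉ 0ℤ → - + 2 ≈ w ⊎ ∃₂ λ x y → Adj x y path × y - x ≈ w
    size     : suc (length path) ≡ m

reverse-closed : ∀ {A : Set} (c : A) K → reverse (closed c K) ≡ closed c (reverse K)
reverse-closed c K = trans (unfold-reverse c (K ∷ʳ c)) (cong (_∷ʳ c) (reverse-++ K (c ∷ [])))

private abstract
  scaled-vertex-eq : ∀ κ κ′ x M w → κ * (x - M) - w ≡ κ * (x - (M + κ′ * w)) + w * (κ * κ′ - 1ℤ)
  scaled-vertex-eq = solve-∀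
  scaled-step-eq : ∀ κ κ′ x y M w → κ * (y - M) - κ * (x - M) - w ≡ κ * (y - x - κ′ * w) + w * (κ * κ′ - 1ℤ)
  scaled-step-eq = solve-∀
  unit-eq : ∀ κ κ′ w → w - 0ℤ ≡ κ * (κ′ * w - 0ℤ) + - w * (κ * κ′ - 1ℤ)
  unit-eq = solve-∀
  unit-eq′ : ∀ κ κ′ w M → w - 0ℤ ≡ κ * (M + κ′ * w - M) + - w * (κ * κ′ - 1ℤ)
  unit-eq′ = solve-∀
  negate-eq : ∀ w → w - 0ℤ ≡ - 1ℤ * (- w - 0ℤ)
  negate-eq = solve-∀
  negate-step : ∀ x y w → x - y - w ≡ - 1ℤ * (y - x - - w)
  negate-step = solve-∀
  κ-unit : ∀ ε D n₂ s r → + 4 * ε * s * (r * (- D * n₂)) - 1ℤ ≡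
           - (+ 2 * n₂ * (s * r)) * (D * (+ 2 * ε) - - 1ℤ) + s * r * (+ 2 * n₂ - 1ℤ) + 1ℤ * (s * r - 1ℤ)
  κ-unit = solve-∀
  run-first-eq : ∀ ε M n₂ s r y → + 4 * ε * s * (y - M) - (s - 1ℤ) ≡
    + 4 * ε * s * (y - (- 1ℤ - (M + (1ℤ + r) * (- (+ 2 * M + 1ℤ) * n₂)))) +
    (- (+ 2 * s) + s * (1ℤ + r) * (+ 2 * n₂)) * ((+ 2 * M + 1ℤ) * (+ 2 * ε) - - 1ℤ) +
    (- (s * (1ℤ + r)) * (+ 2 * n₂ - 1ℤ) + - 1ℤ * (s * r - 1ℤ))
  run-first-eq = solve-∀
  run-last-eq : ∀ ε M n₂ s r x → + 4 * ε * s * (x - M) - (s + 1ℤ) ≡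
    + 4 * ε * s * (x - (M + (1ℤ + r) * (- (+ 2 * M + 1ℤ) * n₂))) +
    - (s * (1ℤ + r) * (+ 2 * n₂)) * ((+ 2 * M + 1ℤ) * (+ 2 * ε) - - 1ℤ) +
    (s * (1ℤ + r) * (+ 2 * n₂ - 1ℤ) + 1ℤ * (s * r - 1ℤ))
  run-last-eq = solve-∀
  not-hole : ∀ ε M n₂ r → r - - 1ℤ ≡
    + 4 * ε * (M + (1ℤ + r) * (- (+ 2 * M + 1ℤ) * n₂) - M) +
    (1ℤ + r) * (+ 2 * n₂) * ((+ 2 * M + 1ℤ) * (+ 2 * ε) - - 1ℤ) + - (1ℤ + r) * (+ 2 * n₂ - 1ℤ)
  not-hole = solve-∀
  not-mirror : ∀ ε M n₂ r → r - 1ℤ ≡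
    - (+ 4 * ε) * (- 1ℤ - (M + (1ℤ + r) * (- (+ 2 * M + 1ℤ) * n₂)) - M) +
    (- + 2 + (1ℤ + r) * (+ 2 * n₂)) * ((+ 2 * M + 1ℤ) * (+ 2 * ε) - - 1ℤ) + - (1ℤ + r) * (+ 2 * n₂ - 1ℤ)
  not-mirror = solve-∀
  not-centre : ∀ ε M n₂ r → r - 0ℤ ≡
    + 2 * ε * (+ 2 * (M + (1ℤ + r) * (- (+ 2 * M + 1ℤ) * n₂)) + 1ℤ - 0ℤ) +
    (- 1ℤ + (1ℤ + r) * (+ 2 * n₂)) * ((+ 2 * M + 1ℤ) * (+ 2 * ε) - - 1ℤ) + - (1ℤ + r) * (+ 2 * n₂ - 1ℤ)
  not-centre = solve-∀
  unit≉0 : ∀ s r → r - 1ℤ ≡ (- 1ℤ * s + s * r) * (r - 0ℤ) + (1ℤ - r) * (s * r - 1ℤ)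
  unit≉0 = solve-∀

module _ {m : ℕ} (Wh : Wheel m) {s r n₂ : ℤ} where
  open Mod m
  private
    module Wh = Wheel Wh
    open Wh using (c)
    -- Since 2f = -D, the point M + f is the centre -1/2, and so v = M + (1 + r) f has the mirror
    -- image M + (1 - r) f. `κ` is chosen with κ r f = 1, that is κ f = s. Then `scale` takes the
    -- hole to 0, v to s + 1 and -1 - v to s - 1.
    M ε D f v κ κ′ : ℤ
    M  = Wh.hole
    ε  = proj₁ Wh.centre
    D  = + 2 * M + 1ℤ
    f  = - D * n₂
    v  = M + (1ℤ + r) * f
    κ  = + 4 * ε * s
    κ′ = r * f
    scale : ℤ → ℤ
    scale x = κ * (x - M)

  module _ (n₂-half : + 2 * n₂ ≈ 1ℤ) (sr≈1 : s * r ≈ 1ℤ) (r≉1 : r ≉ 1ℤ) (r≉-1 : r ≉ - 1ℤ) where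

    private
      Dε : D * (+ 2 * ε) ≈ - 1ℤ
      Dε = proj₂ Wh.centre

      κκ′≈1 : κ * κ′ ≈ 1ℤ
      κκ′≈1 = lin₃ (- (+ 2 * n₂ * (s * r))) (s * r) 1ℤ (κ-unit ε D n₂ s r) Dε n₂-half sr≈1

      module _ (K : List ℤ)
        (vert : ∀ w → w ≉ M → ∃ λ x → x ∈ K ∷ʳ c × x ≈ w)
        (step : ∀ w → w ≉ 0ℤ → ∃₂ λ x y → Adj x y (closed c K) × y - x ≈ w)
        (size : suc (suc (length K)) ≡ m)
        {x y : ℤ} (x≈ : x ≈ v) (y≈ : y ≈ - 1ℤ - v) (edge : Adj x y (closed c K)) where

        private module O = Opened (cut-open c K edge)

        first≈ : scale y ≈ s - 1ℤ
        first≈ = lin₄ κ (- (+ 2 * s) + s * (1ℤ + r) * (+ 2 * n₂)) (- (s * (1ℤ + r))) (- 1ℤ)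
                      (run-first-eq ε M n₂ s r y) y≈ Dε n₂-half sr≈1

        last≈ : scale x ≈ s + 1ℤ
        last≈ = lin₄ κ (- (s * (1ℤ + r) * (+ 2 * n₂))) (s * (1ℤ + r)) 1ℤ
                     (run-last-eq ε M n₂ s r x) x≈ Dε n₂-half sr≈1

        oriented : ZeroRun m s
        oriented = record
          { first = scale y ; last = scale x ; path = map scale O.path
          ; init = map scale O.init ; rest = map scale O.rest
          ; starts = cong (map scale) O.starts
          ; ends = trans (cong (map scale) O.ends) (map-++ scale O.init (x ∷ []))
          ; first≈ = first≈ ; last≈ = last≈
          ; vertices = vertex ; steps = steps
          ; size = trans (cong suc (trans (length-map scale O.path) O.size)) size }
          where
          vertex : ∀ w → w ≉ 0ℤ → ∃ λ z → z ∈ map scale O.path × z ≈ w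
          vertex w w≉0 with vert (M + κ′ * w)
            (λ p → w≉0 (lin₂ κ (- w) (unit-eq′ κ κ′ w M) p κκ′≈1))
          ... | z , z∈ , e = scale z , ∈-map⁺ scale (O.vertices z∈) , lin₂ κ w (scaled-vertex-eq κ κ′ z M w) e κκ′≈1
          steps : ∀ w → w ≉ 0ℤ → - + 2 ≈ w ⊎ ∃₂ λ a b → Adj a b (map scale O.path) × b - a ≈ w
          steps w w≉0 with step (κ′ * w) (λ p → w≉0 (lin₂ κ (- w) (unit-eq κ κ′ w) p κκ′≈1))
          ... | a , b , q , e = classify (subst (λ l → Adj a b (x ∷ l)) O.starts (O.edges q))
            where
            e′ : scale b - scale a ≈ w
            e′ = lin₂ κ w (scaled-step-eq κ κ′ a b M w) e κκ′≈1
            classify : Adj a b (x ∷ y ∷ O.rest) → _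
            classify here      = inj₁ (lin₃ 1ℤ (- 1ℤ) 1ℤ (combine (scale y) (scale x) s w) e′ first≈ last≈)
              where abstract
                combine : ∀ y x s w → - + 2 - w ≡ 1ℤ * (y - x - w) + - 1ℤ * (y - (s - 1ℤ)) + 1ℤ * (x - (s + 1ℤ))
                combine = solve-∀
            classify (there t) = inj₂ (_ , _ , adj-map scale (subst (Adj a b) (sym O.starts) t) , e′)

    -- The edge to be cut exists because `v` is the hole only for r = -1, its mirror image only for
    -- r = 1, and the centre only for r = 0. It has to lead from v to -1 - v, so that its scaled
    -- step is -2; otherwise the wheel is traversed backwards.
    zero-run : ZeroRun m s
    zero-run with Wh.pairs v
      (λ p → r≉-1 (lin₃ (+ 4 * ε) ((1ℤ + r) * (+ 2 * n₂)) (- (1ℤ + r)) (not-hole ε M n₂ r) p Dε n₂-half))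
      (λ p → r≉1 (lin₃ (- (+ 4 * ε)) (- + 2 + (1ℤ + r) * (+ 2 * n₂)) (- (1ℤ + r)) (not-mirror ε M n₂ r) p Dε n₂-half))
      (λ p → r≉1 (lin₂ {a = r} {0ℤ} (- 1ℤ * s + s * r) (1ℤ - r) (unit≉0 s r)
        (lin₃ (+ 2 * ε) (- 1ℤ + (1ℤ + r) * (+ 2 * n₂)) (- (1ℤ + r)) (not-centre ε M n₂ r) p Dε n₂-half) sr≈1))
    ... | x , y , x≈ , y≈ , inj₁ q = oriented Wh.K Wh.vertices Wh.steps Wh.size x≈ y≈ q
    ... | x , y , x≈ , y≈ , inj₂ q = oriented (reverse Wh.K) vert step
        (trans (cong (λ n → suc (suc n)) (length-reverse Wh.K)) Wh.size) x≈ y≈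
        (subst (Adj x y) (reverse-closed c Wh.K) (adj-reverse q))
      where
      vert : ∀ w → w ≉ M → ∃ λ x → x ∈ reverse Wh.K ∷ʳ c × x ≈ w
      vert w w≉ with Wh.vertices w w≉
      ... | x , x∈ , e = x , [ ∈-++⁺ˡ ∘ reverse⁺ , ∈-++⁺ʳ (reverse Wh.K) ]′ (∈-++⁻ Wh.K x∈) , e
      step : ∀ w → w ≉ 0ℤ → ∃₂ λ x y → Adj x y (closed c (reverse Wh.K)) × y - x ≈ w
      step w w≉0 with Wh.steps (- w) (λ p → w≉0 (lin₁ (- 1ℤ) (negate-eq w) p))
      ... | x , y , q , e = y , x , subst (Adj y x) (reverse-closed c Wh.K) (adj-reverse q) ,
                            lin₁ (- 1ℤ) (negate-step x y w) e

-- Elements of odd order and the choice of the pieces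

^ᶻ-*ℕ : ∀ x a b → x ^ᶻ (a ℕ.* b) ≡ (x ^ᶻ b) ^ᶻ a
^ᶻ-*ℕ x zero    b = refl
^ᶻ-*ℕ x (suc a) b = trans (^ᶻ-+ x b (a ℕ.* b)) (cong (x ^ᶻ b *_) (^ᶻ-*ℕ x a b))

1^ᶻ : ∀ n → 1ℤ ^ᶻ n ≡ 1ℤ
1^ᶻ zero    = refl
1^ᶻ (suc n) = trans (ℤₚ.*-identityˡ _) (1^ᶻ n)

-1^ᶻ-odd : ∀ h → (- 1ℤ) ^ᶻ suc (h ℕ.+ h) ≡ - 1ℤ
-1^ᶻ-odd h = trans (cong (- 1ℤ *_) (trans (^ᶻ-+ (- 1ℤ) h h) (even h))) refl
  where
  even : ∀ h → (- 1ℤ) ^ᶻ h * (- 1ℤ) ^ᶻ h ≡ 1ℤ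
  even zero    = refl
  even (suc h) = trans (lemma ((- 1ℤ) ^ᶻ h)) (even h)
    where lemma : ∀ y → - 1ℤ * y * (- 1ℤ * y) ≡ y * y
          lemma = solve-∀

private abstract
  halve-eq : ∀ n → 1ℤ - 0ℤ ≡ - 1ℤ * (+ 2 * n - 1ℤ) + - n * (- 1ℤ - 1ℤ)
  halve-eq = solve-∀
  trivial-eq : ∀ r → r - 1ℤ ≡ (r - 1ℤ) * (1ℤ - 0ℤ)
  trivial-eq = solve-∀
  zero-eq : ∀ y z → 1ℤ - 0ℤ ≡ - 1ℤ * (y * z - 1ℤ) + z * (y - 0ℤ)
  zero-eq = solve-∀

module OddOrder {m : ℕ} {n₂ : ℤ} (n₂-half : Mod._≈_ m (+ 2 * n₂) 1ℤ) (1≉0 : Mod._≉_ m 1ℤ 0ℤ) (h : ℕ) where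
  open Mod m

  q : ℕ
  q = suc (h ℕ.+ h)

  -- An odd power of -1 is -1, and -1 = 1 would give 1 = 0 because 2 is invertible.
  ≉-1 : ∀ {x} → x ^ᶻ q ≈ 1ℤ → x ≉ - 1ℤ
  ≉-1 {x} x^q≈1 x≈-1 = 1≉0 (lin₂ (- 1ℤ) (- n₂) (halve-eq n₂) n₂-half
    (≈-trans (≈-sym (≈-trans (^ᶻ-cong q x≈-1) (≡⇒≈ (-1^ᶻ-odd h)))) x^q≈1))

  ≉0 : ∀ {x} → x ^ᶻ q ≈ 1ℤ → x ≉ 0ℤ
  ≉0 {x} x^q≈1 x≈0 = 1≉0 (lin₂ (- 1ℤ) (x ^ᶻ (h ℕ.+ h)) (zero-eq x (x ^ᶻ (h ℕ.+ h))) x^q≈1 x≈0)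

  power : ∀ {x} k → x ^ᶻ q ≈ 1ℤ → (x ^ᶻ k) ^ᶻ q ≈ 1ℤ
  power {x} k p = ≈-trans (≡⇒≈ (trans (sym (^ᶻ-*ℕ x q k)) (trans (cong (x ^ᶻ_) (ℕₚ.*-comm q k)) (^ᶻ-*ℕ x k q))))
                          (≈-trans (^ᶻ-cong k p) (≡⇒≈ (1^ᶻ k)))

module _ (h : ℕ) where
  private module M3 = OddOrder {3} {+ 2} (Mod.shift-modulus 3 1ℤ refl) (incongruent-3 1ℤ 0ℤ) h
  open Mod 3

  -- The only residues are 0, 1 and -1. This keeps ζ away from the exceptional values when 3 divides
  -- m.
  odd-order-mod-3 : ∀ {x} → x ^ᶻ suc (h ℕ.+ h) ≈ 1ℤ → x ≈ 1ℤ
  odd-order-mod-3 {x} p with residue x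
  ... | 0 , _ , e = contradiction e (M3.≉0 {x} p)
  ... | 1 , _ , e = e
  ... | 2 , _ , e = contradiction (≈-trans e (shift-modulus 1ℤ refl)) (M3.≉-1 {x} p)
  ... | suc (suc (suc _)) , ℕ.s≤s (ℕ.s≤s (ℕ.s≤s ())) , _

-- Odd numbers sorted by the construction that serves them. The equation in `coprime` excludes t = ε
-- = 0, where the first cycle would be a single point without a step of 1.
data Shape : ℕ → Set where
  one      : Shape 1
  three    : Shape 3
  five     : Shape 5
  nine     : Shape 9
  coprime  : ∀ t ε (ε≤1 : ε ≡ 0 ⊎ ε ≡ 1) {u} → 2 ℕ.* t ℕ.+ ε ≡ suc u → Shape (6 ℕ.* t ℕ.+ 5 ℕ.+ 2 ℕ.* ε)
  multiple : ∀ k → Shape (6 ℕ.* k ℕ.+ 15)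

private abstract
  shape₁ : ∀ d → 6 ℕ.* d ℕ.+ 5 ℕ.+ 2 ≡ 1 ℕ.+ suc d ℕ.* 6
  shape₁ = ℕ-Solver.solve-∀
  shape₃ : ∀ k → 6 ℕ.* k ℕ.+ 15 ≡ 3 ℕ.+ suc (suc k) ℕ.* 6
  shape₃ = ℕ-Solver.solve-∀
  shape₅ : ∀ d → 6 ℕ.* suc d ℕ.+ 5 ℕ.+ 0 ≡ 5 ℕ.+ suc d ℕ.* 6
  shape₅ = ℕ-Solver.solve-∀
  even₀ : ∀ d → d ℕ.* 6 ≡ 3 ℕ.* d ℕ.+ 3 ℕ.* d
  even₀ = ℕ-Solver.solve-∀
  twice : ∀ d → 2 ℕ.* suc d ℕ.+ 0 ≡ suc (suc (2 ℕ.* d))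
  twice = ℕ-Solver.solve-∀

odd≢even : ∀ h x → suc (h ℕ.+ h) ≢ x ℕ.+ x
odd≢even h       zero    ()
odd≢even zero    (suc x) e with trans (ℕₚ.suc-injective e) (ℕₚ.+-suc x x)
... | ()
odd≢even (suc h) (suc x) e = odd≢even h x (ℕₚ.suc-injective (trans (cong suc (sym (ℕₚ.+-suc h h)))
                                                    (trans (ℕₚ.suc-injective e) (ℕₚ.+-suc x x))))

shape : ∀ H → Shape (suc (H ℕ.+ H))
shape H with suc (H ℕ.+ H) % 6 | suc (H ℕ.+ H) / 6 | m≡m%n+[m/n]*n (suc (H ℕ.+ H)) 6 | m%n<n (suc (H ℕ.+ H)) 6
... | 0 | d | e | _ = contradiction (trans e (even₀ d)) (odd≢even H (3 ℕ.* d))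
... | 2 | d | e | _ = contradiction (trans e (lemma d)) (odd≢even H (1 ℕ.+ 3 ℕ.* d))
  where abstract
    lemma : ∀ d → 2 ℕ.+ d ℕ.* 6 ≡ 1 ℕ.+ 3 ℕ.* d ℕ.+ (1 ℕ.+ 3 ℕ.* d)
    lemma = ℕ-Solver.solve-∀
... | 4 | d | e | _ = contradiction (trans e (lemma d)) (odd≢even H (2 ℕ.+ 3 ℕ.* d))
  where abstract
    lemma : ∀ d → 4 ℕ.+ d ℕ.* 6 ≡ 2 ℕ.+ 3 ℕ.* d ℕ.+ (2 ℕ.+ 3 ℕ.* d)
    lemma = ℕ-Solver.solve-∀
... | 1 | zero          | e | _ = subst Shape (sym e) one
... | 1 | suc d         | e | _ = subst Shape (trans (shape₁ d) (sym e)) (coprime d 1 (inj₂ refl) (ℕₚ.+-comm (2 ℕ.* d) 1))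
... | 3 | zero          | e | _ = subst Shape (sym e) three
... | 3 | suc zero      | e | _ = subst Shape (sym e) nine
... | 3 | suc (suc k)   | e | _ = subst Shape (trans (shape₃ k) (sym e)) (multiple k)
... | 5 | zero          | e | _ = subst Shape (sym e) five
... | 5 | suc d         | e | _ = subst Shape (trans (shape₅ d) (sym e)) (coprime (suc d) 0 (inj₁ refl) (twice d))
... | suc (suc (suc (suc (suc (suc _))))) | _ | _ | ℕ.s≤s (ℕ.s≤s (ℕ.s≤s (ℕ.s≤s (ℕ.s≤s (ℕ.s≤s ())))))

wheel-of : ∀ H → 2 ℕ.≤ H → Wheel (suc (H ℕ.+ H))
wheel-of H p with halve H
... | suc i , inj₁ refl = wheel i i (inj₂ refl)
... | suc i , inj₂ refl = subst (λ z → Wheel (suc (z ℕ.+ z))) (ℕₚ.+-suc (suc i) (suc i)) (wheel i (suc i) (inj₁ refl))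
wheel-of .0 () | zero , inj₁ refl
wheel-of .1 (ℕ.s≤s ()) | zero , inj₂ refl

-- With σ = r^h, σ² is the inverse of r. `block-outer` is for the pair h, -h only, where the tour
-- turns; `block-inner` is for all the other pairs.
record Pieces (m : ℕ) (σ : ℤ) : Set where
  open Mod m
  field
    run-zero     : ZeroRun m (σ * σ)
    block-inner  : Block m 1ℤ
    block-outer  : Block m σ

module _ {H h : ℕ} {r n₂ : ℤ} where
  private
    m q : ℕ
    m = suc (H ℕ.+ H)
    q = suc (h ℕ.+ h)
  open Mod m

  -- For m = 1, 3, 5 an element of odd order can only be 1, against r ≉ 1; every other odd m has a
  -- construction. Since 1 is itself a q-th root of unity, both blocks come from one case
  -- distinction.
  pieces : + 2 * n₂ ≈ 1ℤ → r ^ᶻ q ≈ 1ℤ → r ≉ 1ℤ → Pieces m (r ^ᶻ h)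
  pieces n₂-half r^q≈1 r≉1 = record
    { run-zero = zero-run (wheel-of H (large H refl)) {n₂ = n₂} n₂-half σσr≈1 r≉1 (O.≉-1 {r} r^q≈1)
    ; block-inner = block (shape H) refl (≡⇒≈ (1^ᶻ q))
    ; block-outer = block (shape H) refl σ^q≈1 }
    where
    σ = r ^ᶻ h
    1≉0 : 1ℤ ≉ 0ℤ
    1≉0 p = r≉1 (lin₁ (r - 1ℤ) (trivial-eq r) p)
    module O = OddOrder {m} {n₂} n₂-half 1≉0 h
    σ^q≈1 : σ ^ᶻ q ≈ 1ℤ
    σ^q≈1 = O.power {r} h r^q≈1
    σσr≈1 : σ * σ * r ≈ 1ℤ
    σσr≈1 = ≈-trans (≡⇒≈ (trans (ℤₚ.*-comm (σ * σ) r) (cong (r *_) (sym (^ᶻ-+ r h h))))) r^q≈1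
    mod-3 : ∀ k → m ≡ k ℕ.* 3 → ∀ {x} → x ^ᶻ q ≈ 1ℤ → Mod._≈_ 3 x 1ℤ
    mod-3 k e {x} p = odd-order-mod-3 h {x} (change-modulus k e p)
    not-one : m ≢ 1
    not-one e = 1≉0 (shift-modulus 1ℤ (cong (λ z → 0ℤ + 1ℤ * + z) (sym e)))
    not-three : m ≢ 3
    not-three e = r≉1 (change-modulus 1 (trans (sym e) (sym (ℕₚ.+-identityʳ m))) (mod-3 1 e {r} r^q≈1))
    not-five : m ≢ 5
    not-five e with residue r
    ... | 0 , _ , p = O.≉0 {r} r^q≈1 p
    ... | 1 , _ , p = r≉1 p
    -- The squares of 2 and 3 are -1 modulo 5, but the square of `r` has odd order too.
    ... | 2 , _ , p = O.≉-1 {r ^ᶻ 2} (O.power {r} 2 r^q≈1) (≈-trans (^ᶻ-cong 2 p) (shift-modulus 1ℤ (cong (λ z → - 1ℤ + 1ℤ * + z) (sym e))))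
    ... | 3 , _ , p = O.≉-1 {r ^ᶻ 2} (O.power {r} 2 r^q≈1) (≈-trans (^ᶻ-cong 2 p) (shift-modulus (+ 2) (cong (λ z → - 1ℤ + + 2 * + z) (sym e))))
    ... | 4 , _ , p = O.≉-1 {r} r^q≈1 (≈-trans p (shift-modulus 1ℤ (cong (λ z → - 1ℤ + 1ℤ * + z) (sym e))))
    ... | suc (suc (suc (suc (suc x)))) , x<m , _ with subst (5 ℕ.+ x ℕ.<_) e x<m
    ...   | ℕ.s≤s (ℕ.s≤s (ℕ.s≤s (ℕ.s≤s (ℕ.s≤s ()))))
    large : ∀ x → x ≡ H → 2 ℕ.≤ x
    large 0             refl = contradiction refl not-one
    large 1             refl = contradiction refl not-three
    large (suc (suc x)) _    = ℕ.s≤s (ℕ.s≤s ℕ.z≤n)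
    block : ∀ {k ζ} → Shape k → k ≡ m → ζ ^ᶻ q ≈ 1ℤ → Block m ζ
    block one   e _ = contradiction (sym e) not-one
    block three e _ = contradiction (sym e) not-three
    block five  e _ = contradiction (sym e) not-five
    block {ζ = ζ} nine e p = subst (λ z → Block z ζ) e (Nine.block ζ (mod-3 3 (sym e) {ζ} p))
    block {ζ = ζ} (coprime t ε ε≤1 u) e p = subst (λ z → Block z ζ) e (CoprimeTo3.block t ε ε≤1 u ζ
      (λ z → O.≉0 {ζ} p (subst (λ k → Mod._≈_ k ζ 0ℤ) e z)) (λ z → O.≉-1 {ζ} p (subst (λ k → Mod._≈_ k ζ (- 1ℤ)) e z)))
    block {ζ = ζ} (multiple k) e p = subst (λ z → Block z ζ) e (Fifteen.block k ζ (mod-3 (2 ℕ.* k ℕ.+ 5) (trans (sym e) (lemma k)) {ζ} p))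
      where lemma : ∀ k → 6 ℕ.* k ℕ.+ 15 ≡ (2 ℕ.* k ℕ.+ 5) ℕ.* 3
            lemma = ℕ-Solver.solve-∀

-- The tour

-- (u , w) stands for the group element (u , rᵘ w), so that a step from (u , w) to (u′ , w′) has the
-- quotient (u′ - u , r^u′ (w′ - w)).
Vertex : Set
Vertex = ℕ × ℤ

record _⊑_ {A : Set} (k l : List A) : Set where
  field
    ∈-mono   : ∀ {x} → x ∈ k → x ∈ l
    adj-mono : ∀ {x y} → Adj x y k → Adj x y l
open _⊑_

⊑-infix : ∀ {A : Set} (k l n : List A) → l ⊑ (k ++ l ++ n)
⊑-infix k l n = record { ∈-mono = ∈-++⁺ʳ k ∘ ∈-++⁺ˡ ; adj-mono = adj-++ʳ k ∘ adj-++ˡ n }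

⊑-prefix : ∀ {A : Set} (l n : List A) → l ⊑ (l ++ n)
⊑-prefix l n = record { ∈-mono = ∈-++⁺ˡ ; adj-mono = adj-++ˡ n }

record Ends {A : Set} (a b : A) (l : List A) : Set where
  constructor ends
  field
    init rest : List A
    starts    : l ≡ a ∷ rest
    finishes  : l ≡ init ∷ʳ b

ends-++ : ∀ {A : Set} {a b c d : A} {k l} → Ends a b k → Ends c d l → Ends a d (k ++ l)
ends-++ {k = k} {l} (ends _ rest s _) (ends init _ _ f) =
  ends (k ++ init) (rest ++ l) (cong (_++ l) s) (trans (cong (k ++_) f) (sym (++-assoc k init _)))

junction : ∀ {A : Set} {a b c d : A} {k l} → Ends a b k → Ends c d l → Adj b c (k ++ l)
junction {b = b} {c} {k = k} {l} (ends init _ _ f) (ends _ rest s _) =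
  subst (Adj b c) (sym (trans (cong₂ _++_ f s) (++-assoc init _ _))) (adj-mid init rest)

-- Vertices of the coset pair i, j, the second of which carries the doubled coordinates.
module Layer (i j : ℕ) (c t : ℤ) where
  gx gy : ℤ → ℤ
  gx x = t + c * x
  gy x = t + c * (+ 2 * x)

  forward : List ℤ → List Vertex
  forward []      = []
  forward (x ∷ l) = (i , gx x) ∷ (j , gy x) ∷ forward l

  -- Every interior entry yields its visit to `i` followed by its visit to `j`, the first entry only
  -- the one to `j` and the last only the one to `i`. The return trip therefore starts in `j` and
  -- ends in `i`.
  mirrored : List ℤ → List Vertex
  mirrored []          = []
  mirrored (x ∷ [])    = []
  mirrored (x ∷ y ∷ l) = (j , gy x) ∷ (i , gx y) ∷ mirrored (y ∷ l)

  forward-pair : ∀ {x l} → x ∈ l → Adj (i , gx x) (j , gy x) (forward l)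
  forward-pair (here refl) = here
  forward-pair (there p)   = there (there (forward-pair p))

  forward-link : ∀ {x y l} → Adj x y l → Adj (j , gy x) (i , gx y) (forward l)
  forward-link here      = there here
  forward-link (there p) = there (there (forward-link p))

  mirrored-link : ∀ {x y l} → Adj x y l → Adj (j , gy x) (i , gx y) (mirrored l)
  mirrored-link here = here
  mirrored-link {l = _ ∷ _ ∷ _} (there p) = there (there (mirrored-link p))

  mirrored-pair : ∀ {x y l z} → x ∈ l → Adj (i , gx x) (j , gy x) (mirrored (y ∷ l ∷ʳ z))
  mirrored-pair {l = _ ∷ []}    (here refl) = there here
  mirrored-pair {l = _ ∷ _ ∷ _} (here refl) = there here
  mirrored-pair {l = _ ∷ _ ∷ _} (there p)   = there (there (mirrored-pair p))

  forward-ends : ∀ {x p init rest l} → l ≡ x ∷ rest → l ≡ init ∷ʳ p → Ends (i , gx x) (j , gy p) (forward l)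
  forward-ends {init = init} refl e = ends (prefix init) _ refl (trans (cong forward e) (unsnoc init))
    where
    prefix : List ℤ → List Vertex
    prefix []      = (i , gx _) ∷ []
    prefix (x ∷ l) = (i , gx x) ∷ (j , gy x) ∷ prefix l
    unsnoc : ∀ l → forward (l ∷ʳ _) ≡ prefix l ∷ʳ (j , gy _)
    unsnoc []      = refl
    unsnoc (x ∷ l) = cong (λ k → (i , gx x) ∷ (j , gy x) ∷ k) (unsnoc l)

  mirrored-ends : ∀ {y z} l → Ends (j , gy y) (i , gx z) (mirrored (y ∷ l ∷ʳ z))
  mirrored-ends {y} {z} l = ends (prefix y l) _ (head l) (unsnoc y l)
    where
    prefix : ℤ → List ℤ → List Vertex
    prefix y []      = (j , gy y) ∷ []
    prefix y (x ∷ l) = (j , gy y) ∷ (i , gx x) ∷ prefix x l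
    rest : List ℤ → List Vertex
    rest []      = (i , gx z) ∷ []
    rest (x ∷ l) = (i , gx x) ∷ mirrored (x ∷ l ∷ʳ z)
    head : ∀ l → mirrored (y ∷ l ∷ʳ z) ≡ (j , gy y) ∷ rest l
    head []      = refl
    head (x ∷ l) = refl
    unsnoc : ∀ y l → mirrored (y ∷ l ∷ʳ z) ≡ prefix y l ∷ʳ (i , gx z)
    unsnoc y []      = refl
    unsnoc y (x ∷ l) = cong (λ k → (j , gy y) ∷ (i , gx x) ∷ k) (unsnoc x l)

  length-forward : ∀ l → length (forward l) ≡ length l ℕ.+ length l
  length-forward []      = refl
  length-forward (x ∷ l) = cong suc (trans (cong suc (length-forward l)) (sym (ℕₚ.+-suc (length l) (length l))))

  length-mirrored : ∀ y l → length (mirrored (y ∷ l)) ≡ length l ℕ.+ length l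
  length-mirrored y []      = refl
  length-mirrored y (x ∷ l) = cong suc (trans (cong suc (length-mirrored x l)) (sym (ℕₚ.+-suc (length l) (length l))))

module Path (m : ℕ) where
  open Mod m

  Has : ℕ → ℤ → List Vertex → Set
  Has u w l = ∃ λ w′ → (u , w′) ∈ l × w′ ≈ w

  Jump : ℕ → ℕ → ℤ → List Vertex → Set
  Jump u u′ δ l = ∃₂ λ a b → Adj (u , a) (u′ , b) l × b - a ≈ δ

  has-mono : ∀ {u w k l} → k ⊑ l → Has u w k → Has u w l
  has-mono s (w , p , e) = w , ∈-mono s p , e

  jump-mono : ∀ {u u′ δ k l} → k ⊑ l → Jump u u′ δ k → Jump u u′ δ l
  jump-mono s (a , b , p , e) = a , b , adj-mono s p , e

  -- Both cosets i and j are covered, and so are the steps between them up to one label each way.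
  record Covered (i j : ℕ) (A B : ℤ) (l : List Vertex) : Set where
    field
      has-i : ∀ w → Has i w l
      has-j : ∀ w → Has j w l
      forth : ∀ δ → A ≈ δ ⊎ Jump i j δ l
      back  : ∀ δ → B ≈ δ ⊎ Jump j i δ l

  covered-mono : ∀ {i j A B k l} → k ⊑ l → Covered i j A B k → Covered i j A B l
  covered-mono s C = record
    { has-i = has-mono s ∘ C.has-i ; has-j = has-mono s ∘ C.has-j
    ; forth = λ δ → [ inj₁ , inj₂ ∘ jump-mono s ]′ (C.forth δ)
    ; back  = λ δ → [ inj₁ , inj₂ ∘ jump-mono s ]′ (C.back δ) }
    where module C = Covered C

private abstract
  scale-eq : ∀ c c′ t x w → t + c * x - w ≡ c * (x - (w - t) * c′) + (w - t) * (c * c′ - 1ℤ)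
  scale-eq = solve-∀
  double-eq : ∀ c c′ n t x w → t + c * (+ 2 * x) - w ≡
    + 2 * c * (x - (w - t) * c′ * n) + (w - t) * (c * c′) * (+ 2 * n - 1ℤ) + (w - t) * (c * c′ - 1ℤ)
  double-eq = solve-∀
  pair-eq : ∀ c c′ t x δ → t + c * (+ 2 * x) - (t + c * x) - δ ≡ c * (x - δ * c′) + δ * (c * c′ - 1ℤ)
  pair-eq = solve-∀
  missing-eq : ∀ c c′ x δ → c * x - δ ≡ c * (x - δ * c′) + δ * (c * c′ - 1ℤ)
  missing-eq = solve-∀
  link-eq : ∀ c c′ t a b δ → t + c * b - (t + c * (+ 2 * a)) - δ ≡
    - c * (+ 2 * a - b - - δ * c′) + δ * (c * c′ - 1ℤ)
  link-eq = solve-∀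
  missing-link-eq : ∀ c c′ a b δ → c * (b - + 2 * a) - δ ≡ - c * (+ 2 * a - b - - δ * c′) + δ * (c * c′ - 1ℤ)
  missing-link-eq = solve-∀
  start-eq : ∀ P y → P - y + y ≡ P
  start-eq = solve-∀
  finish-eq : ∀ P c σ ζ p x₁ x₀ → P - c * x₁ + c * x₀ - (P - (1ℤ + σ)) ≡
    - c * (x₁ - (p + 1ℤ)) + c * (x₀ - (p - ζ)) + - 1ℤ * (c * (1ℤ + ζ) - (1ℤ + σ))
  finish-eq = solve-∀
  ascend-eq : ∀ y z a → a - y - z ≡ 1ℤ * (a - (y + z))
  ascend-eq = solve-∀
  descend-eq : ∀ t c σ p x₁ x₀ b →
    t + c * (+ 2 * x₀) - b - σ * (c * (x₁ - + 2 * p)) ≡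
    - 1ℤ * (b - (t + c * (+ 2 * p) + σ * (c * x₀) - (1ℤ + σ))) + - (σ * c) * (x₁ - (p + 1ℤ)) +
    ((+ 2 * c - σ * c) * (x₀ - (p - 1ℤ)) + - 1ℤ * (c * (1ℤ + 1ℤ) - (1ℤ + σ)))
  descend-eq = solve-∀
  turn-eq : ∀ t σ p x₀ → t + 1ℤ * (+ 2 * x₀) - (t + 1ℤ * (+ 2 * p)) - - (+ 2 * σ) ≡ + 2 * (x₀ - (p - σ))
  turn-eq = solve-∀

module _ {m : ℕ} {n : ℤ} (n-half : Mod._≈_ m (+ 2 * n) 1ℤ) where
  open Mod m
  open Path m

  module Placed {ζ : ℤ} (blk : Block m ζ) (i j : ℕ) (c c′ : ℤ) (cc′≈1 : c * c′ ≈ 1ℤ) (P : ℤ) where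
    open Block blk
    -- Normalised so that `F` starts at height `P`.
    t : ℤ
    t = P - c * x₁
    open Layer i j c t public

    F M : List Vertex
    F = forward path₁
    M = mirrored (x₀ ∷ path₂)

    F-ends : Ends (i , gx x₁) (j , gy p) F
    F-ends = forward-ends starts₁ ends₁

    M-ends : Ends (j , gy x₀) (i , gx x₀) M
    M-ends = subst (λ l → Ends (j , gy x₀) (i , gx x₀) (mirrored (x₀ ∷ l))) (sym ends₂) (mirrored-ends init₂)

    length-FM : ∀ X → length (F ++ X ++ M) ≡ m ℕ.+ m ℕ.+ length X
    length-FM X = begin
      length (F ++ X ++ M)                                 ≡⟨ trans (length-++ F) (cong (length F ℕ.+_) (length-++ X)) ⟩
      length F ℕ.+ (length X ℕ.+ length M)                 ≡⟨ cong₂ (λ a b → a ℕ.+ (length X ℕ.+ b)) (length-forward path₁) (length-mirrored x₀ path₂) ⟩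
      a ℕ.+ a ℕ.+ (length X ℕ.+ (b ℕ.+ b))                 ≡⟨ shuffle a b (length X) ⟩
      (a ℕ.+ b) ℕ.+ (a ℕ.+ b) ℕ.+ length X                 ≡⟨ cong (λ z → z ℕ.+ z ℕ.+ length X) size ⟩
      m ℕ.+ m ℕ.+ length X                                 ∎
      where
      open ≡-Reasoning
      a = length path₁
      b = length path₂
      shuffle : ∀ a b x → a ℕ.+ a ℕ.+ (x ℕ.+ (b ℕ.+ b)) ≡ (a ℕ.+ b) ℕ.+ (a ℕ.+ b) ℕ.+ x
      shuffle = ℕ-Solver.solve-∀

    module _ (X : List Vertex) where
      private
        L : List Vertex
        L = F ++ X ++ M
        F⊑L : F ⊑ L
        F⊑L = ⊑-prefix F (X ++ M)
        M⊑L : M ⊑ L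
        M⊑L = record { ∈-mono = ∈-++⁺ʳ F ∘ ∈-++⁺ʳ X ; adj-mono = adj-++ʳ F ∘ adj-++ʳ X }
        pair₂ : ∀ {x} → x ∈ init₂ → Adj (i , gx x) (j , gy x) L
        pair₂ {x} q = adj-mono M⊑L (subst (λ l → Adj (i , gx x) (j , gy x) (mirrored (x₀ ∷ l))) (sym ends₂) (mirrored-pair q))

        -- The return trip begins with the copy of `x₀` in `j` and ends with its copy in `i`, so
        -- `x₀` alone is not traversed from `i` to `j`. This is the missing label in the forward
        -- direction.
        data Place (x : ℤ) : Set where
          paired : Adj (i , gx x) (j , gy x) L → Place x
          single : x ≡ x₀ → Place x

        place : ∀ w → ∃ λ x → Place x × x ≈ w
        place w with vertices w
        ... | inj₁ (x , q , e) = x , paired (adj-mono F⊑L (forward-pair q)) , e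
        ... | inj₂ (x , q , e) with ∈-++⁻ init₂ (subst (x ∈_) ends₂ q)
        ...   | inj₁ r           = x , paired (pair₂ r) , e
        ...   | inj₂ (here refl) = x , single refl , e

        first-∈ : ∀ {a b : Vertex} {l} → Ends a b l → a ∈ l
        first-∈ E = subst (_ ∈_) (sym (Ends.starts E)) (here refl)
        last-∈ : ∀ {a b : Vertex} {l} → Ends a b l → b ∈ l
        last-∈ E = subst (_ ∈_) (sym (Ends.finishes E)) (∈-++⁺ʳ (Ends.init E) (here refl))

        ∈-i : ∀ {x} → Place x → (i , gx x) ∈ L
        ∈-i (paired q)    = adj⇒∈ˡ q
        ∈-i (single refl) = ∈-mono M⊑L (last-∈ M-ends)
        ∈-j : ∀ {x} → Place x → (j , gy x) ∈ L
        ∈-j (paired q)    = adj⇒∈ʳ q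
        ∈-j (single refl) = ∈-mono M⊑L (first-∈ M-ends)

        link : ∀ {a b} → Adj a b path₁ ⊎ Adj a b (x₀ ∷ path₂) → Adj (j , gy a) (i , gx b) L
        link (inj₁ q) = adj-mono F⊑L (forward-link q)
        link (inj₂ q) = adj-mono M⊑L (mirrored-link q)

        has-i′ : ∀ w → Has i w L
        has-i′ w with place ((w - t) * c′)
        ... | x , q , e = gx x , ∈-i q , lin₂ c (w - t) (scale-eq c c′ t x w) e cc′≈1
        has-j′ : ∀ w → Has j w L
        has-j′ w with place ((w - t) * c′ * n)
        ... | x , q , e = gy x , ∈-j q ,
          lin₃ (+ 2 * c) ((w - t) * (c * c′)) (w - t) (double-eq c c′ n t x w) e n-half cc′≈1
        forth′ : ∀ δ → c * x₀ ≈ δ ⊎ Jump i j δ L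
        forth′ δ with place (δ * c′)
        ... | x , paired q    , e = inj₂ (gx x , gy x , q , lin₂ c δ (pair-eq c c′ t x δ) e cc′≈1)
        ... | x , single refl , e = inj₁ (lin₂ c δ (missing-eq c c′ x δ) e cc′≈1)
        back′ : ∀ δ → c * (x₁ - + 2 * p) ≈ δ ⊎ Jump j i δ L
        back′ δ with edges (- δ * c′)
        ... | inj₁ e               = inj₁ (lin₂ (- c) δ (missing-link-eq c c′ p x₁ δ) e cc′≈1)
        ... | inj₂ (a , b , q , e) = inj₂ (gy a , gx b , link q , lin₂ (- c) δ (link-eq c c′ t a b δ) e cc′≈1)

      covered : Covered i j (c * x₀) (c * (x₁ - + 2 * p)) L
      covered = record { has-i = has-i′ ; has-j = has-j′ ; forth = forth′ ; back = back′ }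

    -- The drop is c (x₁ - x₀) = c (1 + ζ). Keeping it at 1 + σ for every pair makes the nesting
    -- independent of the depth.
    finish≈ : ∀ {σ} → c * (1ℤ + ζ) ≈ 1ℤ + σ → gx x₀ ≈ P - (1ℤ + σ)
    finish≈ {σ} e = lin₃ (- c) c (- 1ℤ) (finish-eq P c σ ζ p x₁ x₀) x₁≈ x₀≈ e

  module Nest {σ : ℤ} (inner : Block m 1ℤ) (outer : Block m σ) (c c′ : ℤ) (cc′≈1 : c * c′ ≈ 1ℤ)
              (2c≈1+σ : c * (1ℤ + 1ℤ) ≈ 1ℤ + σ) (h : ℕ) where
    private
      module I = Block inner
      module O = Block outer
      module Outer (i k : ℕ) (P : ℤ) = Placed outer i (suc (h ℕ.+ k)) 1ℤ 1ℤ (≡⇒≈ refl) P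
      module Inner (i k : ℕ) (P : ℤ) = Placed inner i (suc (h ℕ.+ k)) c c′ cc′≈1 P

    -- The labels missing from the pair h - b, h + 1 + b. They agree for all b > 0, as these pairs
    -- share block and scale; hence the link next to one pair can replace the missing label of
    -- another.
    A B : ℕ → ℤ
    A zero    = 1ℤ * O.x₀
    A (suc _) = c * I.x₀
    B zero    = 1ℤ * (O.x₁ - + 2 * O.p)
    B (suc _) = c * (I.x₁ - + 2 * I.p)

    next : ℕ → ℕ → ℤ → ℤ
    next i k P = Inner.gy i (suc k) P I.p + σ * (c * I.x₀)

    nest : ℕ → ℕ → ℤ → List Vertex
    nest i zero    P = Outer.F i 0 P ++ [] ++ Outer.M i 0 P
    nest i (suc k) P = Inner.F i (suc k) P ++ nest (suc i) k (next i k P) ++ Inner.M i (suc k) P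

    nest-ends : ∀ i k P → ∃₂ λ a b → Ends (i , a) (i , b) (nest i k P) × a ≈ P × b ≈ P - (1ℤ + σ)
    nest-ends i zero P = _ , _ , ends-++ (Outer.F-ends i 0 P) (Outer.M-ends i 0 P) ,
      ≡⇒≈ (start-eq P _) , Outer.finish≈ i 0 P {σ} (≡⇒≈ (ℤₚ.*-identityˡ _))
    nest-ends i (suc k) P with nest-ends (suc i) k (next i k P)
    ... | _ , _ , E , _ = _ , _ , ends-++ (Inner.F-ends i (suc k) P) (ends-++ E (Inner.M-ends i (suc k) P)) ,
      ≡⇒≈ (start-eq P _) , Inner.finish≈ i (suc k) P {σ} 2c≈1+σ

    length-nest : ∀ i k P → length (nest i k P) ≡ suc k ℕ.* (m ℕ.+ m)
    length-nest i zero    P = Outer.length-FM i 0 P []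
    length-nest i (suc k) P = trans (Inner.length-FM i (suc k) P (nest (suc i) k (next i k P)))
                                    (cong (m ℕ.+ m ℕ.+_) (length-nest (suc i) k (next i k P)))

    private
      deeper : ∀ i k P → nest (suc i) k (next i k P) ⊑ nest i (suc k) P
      deeper i k P = ⊑-infix (Inner.F i (suc k) P) (nest (suc i) k (next i k P)) (Inner.M i (suc k) P)

    nest-covered : ∀ i k P d b → d ℕ.+ b ≡ k → ∀ {i′} → i′ ≡ d ℕ.+ i →
                   Covered i′ (suc (h ℕ.+ b)) (A b) (B b) (nest i k P)
    nest-covered i zero    P zero    .0 refl refl = Outer.covered i 0 P []
    nest-covered i (suc k) P zero    ._ refl refl = Inner.covered i (suc k) P (nest (suc i) k (next i k P))
    nest-covered i (suc k) P (suc d) b  e    refl =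
      covered-mono (deeper i k P) (nest-covered (suc i) k (next i k P) d b (ℕₚ.suc-injective e) (sym (ℕₚ.+-suc d i)))

    -- `next` is chosen to give the first link its label. That leaves no freedom for the second
    -- link, which has 2c (x₀ - p) - σ c x₀ + (1 + σ); this equals σ c (x₁ - 2p) because x₀ = p - 1,
    -- x₁ = p + 1 and 2c = 1 + σ.
    nest-connected : ∀ i k P d b → d ℕ.+ suc b ≡ k → ∀ {i′} → i′ ≡ d ℕ.+ i →
                     Jump (suc (h ℕ.+ suc b)) (suc i′) (σ * A (suc b)) (nest i k P) ×
                     Jump (suc i′) (suc (h ℕ.+ suc b)) (σ * B (suc b)) (nest i k P)
    nest-connected i (suc k) P zero ._ refl refl with nest-ends (suc i) k (next i k P)
    ... | a , b , E , a≈ , b≈ =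
      (_ , a , junction (Inner.F-ends i (suc k) P) (ends-++ E (Inner.M-ends i (suc k) P)) ,
        lin₁ 1ℤ (ascend-eq (Inner.gy i (suc k) P I.p) (σ * (c * I.x₀)) a) a≈) ,
      (b , _ , adj-++ʳ (Inner.F i (suc k) P) (junction E (Inner.M-ends i (suc k) P)) ,
        lin₄ (- 1ℤ) (- (σ * c)) (+ 2 * c - σ * c) (- 1ℤ)
             (descend-eq (Inner.t i (suc k) P) c σ I.p I.x₁ I.x₀ b) b≈ I.x₁≈ I.x₀≈ 2c≈1+σ)
    nest-connected i (suc k) P (suc d) b e refl
      with nest-connected (suc i) k (next i k P) d b (ℕₚ.suc-injective e) (sym (ℕₚ.+-suc d i))
    ... | u , v = jump-mono (deeper i k P) u , jump-mono (deeper i k P) v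

    -- In the innermost pair nothing separates the two visits, so 2p is followed by 2x₀ = 2p - 2σ in
    -- the same coset h + 1. The quotient is -2σ r^(h+1) = -2 r^q = -2, the one that the zigzag
    -- lacks.
    nest-turn : ∀ i k P → Jump (suc (h ℕ.+ 0)) (suc (h ℕ.+ 0)) (- (+ 2 * σ)) (nest i k P)
    nest-turn i zero P = _ , _ , junction (Outer.F-ends i 0 P) (Outer.M-ends i 0 P) ,
      lin₁ (+ 2) (turn-eq (Outer.t i 0 P) σ O.p O.x₀) O.x₀≈
    nest-turn i (suc k) P = jump-mono (deeper i k P) (nest-turn (suc i) k (next i k P))

private abstract
  alternating-step : ∀ σ y z → (1ℤ + σ) * y ≡ 1ℤ + z → (1ℤ + σ) * (σ * σ * y + (1ℤ - σ)) ≡ 1ℤ + σ * (σ * z)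
  alternating-step σ y z e = trans (l σ y) (trans (cong (λ w → σ * σ * w + (1ℤ - σ * σ)) e) (r σ z))
    where l : ∀ σ y → (1ℤ + σ) * (σ * σ * y + (1ℤ - σ)) ≡ σ * σ * ((1ℤ + σ) * y) + (1ℤ - σ * σ)
          l = solve-∀
          r : ∀ σ z → σ * σ * (1ℤ + z) + (1ℤ - σ * σ) ≡ 1ℤ + σ * (σ * z)
          r = solve-∀
  alternating-unit : ∀ σ n y z → (1ℤ + σ) * y ≡ 1ℤ + z →
                     (1ℤ + σ) * n * y - 1ℤ ≡ 1ℤ * (+ 2 * n - 1ℤ) + n * (z - 1ℤ)
  alternating-unit σ n y z e = trans (l σ n y) (trans (cong (λ w → n * w - 1ℤ) e) (r n z))
    where l : ∀ σ n y → (1ℤ + σ) * n * y - 1ℤ ≡ n * ((1ℤ + σ) * y) - 1ℤ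
          l = solve-∀
          r : ∀ n z → n * (1ℤ + z) - 1ℤ ≡ 1ℤ * (+ 2 * n - 1ℤ) + n * (z - 1ℤ)
          r = solve-∀
  double-unit : ∀ σ n → (1ℤ + σ) * n * (1ℤ + 1ℤ) - (1ℤ + σ) ≡ (1ℤ + σ) * (+ 2 * n - 1ℤ)
  double-unit = solve-∀
  entry-eq : ∀ z y a → a - z - y ≡ 1ℤ * (a - (z + y))
  entry-eq = solve-∀
  exit-eq : ∀ σ z x₀ x₁ p b → 0ℤ - b - σ * (1ℤ * (x₁ - + 2 * p)) ≡
    - 1ℤ * (b - (z + σ * (1ℤ * x₀) - (1ℤ + σ))) + - 1ℤ * (z - (σ * σ + 1ℤ)) +
    (- σ * (x₀ - (p - σ)) + - σ * (x₁ - (p + 1ℤ)))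
  exit-eq = solve-∀
  label-plain : ∀ x δ → 1ℤ * x - δ ≡ 1ℤ * (x - δ)
  label-plain = solve-∀
  label-straight : ∀ a b δ → a * (b * δ) - δ ≡ δ * (a * b - 1ℤ)
  label-straight = solve-∀
  label-detour : ∀ a s b B δ → a * (s * B) - δ ≡ a * s * (B - b * δ) + δ * (a * s * b - 1ℤ)
  label-detour = solve-∀
  label-turn : ∀ a s δ → a * - (+ 2 * s) - δ ≡ - + 2 * (a * s - 1ℤ) + 1ℤ * (- + 2 - δ)
  label-turn = solve-∀

-- The sum 1 - σ + σ² - ... + σ^(2k). Times 1 + σ it gives 1 + σ^(2k+1), which is 2 for k = h; this
-- makes (1 + σ)/2 a unit.
alternating : ℤ → ℕ → ℤ
alternating σ zero    = 1ℤ
alternating σ (suc k) = σ * σ * alternating σ k + (1ℤ - σ)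

alternating-sum : ∀ σ k → (1ℤ + σ) * alternating σ k ≡ 1ℤ + σ ^ᶻ suc (k ℕ.+ k)
alternating-sum σ zero    = trans (ℤₚ.*-identityʳ _) (cong (λ z → 1ℤ + z) (sym (ℤₚ.*-identityʳ σ)))
alternating-sum σ (suc k) = trans (alternating-step σ _ _ (alternating-sum σ k))
  (cong (λ e → 1ℤ + σ * σ ^ᶻ e) (cong suc (sym (ℕₚ.+-suc k k))))

module Tour (H h′ : ℕ) {r n : ℤ}
  (n-half : Mod._≈_ (suc (H ℕ.+ H)) (+ 2 * n) 1ℤ)
  (r^q≈1 : Mod._≈_ (suc (H ℕ.+ H)) (r ^ᶻ suc (suc h′ ℕ.+ suc h′)) 1ℤ)
  (Pcs : Pieces (suc (H ℕ.+ H)) (r ^ᶻ suc h′)) where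
  private
    h m q : ℕ
    h = suc h′
    m = suc (H ℕ.+ H)
    q = suc (h ℕ.+ h)
    σ : ℤ
    σ = r ^ᶻ h
  open Mod m
  open Path m

  private
    module Pc = Pieces Pcs
    module Z = ZeroRun Pc.run-zero
    module O = Block Pc.block-outer
    c c′ : ℤ
    c  = (1ℤ + σ) * n
    c′ = alternating σ h

    abstract
      power-one : ∀ {e} k → e ≡ k ℕ.* q → r ^ᶻ e ≈ 1ℤ
      power-one k refl = ≈-trans (≡⇒≈ (^ᶻ-*ℕ r k q)) (≈-trans (^ᶻ-cong k r^q≈1) (≡⇒≈ (1^ᶻ k)))

      cc′≈1 : c * c′ ≈ 1ℤ
      cc′≈1 = lin₂ 1ℤ n (alternating-unit σ n c′ (σ ^ᶻ q) (alternating-sum σ h)) n-half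
        (≈-trans (≡⇒≈ (sym (^ᶻ-*ℕ r q h))) (power-one h (ℕₚ.*-comm q h)))

      2c≈1+σ : c * (1ℤ + 1ℤ) ≈ 1ℤ + σ
      2c≈1+σ = lin₁ (1ℤ + σ) (double-unit σ n) n-half

    module N = Nest {m} {n} n-half {σ} Pc.block-inner Pc.block-outer c c′ cc′≈1 2c≈1+σ h

    P₁ : ℤ
    P₁ = Z.last + σ * N.A 0

    at-zero : ℤ → Vertex
    at-zero z = 0 , z

    zeros coils : List Vertex
    zeros = map at-zero Z.path
    coils = N.nest 1 h′ P₁

  tour : List Vertex
  tour = zeros ++ coils ++ (0 , 0ℤ) ∷ []

  private
    zeros⊑ : zeros ⊑ tour
    zeros⊑ = ⊑-prefix zeros _
    coils⊑ : coils ⊑ tour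
    coils⊑ = ⊑-infix zeros coils _

    zeros-ends : Ends (0 , Z.first) (0 , Z.last) zeros
    zeros-ends = ends (map at-zero Z.init) (map at-zero Z.rest) (cong (map at-zero) Z.starts)
      (trans (cong (map at-zero) Z.ends) (map-++ at-zero Z.init _))

    entry : Jump 0 1 (σ * N.A 0) tour
    entry with N.nest-ends 1 h′ P₁
    ... | a , b , E , a≈ , b≈ = Z.last , a , junction zeros-ends (ends-++ E (ends [] [] refl refl)) ,
      lin₁ 1ℤ (entry-eq Z.last (σ * N.A 0) a) a≈

    -- `P₁` was fixed by the label of the entry, so this label has to come out by itself. It does
    -- since the zigzag ends at σ² + 1: with x₀ = p - σ and x₁ = p + 1, leaving at last + σ x₀ - (1
    -- + σ) for 0 gives σ (x₁ - 2p).
    exit : Jump 1 0 (σ * N.B 0) tour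
    exit with N.nest-ends 1 h′ P₁
    ... | a , b , E , a≈ , b≈ = b , 0ℤ , adj-++ʳ zeros (junction E (ends [] [] refl refl)) ,
      lin₄ (- 1ℤ) (- 1ℤ) (- σ) (- σ) (exit-eq σ Z.last O.x₀ O.x₁ O.p b) b≈ Z.last≈ O.x₀≈ O.x₁≈

    length-eq : ∀ z h′ m → suc z ≡ m → z ℕ.+ (suc h′ ℕ.* (m ℕ.+ m) ℕ.+ 1) ≡ suc (suc h′ ℕ.+ suc h′) ℕ.* m
    length-eq z h′ _ refl = lemma z h′
      where lemma : ∀ z h′ → z ℕ.+ (suc h′ ℕ.* (suc z ℕ.+ suc z) ℕ.+ 1) ≡ suc (suc h′ ℕ.+ suc h′) ℕ.* suc z
            lemma = ℕ-Solver.solve-∀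

  length-tour : length tour ≡ q ℕ.* m
  length-tour = trans (trans (length-++ zeros) (cong₂ ℕ._+_ (length-map at-zero Z.path)
    (trans (length-++ coils) (cong (ℕ._+ 1) (N.length-nest 1 h′ P₁))))) (length-eq (length Z.path) h′ m Z.size)

  zero? : ∀ w → w ≈ 0ℤ ⊎ w ≉ 0ℤ
  zero? w with residue w
  ... | zero  , _   , e = inj₁ e
  ... | suc x , x<m , e = inj₂ λ p → contradiction (residue-unique x<m (ℕ.s≤s ℕ.z≤n) (≈-trans (≈-sym e) p)) λ ()

  private
    coil : ∀ d b → d ℕ.+ b ≡ h′ → Covered (suc d) (suc (h ℕ.+ b)) (N.A b) (N.B b) coils
    coil d b e = N.nest-covered 1 h′ P₁ d b e (ℕₚ.+-comm 1 d)

  vertices : ∀ u w → u ℕ.< q → Has u w tour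
  vertices zero w _ with zero? w
  ... | inj₁ w≈0 = 0ℤ , ∈-++⁺ʳ zeros (∈-++⁺ʳ coils (here refl)) , ≈-sym w≈0
  ... | inj₂ w≉0 with Z.vertices w w≉0
  ...   | z , z∈ , e = z , ∈-mono zeros⊑ (∈-map⁺ at-zero z∈) , e
  vertices (suc u) w (ℕ.s≤s p) with split-at h p
  ... | inj₁ (ℕ.s≤s u≤h′)       = has-mono coils⊑ (Covered.has-i (coil u (h′ ℕ.∸ u) (ℕₚ.m+[n∸m]≡n u≤h′)) w)
  ... | inj₂ (b , ℕ.s≤s b≤h′ , refl) = has-mono coils⊑ (Covered.has-j (coil (h′ ℕ.∸ b) b (ℕₚ.m∸n+n≡m b≤h′)) w)

  -- Coset indices in the tour are numbers below q, so the congruence of u + d and u′ modulo q is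
  -- one of two equations.
  Step : ℕ → ℤ → Set
  Step d δ = ∃₂ λ u u′ → ∃ λ δ′ → Jump u u′ δ′ tour × (u ℕ.+ d ≡ u′ ⊎ u ℕ.+ d ≡ u′ ℕ.+ q) × r ^ᶻ u′ * δ′ ≈ δ

  private
    straight : ∀ {δ} a b → a ℕ.+ b ≡ q → r ^ᶻ a * (r ^ᶻ b * δ) ≈ δ
    straight {δ} a b e = lin₁ δ (label-straight (r ^ᶻ a) (r ^ᶻ b) δ)
      (≈-trans (≡⇒≈ (sym (^ᶻ-+ r a b))) (power-one 1 (trans e (sym (ℕₚ.*-identityˡ q)))))

    -- For a label X missing from its pair, X = r^b δ. A link into coset a carrying σ X yields the
    -- quotient r^(a+h+b) δ, which is δ once the exponent is a multiple of q.
    detour : ∀ {δ X} a b k → X ≈ r ^ᶻ b * δ → a ℕ.+ h ℕ.+ b ≡ k ℕ.* q → r ^ᶻ a * (σ * X) ≈ δ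
    detour {δ} {X} a b k X≈ e = lin₂ (r ^ᶻ a * σ) δ (label-detour (r ^ᶻ a) σ (r ^ᶻ b) X δ) X≈
      (≈-trans (≡⇒≈ (sym (trans (^ᶻ-+ r (a ℕ.+ h) b) (cong (_* r ^ᶻ b) (^ᶻ-+ r a h))))) (power-one k e))

    level-step : ∀ δ → δ ≉ 0ℤ → Step 0 δ
    level-step δ δ≉0 with Z.steps δ δ≉0
    ... | inj₂ (x , y , p , e) = 0 , 0 , y - x , (x , y , adj-mono zeros⊑ (adj-map at-zero p) , ≡⇒≈ refl) , inj₁ refl ,
                                 lin₁ 1ℤ (label-plain (y - x) δ) e
    ... | inj₁ e = _ , _ , _ , jump-mono coils⊑ (N.nest-turn 1 h′ P₁) , inj₁ (ℕₚ.+-identityʳ _) ,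
      lin₂ (- + 2) 1ℤ (label-turn (r ^ᶻ suc (h ℕ.+ 0)) σ δ)
        (≈-trans (≡⇒≈ (sym (^ᶻ-+ r (suc (h ℕ.+ 0)) h))) (power-one 1 (lemma h))) e
      where lemma : ∀ h → suc (h ℕ.+ 0) ℕ.+ h ≡ 1 ℕ.* suc (h ℕ.+ h)
            lemma = ℕ-Solver.solve-∀

    -- The cosets d + 1 and h + 1 + b of one pair differ by 2b + 1. Its missing label is supplied by
    -- the entry from coset 0 if b = 0, and otherwise by the link at the pair h - b, for which d and
    -- b - 1 change places.
    odd-step : ∀ d b → d ℕ.+ b ≡ h′ → ∀ δ → Step (suc (b ℕ.+ b)) δ
    odd-step d b e δ with Covered.forth (coil d b e) (r ^ᶻ suc d * δ)
    odd-step d b refl δ | inj₂ J = _ , _ , _ , jump-mono coils⊑ J , inj₁ (index d b) ,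
      straight (suc (h ℕ.+ b)) (suc d) (exponent d b)
      where index : ∀ d b → suc d ℕ.+ suc (b ℕ.+ b) ≡ suc (suc (d ℕ.+ b) ℕ.+ b)
            index = ℕ-Solver.solve-∀
            exponent : ∀ d b → suc (suc (d ℕ.+ b) ℕ.+ b) ℕ.+ suc d ≡ suc (suc (d ℕ.+ b) ℕ.+ suc (d ℕ.+ b))
            exponent = ℕ-Solver.solve-∀
    odd-step d zero refl δ | inj₁ A≈ = _ , _ , _ , entry , inj₁ refl , detour 1 (suc d) 1 A≈ (exponent d)
      where exponent : ∀ d → 1 ℕ.+ suc (d ℕ.+ 0) ℕ.+ suc d ≡ 1 ℕ.* suc (suc (d ℕ.+ 0) ℕ.+ suc (d ℕ.+ 0))
            exponent = ℕ-Solver.solve-∀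
    odd-step d (suc b) refl δ | inj₁ A≈ = _ , _ , _ ,
      jump-mono coils⊑ (proj₁ (N.nest-connected 1 h′ P₁ b d (commute b d) (ℕₚ.+-comm 1 b))) , inj₂ (index d b) ,
      detour (suc (suc b)) (suc d) 1 A≈ (exponent d b)
      where commute : ∀ b d → b ℕ.+ suc d ≡ d ℕ.+ suc b
            commute = ℕ-Solver.solve-∀
            index : ∀ d b → suc (suc (d ℕ.+ suc b) ℕ.+ suc d) ℕ.+ suc (suc b ℕ.+ suc b) ≡
                    suc (suc b) ℕ.+ suc (suc (d ℕ.+ suc b) ℕ.+ suc (d ℕ.+ suc b))
            index = ℕ-Solver.solve-∀
            exponent : ∀ d b → suc (suc b) ℕ.+ suc (d ℕ.+ suc b) ℕ.+ suc d ≡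
                       1 ℕ.* suc (suc (d ℕ.+ suc b) ℕ.+ suc (d ℕ.+ suc b))
            exponent = ℕ-Solver.solve-∀

    -- The same pairs in the backward direction, with the difference q - (2b + 1) = 2 (d + 1). For b
    -- = 0 the exit to coset 0 takes the part of the entry; for b > 0 the exponents add up to 2q
    -- instead of q.
    even-step : ∀ d b → d ℕ.+ b ≡ h′ → ∀ δ → Step (suc d ℕ.+ suc d) δ
    even-step d b e δ with Covered.back (coil d b e) (r ^ᶻ suc (h ℕ.+ b) * δ)
    even-step d b refl δ | inj₂ J = _ , _ , _ , jump-mono coils⊑ J , inj₂ (index d b) ,
      straight (suc d) (suc (h ℕ.+ b)) (exponent d b)
      where index : ∀ d b → suc (suc (d ℕ.+ b) ℕ.+ b) ℕ.+ (suc d ℕ.+ suc d) ≡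
                    suc d ℕ.+ suc (suc (d ℕ.+ b) ℕ.+ suc (d ℕ.+ b))
            index = ℕ-Solver.solve-∀
            exponent : ∀ d b → suc d ℕ.+ suc (suc (d ℕ.+ b) ℕ.+ b) ≡ suc (suc (d ℕ.+ b) ℕ.+ suc (d ℕ.+ b))
            exponent = ℕ-Solver.solve-∀
    even-step d zero refl δ | inj₁ B≈ = _ , _ , _ , exit , inj₂ (index d) , detour 0 (suc (h ℕ.+ 0)) 1 B≈ (exponent d)
      where index : ∀ d → 1 ℕ.+ (suc d ℕ.+ suc d) ≡ 0 ℕ.+ suc (suc (d ℕ.+ 0) ℕ.+ suc (d ℕ.+ 0))
            index = ℕ-Solver.solve-∀
            exponent : ∀ d → 0 ℕ.+ suc (d ℕ.+ 0) ℕ.+ suc (suc (d ℕ.+ 0) ℕ.+ 0) ≡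
                       1 ℕ.* suc (suc (d ℕ.+ 0) ℕ.+ suc (d ℕ.+ 0))
            exponent = ℕ-Solver.solve-∀
    even-step d (suc b) refl δ | inj₁ B≈ = _ , _ , _ ,
      jump-mono coils⊑ (proj₂ (N.nest-connected 1 h′ P₁ b d (commute b d) (ℕₚ.+-comm 1 b))) , inj₁ (index d b) ,
      detour (suc (h ℕ.+ suc d)) (suc (h ℕ.+ suc b)) 2 B≈ (exponent d b)
      where commute : ∀ b d → b ℕ.+ suc d ≡ d ℕ.+ suc b
            commute = ℕ-Solver.solve-∀
            index : ∀ d b → suc (suc b) ℕ.+ (suc d ℕ.+ suc d) ≡ suc (suc (d ℕ.+ suc b) ℕ.+ suc d)
            index = ℕ-Solver.solve-∀
            exponent : ∀ d b → suc (suc (d ℕ.+ suc b) ℕ.+ suc d) ℕ.+ suc (d ℕ.+ suc b) ℕ.+ suc (suc (d ℕ.+ suc b) ℕ.+ suc b) ≡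
                       2 ℕ.* suc (suc (d ℕ.+ suc b) ℕ.+ suc (d ℕ.+ suc b))
            exponent = ℕ-Solver.solve-∀

  steps : ∀ d δ → d ℕ.< q → (d ≡ 0 → δ ≉ 0ℤ) → Step d δ
  steps d δ d<q ok with halve d
  ... | zero  , inj₁ refl = level-step δ (ok refl)
  ... | suc e , inj₁ refl = even-step e (h′ ℕ.∸ e) (ℕₚ.m+[n∸m]≡n
        (ℕₚ.≤-pred (ℕₚ.≤-pred (double-cancel-< (suc e) (suc h) (ℕₚ.<-trans d<q (ℕ.s≤s (ℕₚ.+-monoʳ-< h (ℕₚ.n<1+n h)))))))) δ
  ... | b     , inj₂ refl = odd-step (h′ ℕ.∸ b) b (ℕₚ.m∸n+n≡m (ℕₚ.≤-pred (double-cancel-< b h (ℕₚ.≤-pred d<q)))) δ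

-- Realisation in the group

module Residues (n : ℕ) .{{_ : NonZero n}} where
  open Mod n

  rep : Fin n → ℤ
  rep x = + toℕ x

  rep-injective : ∀ {x y} → rep x ≈ rep y → x ≡ y
  rep-injective {x} {y} e = Finₚ.toℕ-injective (residue-unique (Finₚ.toℕ<n x) (Finₚ.toℕ<n y) e)

  %-≈ : ∀ k → + (k % n) ≈ + k
  %-≈ k = ≈-sym (shift-modulus (+ (k / n)) (trans (cong +_ (m≡m%n+[m/n]*n k n))
    (cong (λ z → + (k % n) + z) (ℤₚ.pos-* (k / n) n))))

  rep-fromℕ< : ∀ k → rep (fromℕ< (m%n<n k n)) ≈ + k
  rep-fromℕ< k = ≈-trans (≡⇒≈ (cong +_ (Finₚ.toℕ-fromℕ< (m%n<n k n)))) (%-≈ k)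

  rep-add : ∀ x y → rep (addMod n x y) ≈ rep x + rep y
  rep-add x y = rep-fromℕ< (toℕ x ℕ.+ toℕ y)

  rep-neg : ∀ x → rep (negMod n x) ≈ - rep x
  rep-neg x = ≈-trans (rep-fromℕ< (n ℕ.∸ toℕ x)) (shift-modulus 1ℤ
    (trans (lemma (+ (n ℕ.∸ toℕ x)) (+ toℕ x)) (cong (λ z → - + toℕ x + 1ℤ * + z) (ℕₚ.m∸n+n≡m (ℕₚ.<⇒≤ (Finₚ.toℕ<n x))))))
    where lemma : ∀ a b → a ≡ - b + 1ℤ * (a + b)
          lemma = solve-∀

  rep-zero : rep (zeroMod n) ≈ 0ℤ
  rep-zero = rep-fromℕ< 0

  class : ℤ → Fin n
  class w = fromℕ< (proj₁ (proj₂ (residue w)))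

  rep-class : ∀ w → rep (class w) ≈ w
  rep-class w = ≈-trans (≡⇒≈ (cong +_ (Finₚ.toℕ-fromℕ< (proj₁ (proj₂ (residue w)))))) (≈-sym (proj₂ (proj₂ (residue w))))

private abstract
  additive-zero : ∀ a b → b - 0ℤ ≡ - 1ℤ * (a - (b + b)) + 1ℤ * (a - b)
  additive-zero = solve-∀
  additive-suc : ∀ a r b k → a - r * (1ℤ + k) ≡ 1ℤ * (a - (r + b)) + 1ℤ * (b - r * k)
  additive-suc = solve-∀
  fixed : ∀ a r x → a - x ≡ 1ℤ * (a - r * x) + x * (r - 1ℤ)
  fixed = solve-∀
  iterate : ∀ a r b p x → a - r * p * x ≡ 1ℤ * (a - r * b) + r * (b - p * x)
  iterate = solve-∀

module Realisation (H h′ : ℕ) where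
  h m q : ℕ
  h = suc h′
  m = suc (H ℕ.+ H)
  q = suc (h ℕ.+ h)

  private
    module Rm = Residues m
    module Rq = Residues q
  open Mod m

  module _ (α : Fin m → Fin m) (auto : IsAutomorphism m α) (order : HasOrder m α q) where
    open SemiDirect q m α
    open Rm

    private
      r n : ℤ
      r = rep (α (class 1ℤ))
      n = + suc H

      -- Induction by additivity: α is multiplication by its value at 1. The base case uses that
      -- α(0) = α(0) + α(0).
      α-class : ∀ k → rep (α (class (+ k))) ≈ r * + k
      α-class zero = ≈-trans α0≈0 (≡⇒≈ (sym (ℤₚ.*-zeroʳ r)))
        where
        α0≈0 : rep (α (class 0ℤ)) ≈ 0ℤ
        α0≈0 = lin₂ (- 1ℤ) 1ℤ (additive-zero (rep (α (class 0ℤ))) (rep (α (class 0ℤ))))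
          (≈-trans (≡⇒≈ (cong rep (trans (cong α (rep-injective (≈-sym sum))) (proj₁ auto (class 0ℤ) (class 0ℤ)))))
                   (rep-add (α (class 0ℤ)) (α (class 0ℤ)))) (≡⇒≈ {rep (α (class 0ℤ))} refl)
          where sum : rep (addMod m (class 0ℤ) (class 0ℤ)) ≈ rep (class 0ℤ)
                sum = ≈-trans (rep-add (class 0ℤ) (class 0ℤ))
                        (≈-trans (≈-+ (rep-class 0ℤ) (rep-class 0ℤ)) (≈-sym (rep-class 0ℤ)))
      α-class (suc k) = lin₂ 1ℤ 1ℤ (additive-suc (rep (α (class (+ suc k)))) r (rep (α (class (+ k)))) (+ k))
        (≈-trans (≡⇒≈ (cong rep (trans (cong α (rep-injective (≈-sym sum))) (proj₁ auto (class 1ℤ) (class (+ k))))))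
                 (rep-add (α (class 1ℤ)) (α (class (+ k))))) (α-class k)
        where sum : rep (addMod m (class 1ℤ) (class (+ k))) ≈ rep (class (+ suc k))
              sum = ≈-trans (rep-add (class 1ℤ) (class (+ k)))
                      (≈-trans (≈-+ (rep-class 1ℤ) (rep-class (+ k))) (≈-sym (rep-class (+ suc k))))

      rep-α : ∀ x → rep (α x) ≈ r * rep x
      rep-α x = ≈-trans (≡⇒≈ (cong (rep ∘ α) (rep-injective (≈-sym (rep-class (rep x)))))) (α-class (toℕ x))

      rep-iter : ∀ k x → rep (iter α k x) ≈ r ^ᶻ k * rep x
      rep-iter zero    x = ≡⇒≈ (sym (ℤₚ.*-identityˡ _))
      rep-iter (suc k) x = lin₂ 1ℤ r (iterate (rep (iter α (suc k) x)) r (rep (iter α k x)) (r ^ᶻ k) (rep x)) (rep-α (iter α k x)) (rep-iter k x)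

      abstract
        r^q≈1 : r ^ᶻ q ≈ 1ℤ
        r^q≈1 = ≈-trans (≡⇒≈ (sym (ℤₚ.*-identityʳ _))) (≈-trans (≈-*ˡ (r ^ᶻ q) (≈-sym (rep-class 1ℤ)))
          (≈-trans (≈-sym (rep-iter q (class 1ℤ))) (≈-trans (≡⇒≈ (cong rep (proj₁ order (class 1ℤ)))) (rep-class 1ℤ))))

        r≉1 : r ≉ 1ℤ
        r≉1 r≈1 = proj₂ order 1 (ℕ.s≤s ℕ.z≤n) (ℕ.s≤s (ℕ.s≤s ℕ.z≤n))
          λ x → rep-injective (lin₂ 1ℤ (rep x) (fixed (rep (α x)) r (rep x)) (rep-α x) r≈1)

        n-half : + 2 * n ≈ 1ℤ
        n-half = shift-modulus 1ℤ (lemma (+ H))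
          where lemma : ∀ h → + 2 * (1ℤ + h) ≡ 1ℤ + 1ℤ * (1ℤ + (h + h))
                lemma = solve-∀

        chosen : Pieces m (r ^ᶻ h)
        chosen = pieces {H} {h} {r} {n} n-half r^q≈1 r≉1

      module T = Tour H h′ {r} {n} n-half r^q≈1 chosen

      power-% : ∀ k → r ^ᶻ (k % q) ≈ r ^ᶻ k
      power-% k = ≈-sym (≈-trans (≡⇒≈ (trans (cong (r ^ᶻ_) (m≡m%n+[m/n]*n k q)) (^ᶻ-+ r (k % q) (k / q ℕ.* q))))
        (≈-trans (≈-*ˡ (r ^ᶻ (k % q)) (≈-trans (≡⇒≈ (^ᶻ-*ℕ r (k / q) q)) (≈-trans (^ᶻ-cong (k / q) r^q≈1) (≡⇒≈ (1^ᶻ (k / q))))))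
                 (≡⇒≈ (ℤₚ.*-identityʳ _))))

      power-one : ∀ {k} → Mod._≈_ q (+ k) 0ℤ → r ^ᶻ k ≈ 1ℤ
      power-one {k} e = ≈-trans (≈-sym (power-% k)) (≡⇒≈ (cong (r ^ᶻ_)
        (Mod.residue-unique q (m%n<n k q) (ℕ.s≤s ℕ.z≤n) (Mod.≈-trans q (Rq.%-≈ k) e))))

      place : Vertex → SD q m
      place (u , w) = fromℕ< (m%n<n u q) , class (r ^ᶻ u * w)

      undo : ∀ (U : Fin q) u → Mod._≈_ q (Rq.rep U) (+ u) → r ^ᶻ toℕ (negMod q U) * r ^ᶻ u ≈ 1ℤ
      undo U u e = ≈-trans (≡⇒≈ (sym (^ᶻ-+ r (toℕ (negMod q U)) u)))
        (power-one (Mod.lin₂ q 1ℤ (- 1ℤ) (lemma (Rq.rep (negMod q U)) (Rq.rep U) (+ u)) (Rq.rep-neg U) e))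
        where lemma : ∀ a b u → a + u - 0ℤ ≡ 1ℤ * (a - - b) + - 1ℤ * (b - u)
              lemma = solve-∀

      -- The power r^(-u) from the inverse cancels the r^u from `place`, which leaves r^u′ (w′ - w).
      -- This cancellation is the reason for recording r^u w as w.
      label : ∀ {u w u′ w′ d δ} (D : Fin q) (Δ : Fin m) →
              Mod._≈_ q (+ u + + d) (+ u′) → Rq.rep D ≡ + d → r ^ᶻ u′ * (w′ - w) ≈ δ → rep Δ ≡ δ →
              mul (inv (place (u , w))) (place (u′ , w′)) ≡ (D , Δ)
      label {u} {w} {u′} {w′} {d} D Δ e refl e′ refl = cong₂ _,_
        (Rq.rep-injective (Mod.≈-trans q (Rq.rep-add (negMod q U) U′)
          (Mod.lin₃ q 1ℤ 1ℤ (- 1ℤ) (first (Rq.rep (negMod q U)) (Rq.rep U′) (+ d) (+ u) (+ u′) (Rq.rep U))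
            (Rq.rep-neg U) (Rq.rep-fromℕ< u′) backward)))
        (rep-injective (≈-trans (rep-add (iter α (toℕ U′) (negMod m V)) (class (r ^ᶻ u′ * w′))) (≈-trans
          (combine {C = r ^ᶻ toℕ U′} {rep (negMod m V)} {r ^ᶻ toℕ (negMod q U)} {r ^ᶻ u}
            (rep-iter (toℕ U′) (negMod m V)) (rep-class (r ^ᶻ u′ * w′))
            (≈-trans (rep-neg V) (neg-cong (≈-trans (rep-iter (toℕ (negMod q U)) (class (r ^ᶻ u * w)))
              (≈-*ˡ (r ^ᶻ toℕ (negMod q U)) (rep-class (r ^ᶻ u * w))))))
            (≈-trans (≡⇒≈ (cong (r ^ᶻ_) (Finₚ.toℕ-fromℕ< (m%n<n u′ q)))) (power-% u′))
            (undo U u (Rq.rep-fromℕ< u))) e′)))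
        where
        U U′ : Fin q
        U  = fromℕ< (m%n<n u q)
        U′ = fromℕ< (m%n<n u′ q)
        V : Fin m
        V = iter α (toℕ (negMod q U)) (class (r ^ᶻ u * w))
        first : ∀ a b d u u′ v → a + b - d ≡ 1ℤ * (a - - v) + 1ℤ * (b - u′) + - 1ℤ * (v + d - u′)
        first = solve-∀
        second : ∀ u d u′ v → v + d - u′ ≡ 1ℤ * (u + d - u′) + 1ℤ * (v - u)
        second = solve-∀
        backward : Mod._≈_ q (Rq.rep U + + d) (+ u′)
        backward = Mod.lin₂ q 1ℤ 1ℤ (second (+ u) (+ d) (+ u′) (Rq.rep U)) e (Rq.rep-fromℕ< u)
        neg-cong : ∀ {a b} → a ≈ b → - a ≈ - b
        neg-cong {a} {b} = lin₁ (- 1ℤ) (lemma a b)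
          where lemma : ∀ a b → - a - - b ≡ - 1ℤ * (a - b)
                lemma = solve-∀
        combine : ∀ {A B C N s p} → A ≈ C * N → B ≈ r ^ᶻ u′ * w′ → N ≈ - (s * (p * w)) → C ≈ r ^ᶻ u′ → s * p ≈ 1ℤ →
                A + B ≈ r ^ᶻ u′ * (w′ - w)
        combine {A} {B} {C} {N} {s} {p} a b c d e =
          ≈-trans (≈-+ (≈-trans a (≈-* d (≈-trans c (neg-cong (≈-trans (≡⇒≈ (sym (ℤₚ.*-assoc s p w))) (≈-* e (≡⇒≈ refl))))))) b)
                  (≡⇒≈ (lemma (r ^ᶻ u′) w w′))
          where lemma : ∀ t w w′ → t * - (1ℤ * w) + t * w′ ≡ t * (w′ - w)
                lemma = solve-∀

      quotient-∈ : ∀ {a b l} → Adj a b l → mul (inv a) b ∈ quotients l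
      quotient-∈ here = here refl
      quotient-∈ {l = _ ∷ _ ∷ _} (there p) = there (quotient-∈ p)

      length-quotients : ∀ l {k} → length l ≡ suc k → suc (length (quotients l)) ≡ suc k
      length-quotients (a ∷ [])    e = e
      length-quotients (a ∷ b ∷ l) {suc k} e = cong suc (length-quotients (b ∷ l) (ℕₚ.suc-injective e))

      sequence : List (SD q m)
      sequence = map place T.tour

      length-sequence : length sequence ≡ q ℕ.* m
      length-sequence = trans (length-map place T.tour) T.length-tour

      covers : ∀ g → g ∈ sequence
      covers (U , W) with T.vertices (toℕ U) (r ^ᶻ toℕ (negMod q U) * rep W) (Finₚ.toℕ<n U)
      ... | w , p , e = subst (_∈ sequence) (cong₂ _,_
          (Finₚ.toℕ-injective (trans (Finₚ.toℕ-fromℕ< _) (m<n⇒m%n≡m (Finₚ.toℕ<n U))))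
          (rep-injective (≈-trans (rep-class _) (≈-trans (≈-*ˡ (r ^ᶻ toℕ U) e)
            (lin₁ (rep W) (lemma (r ^ᶻ toℕ U) (r ^ᶻ toℕ (negMod q U)) (rep W)) (undo U (toℕ U) (Mod.≡⇒≈ q refl)))))))
          (∈-map⁺ place p)
        where
        lemma : ∀ t s w → t * (s * w) - w ≡ w * (s * t - 1ℤ)
        lemma = solve-∀

      covers-quotients : ∀ g → ¬ g ≡ e → g ∈ quotients sequence
      covers-quotients (D , Δ) g≢e with T.steps (toℕ D) (rep Δ) (Finₚ.toℕ<n D)
        (λ D≡0 Δ≈0 → g≢e (cong₂ _,_ (Rq.rep-injective (Mod.≈-trans q (Mod.≡⇒≈ q (cong +_ D≡0)) (Mod.≈-sym q Rq.rep-zero)))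
                                    (rep-injective (≈-trans Δ≈0 (≈-sym rep-zero)))))
      ... | u , u′ , δ′ , (w , w′ , p , diff) , ud , r^u′δ′≈δ =
        subst (_∈ quotients sequence)
          (label D Δ (shifted ud) refl (≈-trans (≈-*ˡ (r ^ᶻ u′) diff) r^u′δ′≈δ) refl)
          (quotient-∈ (adj-map place p))
        where
        shifted : u ℕ.+ toℕ D ≡ u′ ⊎ u ℕ.+ toℕ D ≡ u′ ℕ.+ q → Mod._≈_ q (+ u + + toℕ D) (+ u′)
        shifted (inj₁ eq) = Mod.≡⇒≈ q (cong +_ eq)
        shifted (inj₂ eq) = Mod.shift-modulus q 1ℤ (trans (cong +_ eq) (cong (λ z → + u′ + z) (sym (ℤₚ.*-identityˡ (+ q)))))

      all-quotients : ∀ g → g ∈ e ∷ quotients sequence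
      all-quotients g with ≡-dec Finₚ._≟_ Finₚ._≟_ g e
      ... | yes g≡e = here g≡e
      ... | no  g≢e = there (covers-quotients g g≢e)

      -- With `e` in front, the quotients form a list of length q m that meets every element.
      -- Counting then shows both facts at once: no quotient repeats, and none equals `e`.
      distinct : Unique (e ∷ quotients sequence)
      distinct = cover⇒unique (e ∷ quotients sequence) (length-quotients sequence length-sequence) all-quotients

    sequenceable : Sequenceable
    sequenceable = sequence , cover⇒unique sequence length-sequence covers , covers , AllPairs.tail distinct ,
      (λ g g∈ g≡e → All.lookup (AllPairs.head distinct) g∈ (sym g≡e)) , covers-quotients

odd-form : ∀ n → n % 2 ≡ 1 → ∃ λ k → n ≡ suc (k ℕ.+ k)
odd-form n e = n / 2 , trans (m≡m%n+[m/n]*n n 2) (trans (cong (ℕ._+ n / 2 ℕ.* 2) e) (cong suc (lemma (n / 2))))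
  where lemma : ∀ k → k ℕ.* 2 ≡ k ℕ.+ k
        lemma = ℕ-Solver.solve-∀

theorem3p7 : (q m : ℕ) .{{_ : NonZero q}} .{{_ : NonZero m}} →
    Prime q → q % 2 ≡ 1 → m % 2 ≡ 1 →
    ((q ^ 2) ∣ m ⊎ ∃ (λ p → Prime p × p % q ≡ 1 × p ∣ m)) →
    (α : Fin m → Fin m) → IsAutomorphism m α → HasOrder m α q →
    SemiDirect.Sequenceable q m α
theorem3p7 q m q-prime q-odd m-odd _ α auto order with odd-form q q-odd | odd-form m m-odd
... | suc h′ , refl | H , refl = Realisation.sequenceable H h′ α auto order
... | zero   , refl | _        = contradiction (prime⇒nonTrivial q-prime) λ ()
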